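{- Let $d>0$ be a real number and let $G$ be a (finite, simple, nonempty) spectrally $d$-degenerate graph. Then $G$ contains a vertex whose degree is at most $\max\{4d,\,4d\log_2(\Delta(G)/d)\}$.
   Context: All graphs are finite and simple (no loops or multiple edges). $\Delta(G)$ is the maximum degree of $G$; $\rho(G)$ is the spectral radius of $G$, i.e. the largest eigenvalue of its adjacency matrix. A graph $G$ is spectrally $d$-degenerate if every subgraph $H\subseteq G$ satisfies $\rho(H)\le\sqrt{d\,\Delta(H)}$. If $\Delta(G)=0$, then $\log_2(\Delta(G)/d)$ is read as $-\infty$, so that the bound is $4d$. -}

module Defs where

open import Data.Bool.Base using (Bool; true; false; if_then_else_)
open import Data.Fin.Base using (Fin)
open import Data.Fin.Subset using (∣_∣)
open import Data.Integer.Base as ℤ using (ℤ; -[1+_])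
open import Data.Nat.Base as ℕ using (ℕ; zero; suc)
import Data.Nat.Properties as ℕ
open import Data.Product using (Σ; ∃-syntax; _×_; _,_; proj₁; proj₂)
open import Data.Rational.Base as ℚ hiding (∣_∣)
open import Data.Rational.Properties
open import Data.Rational.Solver using (module +-*-Solver)
open import Data.Sum using (inj₁; inj₂)
open import Data.Vec.Base using (tabulate)
open import Data.Vec.Functional using (foldr)
open import Function.Definitions using (Injective)
open import Relation.Binary.PropositionalEquality
open import Relation.Nullary using (¬_)

open +-*-Solver using (solve; _:+_; _:*_; _:-_; :-_; _:=_)

------------------------------------------------------------------------

abs≤ : ∀ {p q ε} → p ≤ q + ε → q ≤ p + ε → ℚ.∣ p - q ∣ ≤ ε
abs≤ {p} {q} {ε} p≤ q≤ with ∣p∣≡p∨∣p∣≡-p (p - q)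
... | inj₁ e = begin
  ℚ.∣ p - q ∣     ≡⟨ e ⟩
  p - q           ≤⟨ +-monoˡ-≤ (- q) p≤ ⟩
  q + ε - q       ≡⟨ solve 2 (λ q e → q :+ e :- q := e) refl q ε ⟩
  ε               ∎
  where open ≤-Reasoning
... | inj₂ e = begin
  ℚ.∣ p - q ∣     ≡⟨ e ⟩
  - (p - q)       ≡⟨ solve 2 (λ p q → :- (p :- q) := q :- p) refl p q ⟩
  q - p           ≤⟨ +-monoˡ-≤ (- p) q≤ ⟩
  p + ε - p       ≡⟨ solve 2 (λ q e → q :+ e :- q := e) refl p ε ⟩
  ε               ∎
  where open ≤-Reasoning

p≤∣p∣ : ∀ p → p ≤ ℚ.∣ p ∣
p≤∣p∣ p with ≤-total 0ℚ p
... | inj₁ 0≤p = ≤-reflexive (sym (0≤p⇒∣p∣≡p 0≤p))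
... | inj₂ p≤0 = ≤-trans p≤0 (0≤∣p∣ p)

∣p-q∣≡∣q-p∣ : ∀ p q → ℚ.∣ p - q ∣ ≡ ℚ.∣ q - p ∣
∣p-q∣≡∣q-p∣ p q = trans
  (cong ℚ.∣_∣ (solve 2 (λ p q → p :- q := :- (q :- p)) refl p q))
  (∣-p∣≡∣p∣ (q - p))

abs≤⁻¹ : ∀ p q {ε} → ℚ.∣ p - q ∣ ≤ ε → p ≤ q + ε
abs≤⁻¹ p q {ε} h = begin
  p               ≡⟨ solve 2 (λ p q → p := q :+ (p :- q)) refl p q ⟩
  q + (p - q)     ≤⟨ +-monoʳ-≤ q (≤-trans (p≤∣p∣ (p - q)) h) ⟩
  q + ε           ∎
  where open ≤-Reasoning

⊔-close : ∀ a b c e {ε} → ℚ.∣ a - c ∣ ≤ ε → ℚ.∣ b - e ∣ ≤ ε →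
          ℚ.∣ (a ⊔ b) - (c ⊔ e) ∣ ≤ ε
⊔-close a b c e {ε} h k = abs≤
  (⊔-lub (≤-trans (abs≤⁻¹ a c h) (+-monoˡ-≤ ε (p≤p⊔q c e)))
         (≤-trans (abs≤⁻¹ b e k) (+-monoˡ-≤ ε (p≤q⊔p c e))))
  (⊔-lub (≤-trans (abs≤⁻¹ c a (flip a c h)) (+-monoˡ-≤ ε (p≤p⊔q a b)))
         (≤-trans (abs≤⁻¹ e b (flip b e k)) (+-monoˡ-≤ ε (p≤q⊔p a b))))
  where
  flip : ∀ p q → ℚ.∣ p - q ∣ ≤ ε → ℚ.∣ q - p ∣ ≤ ε
  flip p q = subst (_≤ ε) (∣p-q∣≡∣q-p∣ p q)

0<* : ∀ p q → 0ℚ < p → 0ℚ < q → 0ℚ < p * q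
0<* p q 0<p 0<q = positive⁻¹ (p * q) {{pos*pos⇒pos p {{positive 0<p}} q {{positive 0<q}}}}

0<½* : ∀ {ε} → 0ℚ < ε → 0ℚ < ½ * ε
0<½* {ε} = 0<* ½ ε (positive⁻¹ ½)

½*+½* : ∀ ε → ½ * ε + ½ * ε ≡ ε
½*+½* ε = trans (sym (*-distribʳ-+ ε ½ ½)) (*-identityˡ ε)

1/⁺ : (p : ℚ) → 0ℚ < p → ℚ
1/⁺ p 0<p = (1/ p) {{>-nonZero 0<p}}

0<1/⁺ : ∀ p (0<p : 0ℚ < p) → 0ℚ < 1/⁺ p 0<p
0<1/⁺ p 0<p = positive⁻¹ _ {{1/pos⇒pos p {{positive 0<p}}}}

*-1/⁺ : ∀ p (0<p : 0ℚ < p) → p * 1/⁺ p 0<p ≡ 1ℚ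
*-1/⁺ p 0<p = *-inverseʳ p {{>-nonZero 0<p}}

divide : ∀ {ε B} → 0ℚ < ε → 0ℚ < B → ∃[ δ ] (0ℚ < δ × δ * B ≡ ε)
divide {ε} {B} 0<ε 0<B = ε * 1/⁺ B 0<B ,
  0<* ε (1/⁺ B 0<B) 0<ε (0<1/⁺ B 0<B) ,
  (begin
    ε * 1/⁺ B 0<B * B     ≡⟨ solve 3 (λ x y z → x :* y :* z := (z :* y) :* x) refl ε (1/⁺ B 0<B) B ⟩
    B * 1/⁺ B 0<B * ε     ≡⟨ cong (_* ε) (*-1/⁺ B 0<B) ⟩
    1ℚ * ε                ≡⟨ *-identityˡ ε ⟩
    ε                     ∎)
  where open ≡-Reasoning

*-mono-≤₀ : ∀ {p q r s} → 0ℚ ≤ p → p ≤ q → 0ℚ ≤ r → r ≤ s → p * r ≤ q * s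
*-mono-≤₀ {p} {q} {r} {s} 0≤p p≤q 0≤r r≤s = ≤-trans
  (*-monoʳ-≤-nonNeg r {{nonNegative 0≤r}} p≤q)
  (*-monoˡ-≤-nonNeg q {{nonNegative (≤-trans 0≤p p≤q)}} r≤s)

1/⁺-anti : ∀ {p q} (0<p : 0ℚ < p) (0<q : 0ℚ < q) → p ≤ q → 1/⁺ q 0<q ≤ 1/⁺ p 0<p
1/⁺-anti {p} {q} 0<p 0<q p≤q = begin
  q⁻             ≡⟨ *-identityʳ q⁻ ⟨
  q⁻ * 1ℚ        ≡⟨ cong (q⁻ *_) (*-1/⁺ p 0<p) ⟨
  q⁻ * (p * p⁻)  ≤⟨ *-monoˡ-≤-nonNeg q⁻ {{nonNegative 0≤q⁻}}
                      (*-monoʳ-≤-nonNeg p⁻ {{nonNegative 0≤p⁻}} p≤q) ⟩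
  q⁻ * (q * p⁻)  ≡⟨ solve 3 (λ x y z → x :* (y :* z) := (y :* x) :* z) refl q⁻ q p⁻ ⟩
  q * q⁻ * p⁻    ≡⟨ cong (_* p⁻) (*-1/⁺ q 0<q) ⟩
  1ℚ * p⁻        ≡⟨ *-identityˡ p⁻ ⟩
  p⁻             ∎
  where
  open ≤-Reasoning
  p⁻ = 1/⁺ p 0<p
  q⁻ = 1/⁺ q 0<q
  0≤p⁻ = <⇒≤ (0<1/⁺ p 0<p)
  0≤q⁻ = <⇒≤ (0<1/⁺ q 0<q)

+-close : ∀ a b c e {ε} → ℚ.∣ a - c ∣ ≤ ½ * ε → ℚ.∣ b - e ∣ ≤ ½ * ε →
          ℚ.∣ (a + b) - (c + e) ∣ ≤ ε
+-close a b c e {ε} h k = begin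
  ℚ.∣ (a + b) - (c + e) ∣     ≡⟨ cong ℚ.∣_∣ (solve 4 (λ a b c e →
                                   (a :+ b) :- (c :+ e) := (a :- c) :+ (b :- e)) refl a b c e) ⟩
  ℚ.∣ (a - c) + (b - e) ∣     ≤⟨ ∣p+q∣≤∣p∣+∣q∣ (a - c) (b - e) ⟩
  ℚ.∣ a - c ∣ + ℚ.∣ b - e ∣   ≤⟨ +-mono-≤ h k ⟩
  ½ * ε + ½ * ε               ≡⟨ ½*+½* ε ⟩
  ε                           ∎
  where open ≤-Reasoning

*-close : ∀ a b c e {ε A B δ η} →
          ℚ.∣ a ∣ ≤ A → ℚ.∣ e ∣ ≤ B → δ * B ≡ ½ * ε → η * A ≡ ½ * ε →
          ℚ.∣ a - c ∣ ≤ δ → ℚ.∣ b - e ∣ ≤ η → ℚ.∣ a * b - c * e ∣ ≤ ε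
*-close a b c e {ε} {A} {B} {δ} {η} a≤A e≤B δB ηA h k = begin
  ℚ.∣ a * b - c * e ∣                            ≡⟨ cong ℚ.∣_∣ (solve 4 (λ a b c e →
                                                      a :* b :- c :* e := (a :- c) :* e :+ (b :- e) :* a) refl a b c e) ⟩
  ℚ.∣ (a - c) * e + (b - e) * a ∣                ≤⟨ ∣p+q∣≤∣p∣+∣q∣ ((a - c) * e) ((b - e) * a) ⟩
  ℚ.∣ (a - c) * e ∣ + ℚ.∣ (b - e) * a ∣          ≡⟨ cong₂ _+_ (∣p*q∣≡∣p∣*∣q∣ (a - c) e) (∣p*q∣≡∣p∣*∣q∣ (b - e) a) ⟩
  ℚ.∣ a - c ∣ * ℚ.∣ e ∣ + ℚ.∣ b - e ∣ * ℚ.∣ a ∣  ≤⟨ +-mono-≤ (*-mono-≤₀ (0≤∣p∣ (a - c)) h (0≤∣p∣ e) e≤B)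
                                                             (*-mono-≤₀ (0≤∣p∣ (b - e)) k (0≤∣p∣ a) a≤A) ⟩
  δ * B + η * A                                  ≡⟨ cong₂ _+_ δB ηA ⟩
  ½ * ε + ½ * ε                                  ≡⟨ ½*+½* ε ⟩
  ε                                              ∎
  where open ≤-Reasoning

1/⁺-close : ∀ a b {a⁻ b⁻ c⁻ δ ε} → a * a⁻ ≡ 1ℚ → b * b⁻ ≡ 1ℚ →
            0ℚ ≤ a⁻ → 0ℚ ≤ b⁻ → a⁻ ≤ c⁻ → b⁻ ≤ c⁻ → δ * (c⁻ * c⁻) ≡ ε →
            ℚ.∣ b - a ∣ ≤ δ → ℚ.∣ a⁻ - b⁻ ∣ ≤ ε
1/⁺-close a b {a⁻} {b⁻} {c⁻} {δ} {ε} p q 0≤a⁻ 0≤b⁻ a⁻≤ b⁻≤ δcc h = begin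
  ℚ.∣ a⁻ - b⁻ ∣                        ≡⟨ cong ℚ.∣_∣ diff ⟨
  ℚ.∣ (b - a) * (a⁻ * b⁻) ∣            ≡⟨ ∣p*q∣≡∣p∣*∣q∣ (b - a) (a⁻ * b⁻) ⟩
  ℚ.∣ b - a ∣ * ℚ.∣ a⁻ * b⁻ ∣          ≡⟨ cong (ℚ.∣ b - a ∣ *_) (0≤p⇒∣p∣≡p 0≤a⁻b⁻) ⟩
  ℚ.∣ b - a ∣ * (a⁻ * b⁻)              ≤⟨ *-mono-≤₀ (0≤∣p∣ (b - a)) h 0≤a⁻b⁻ (*-mono-≤₀ 0≤a⁻ a⁻≤ 0≤b⁻ b⁻≤) ⟩
  δ * (c⁻ * c⁻)                        ≡⟨ δcc ⟩
  ε                                    ∎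
  where
  open ≤-Reasoning
  0≤a⁻b⁻ : 0ℚ ≤ a⁻ * b⁻
  0≤a⁻b⁻ = *-mono-≤₀ (≤-refl {0ℚ}) 0≤a⁻ (≤-refl {0ℚ}) 0≤b⁻
  diff : (b - a) * (a⁻ * b⁻) ≡ a⁻ - b⁻
  diff = begin-equality
    (b - a) * (a⁻ * b⁻)              ≡⟨ solve 4 (λ a b x y →
                                          (b :- a) :* (x :* y) := (b :* y) :* x :- (a :* x) :* y) refl a b a⁻ b⁻ ⟩
    b * b⁻ * a⁻ - a * a⁻ * b⁻        ≡⟨ cong₂ (λ u v → u * a⁻ - v * b⁻) q p ⟩
    1ℚ * a⁻ - 1ℚ * b⁻                ≡⟨ cong₂ _-_ (*-identityˡ a⁻) (*-identityˡ b⁻) ⟩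
    a⁻ - b⁻                          ∎

------------------------------------------------------------------------

-- The real numbers: Cauchy sequences of rationals, with _≈ᵣ_ as equality.
record ℝ : Set where
  constructor mkℝ
  field
    seq    : ℕ → ℚ
    cauchy : ∀ ε → 0ℚ < ε →
             ∃[ N ] (∀ m n → N ℕ.≤ m → N ℕ.≤ n → ℚ.∣ seq m - seq n ∣ ≤ ε)

open ℝ public

infix  4 _≈ᵣ_ _≤ᵣ_ _<ᵣ_
infixl 6 _+ᵣ_ _⊔ᵣ_
infixl 7 _*ᵣ_ _÷ᵣ_[_]
infixr 8 _^ᵣ_

_≈ᵣ_ : ℝ → ℝ → Set
x ≈ᵣ y = ∀ ε → 0ℚ < ε → ∃[ N ] (∀ n → N ℕ.≤ n → ℚ.∣ seq x n - seq y n ∣ ≤ ε)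

_≤ᵣ_ : ℝ → ℝ → Set
x ≤ᵣ y = ∀ ε → 0ℚ < ε → ∃[ N ] (∀ n → N ℕ.≤ n → seq x n ≤ seq y n + ε)

_<ᵣ_ : ℝ → ℝ → Set
x <ᵣ y = ∃[ ε ] (0ℚ < ε × ∃[ N ] (∀ n → N ℕ.≤ n → seq x n + ε ≤ seq y n))

fromℚ : ℚ → ℝ
fromℚ q = mkℝ (λ _ → q) λ ε 0<ε → 0 , λ _ _ _ _ →
  subst (λ t → ℚ.∣ t ∣ ≤ ε) (sym (+-inverseʳ q)) (<⇒≤ 0<ε)

fromℕ : ℕ → ℝ
fromℕ k = fromℚ (ℤ.+ k / 1)

0ℝ 1ℝ : ℝ
0ℝ = fromℕ 0
1ℝ = fromℕ 1

_+ᵣ_ : ℝ → ℝ → ℝ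
x +ᵣ y = mkℝ (λ n → seq x n + seq y n) λ ε 0<ε →
  let N , f = cauchy x (½ * ε) (0<½* 0<ε)
      M , g = cauchy y (½ * ε) (0<½* 0<ε)
  in N ℕ.⊔ M , λ m n m≥ n≥ → +-close (seq x m) (seq y m) (seq x n) (seq y n)
    (f m n (ℕ.m⊔n≤o⇒m≤o N M m≥) (ℕ.m⊔n≤o⇒m≤o N M n≥))
    (g m n (ℕ.m⊔n≤o⇒n≤o N M m≥) (ℕ.m⊔n≤o⇒n≤o N M n≥))

bounded : (x : ℝ) → ∃[ B ] (0ℚ < B × ∃[ N ] (∀ n → N ℕ.≤ n → ℚ.∣ seq x n ∣ ≤ B))
bounded x = ℚ.∣ c ∣ + 1ℚ , <-≤-trans (positive⁻¹ 1ℚ) 1≤B , N , λ n N≤n → begin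
  ℚ.∣ seq x n ∣                  ≡⟨ cong ℚ.∣_∣ (solve 2 (λ a c → a := c :+ (a :- c)) refl (seq x n) c) ⟩
  ℚ.∣ c + (seq x n - c) ∣        ≤⟨ ∣p+q∣≤∣p∣+∣q∣ c (seq x n - c) ⟩
  ℚ.∣ c ∣ + ℚ.∣ seq x n - c ∣    ≤⟨ +-monoʳ-≤ ℚ.∣ c ∣ (f n N N≤n ℕ.≤-refl) ⟩
  ℚ.∣ c ∣ + 1ℚ                   ∎
  where
  open ≤-Reasoning
  N = proj₁ (cauchy x 1ℚ (positive⁻¹ 1ℚ))
  f = proj₂ (cauchy x 1ℚ (positive⁻¹ 1ℚ))
  c = seq x N
  1≤B : 1ℚ ≤ ℚ.∣ c ∣ + 1ℚ
  1≤B = subst (_≤ ℚ.∣ c ∣ + 1ℚ) (+-identityˡ 1ℚ) (+-monoˡ-≤ 1ℚ (0≤∣p∣ c))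

_*ᵣ_ : ℝ → ℝ → ℝ
x *ᵣ y = mkℝ (λ n → seq x n * seq y n) λ ε 0<ε →
  let A , 0<A , N₁ , f₁ = bounded x
      B , 0<B , N₂ , f₂ = bounded y
      δ , 0<δ , δB = divide (0<½* 0<ε) 0<B
      η , 0<η , ηA = divide (0<½* 0<ε) 0<A
      N₃ , f₃ = cauchy x δ 0<δ
      N₄ , f₄ = cauchy y η 0<η
      L = N₁ ℕ.⊔ N₂
      R = N₃ ℕ.⊔ N₄
  in L ℕ.⊔ R , λ m n m≥ n≥ →
  let m≥L = ℕ.m⊔n≤o⇒m≤o L R m≥
      n≥L = ℕ.m⊔n≤o⇒m≤o L R n≥
      m≥R = ℕ.m⊔n≤o⇒n≤o L R m≥
      n≥R = ℕ.m⊔n≤o⇒n≤o L R n≥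
  in *-close (seq x m) (seq y m) (seq x n) (seq y n)
    (f₁ m (ℕ.m⊔n≤o⇒m≤o N₁ N₂ m≥L)) (f₂ n (ℕ.m⊔n≤o⇒n≤o N₁ N₂ n≥L)) δB ηA
    (f₃ m n (ℕ.m⊔n≤o⇒m≤o N₃ N₄ m≥R) (ℕ.m⊔n≤o⇒m≤o N₃ N₄ n≥R))
    (f₄ m n (ℕ.m⊔n≤o⇒n≤o N₃ N₄ m≥R) (ℕ.m⊔n≤o⇒n≤o N₃ N₄ n≥R))

_⊔ᵣ_ : ℝ → ℝ → ℝ
x ⊔ᵣ y = mkℝ (λ n → seq x n ⊔ seq y n) λ ε 0<ε →
  let N , f = cauchy x ε 0<ε
      M , g = cauchy y ε 0<ε
  in N ℕ.⊔ M , λ m n m≥ n≥ → ⊔-close (seq x m) (seq y m) (seq x n) (seq y n)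
    (f m n (ℕ.m⊔n≤o⇒m≤o N M m≥) (ℕ.m⊔n≤o⇒m≤o N M n≥))
    (g m n (ℕ.m⊔n≤o⇒n≤o N M m≥) (ℕ.m⊔n≤o⇒n≤o N M n≥))

_^ᵣ_ : ℝ → ℕ → ℝ
x ^ᵣ zero  = 1ℝ
x ^ᵣ suc k = x *ᵣ x ^ᵣ k

-- Truncating at a positive rational c that x eventually exceeds makes every
-- term invertible and does not change the value of x.
invᵣ : (x : ℝ) → 0ℝ <ᵣ x → ℝ
invᵣ x (c , 0<c , _) = mkℝ (λ n → 1/⁺ (t n) (0<t n)) λ ε 0<ε →
  let δ , 0<δ , δB = divide 0<ε 0<B
      N , f        = cauchy (x ⊔ᵣ fromℚ c) δ 0<δ
  in N , λ m n m≥ n≥ → 1/⁺-close (t m) (t n)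
    (*-1/⁺ (t m) (0<t m)) (*-1/⁺ (t n) (0<t n))
    (<⇒≤ (0<1/⁺ (t m) (0<t m))) (<⇒≤ (0<1/⁺ (t n) (0<t n)))
    (1/⁺-anti 0<c (0<t m) (p≤q⊔p (seq x m) c)) (1/⁺-anti 0<c (0<t n) (p≤q⊔p (seq x n) c))
    δB (f n m n≥ m≥)
  where
  t : ℕ → ℚ
  t n = seq x n ⊔ c
  0<t : ∀ n → 0ℚ < t n
  0<t n = <-≤-trans 0<c (p≤q⊔p (seq x n) c)
  0<B : 0ℚ < 1/⁺ c 0<c * 1/⁺ c 0<c
  0<B = 0<* (1/⁺ c 0<c) (1/⁺ c 0<c) (0<1/⁺ c 0<c) (0<1/⁺ c 0<c)

_÷ᵣ_[_] : ℝ → (y : ℝ) → 0ℝ <ᵣ y → ℝ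
x ÷ᵣ y [ 0<y ] = x *ᵣ invᵣ y 0<y

IsSqrt : ℝ → ℝ → Set
IsSqrt x s = 0ℝ ≤ᵣ s × s *ᵣ s ≈ᵣ x

2^_ : ℤ → ℚ
2^ (ℤ.+ k)    = ℤ.+ (2 ℕ.^ k) / 1
2^ -[1+ k ]   = (ℤ.+ 1 / (2 ℕ.^ suc k)) {{ℕ.m^n≢0 2 (suc k)}}

-- x = 2 ^ y.  The power with a real exponent is the unique positive real lying
-- between the rational powers 2 ^ q (q ≤ y) and 2 ^ q (y ≤ q); the comparison
-- of x with 2 ^ (a / b) is written as that of x ^ b with 2 ^ a.
IsExp₂ : ℝ → ℝ → Set
IsExp₂ y x = 0ℝ <ᵣ x
  × (∀ q → fromℚ q ≤ᵣ y → fromℚ (2^ (↥ q)) ≤ᵣ x ^ᵣ ↧ₙ q)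
  × (∀ q → y ≤ᵣ fromℚ q → x ^ᵣ ↧ₙ q ≤ᵣ fromℚ (2^ (↥ q)))

IsLog₂ : ℝ → ℝ → Set
IsLog₂ x y = IsExp₂ y x

------------------------------------------------------------------------

∑ : ∀ {n} → (Fin n → ℝ) → ℝ
∑ = foldr _+ᵣ_ 0ℝ

IsEigenvalue : ∀ {n} → (Fin n → Fin n → ℝ) → ℝ → Set
IsEigenvalue {n} M μ = Σ (Fin n → ℝ) λ x →
  ¬ (∀ i → x i ≈ᵣ 0ℝ) × (∀ i → ∑ (λ j → M i j *ᵣ x j) ≈ᵣ μ *ᵣ x i)

IsLargestEigenvalue : ∀ {n} → (Fin n → Fin n → ℝ) → ℝ → Set
IsLargestEigenvalue M ρ = IsEigenvalue M ρ × (∀ μ → IsEigenvalue M μ → μ ≤ᵣ ρ)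

------------------------------------------------------------------------

record Graph (n : ℕ) : Set where
  field
    adj    : Fin n → Fin n → Bool
    symm   : ∀ u v → adj u v ≡ adj v u
    irrefl : ∀ v → adj v v ≡ false

open Graph public

degree : ∀ {n} → Graph n → Fin n → ℕ
degree G v = ∣ tabulate (adj G v) ∣

Δ : ∀ {n} → Graph n → ℕ
Δ G = foldr ℕ._⊔_ 0 (degree G)

adjacencyMatrix : ∀ {n} → Graph n → Fin n → Fin n → ℝ
adjacencyMatrix G u v = if adj G u v then 1ℝ else 0ℝ

IsSpectralRadius : ∀ {n} → Graph n → ℝ → Set
IsSpectralRadius G ρ = IsLargestEigenvalue (adjacencyMatrix G) ρ

-- A not necessarily induced subgraph, given as a graph together with an
-- injection of its vertices into those of G that sends edges to edges.
record _⊆ᴳ_ {m n} (H : Graph m) (G : Graph n) : Set where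
  field
    emb       : Fin m → Fin n
    injective : Injective _≡_ _≡_ emb
    preserves : ∀ u v → adj H u v ≡ true → adj G (emb u) (emb v) ≡ true

-- ρ(H) and √(d Δ(H)) enter as the numbers satisfying their defining
-- properties.  The graph without vertices has no eigenvalue, so it imposes
-- no condition.
SpectrallyDegenerate : ∀ {n} → ℝ → Graph n → Set
SpectrallyDegenerate d G = ∀ {m} (H : Graph m) → H ⊆ᴳ G → ∀ ρ s →
  IsSpectralRadius H ρ → IsSqrt (d *ᵣ fromℕ (Δ H)) s → ρ ≤ᵣ s

-- β = max { 4d , 4d log₂ (k / d) }, where log₂ 0 is read as -∞.
IsDegreeBound : (d : ℝ) → 0ℝ <ᵣ d → ℕ → ℝ → Set
IsDegreeBound d 0<d zero    β = β ≈ᵣ fromℕ 4 *ᵣ d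
IsDegreeBound d 0<d (suc k) β = ∃[ ℓ ] (IsLog₂ (fromℕ (suc k) ÷ᵣ d [ 0<d ]) ℓ
  × β ≈ᵣ fromℕ 4 *ᵣ d ⊔ᵣ fromℕ 4 *ᵣ d *ᵣ ℓ)

{-# OPTIONS --safe #-}
-- Delete edges between vertices of degree larger than the minimum degree δ as long as possible; then every
-- edge meets the set A of vertices of degree δ.  A subgraph H with spectral radius ρ satisfies
-- |M_H x|² ≤ ρ² |x|² ≤ d Δ(H) |x|²; take x to be the indicator of A.  For H induced by A this shows, when
-- 4 d ≤ δ, that at most half of the degree sum δ |A| is spent inside A.  For H induced by A and the vertices
-- whose degree lies in (D , 2 D] it shows that at most 2 d |A| edges join A to these vertices.  Hence
-- δ |A| / 2 ≤ 2 d t |A| for the least t with Δ ≤ 2 ^ t δ, and t ≤ log₂ (Δ / d) because 4 d ≤ δ.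
--
-- The hypothesis speaks only about H whose spectral radius is given as a real number with an eigenvector, so
-- these are constructed for connected H.  With B a positive power of M_H + I, the functionals
-- z ↦ (Bᵏ z)ᵣ / (Bᵏ 1)ᵣ converge geometrically (Birkhoff–Hopf) to a functional Λ with
-- Λ (M_H z) = Λ (M_H 1) Λ z.  Its values at the unit vectors form the Perron eigenvector, and ρ = Λ (M_H 1).
module Submission where

open import Algebra.Bundles using (CommutativeRing)
open import Data.Bool.Base using (Bool; true; false; if_then_else_; not; _∧_; _∨_)
import Data.Bool.Properties as Bool
open import Data.Empty using (⊥)
open import Data.Fin.Base using (Fin; zero; suc)
open import Data.Fin.Properties as Fin using (_≟_; any?)
open import Data.Fin.Subset using (∣_∣)
open import Data.Fin.Subset.Properties using (∣p∣≤n)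
open import Data.Integer.Base as ℤ using (ℤ)
import Data.Integer.Properties as ℤ
open import Data.Nat.Base as ℕ using (ℕ; zero; suc)
import Data.Nat.Coprimality as Coprimality
open import Data.Nat.GeneralisedArithmetic using (fold; fold-+)
import Data.Nat.Properties as ℕ
open import Data.Product using (∃-syntax; _×_; _,_; proj₁; proj₂)
open import Data.Rational.Base as ℚ hiding (∣_∣)
open import Data.Rational.Properties hiding (_≟_)
open import Data.Rational.Solver using (module +-*-Solver)
import Data.Rational.Unnormalised.Base as ℚᵘ
import Data.Rational.Unnormalised.Properties as ℚᵘ
open import Data.Sum using (_⊎_; inj₁; inj₂)
open import Data.Vec.Base using (tabulate; _∷_)
open import Data.Vec.Functional using (foldr)
open import Function.Base using (_∘_)
open import Relation.Binary.PropositionalEquality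
open import Relation.Nullary using (¬_; Dec; yes; no; contradiction; does)
open import Relation.Nullary.Decidable using (_×-dec_; dec-true; dec-false)
open import Defs
open import Algebra.Properties.CommutativeSemiring.Exp
  (CommutativeRing.commutativeSemiring +-*-commutativeRing)
  using (_^_; ^-assocʳ; ^-distrib-*)
open import Algebra.Properties.Semiring.Sum
  (CommutativeRing.semiring +-*-commutativeRing)
  using (sum; sum-cong-≗; ∑-distrib-+; ∑-comm; *-distribˡ-sum; *-distribʳ-sum)
open +-*-Solver using (solve; _:+_; _:*_; _:-_; :-_; _:=_; con)

-- Rational arithmetic

-- The order of real numbers is undecidable, so every estimate is made for rational terms of the
-- sequences. The spectral part rests on one kind of certificate: a positive rational `w` with A w ≤
-- lam w. It bounds all real eigenvalues by lam and also gives |A a|² ≤ lam² |a|² by Schur's test,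
-- so no diagonalisation is used. The iterates Bᵏ χ, corrected off the component, are such vectors
-- with lam as close to ρ as desired. For disconnected H the resulting bounds are added over the
-- components.
--
-- Deleting edges pays off in the layers: a vertex of degree above δ keeps only neighbours in A, so
-- M 1_A takes its full degree there, which exceeds D. Hence D times this entry is at most its
-- square; the squares sum to at most d (2 D) |A|, and division by D leaves 2 d |A|. The constant 4
-- is this 2, the width of a dyadic layer, times the 2 lost to the half of the degree sum inside A.
--
-- The final inequality between reals is proved by refuting its strict opposite, which supplies an ε
-- of room to replace d by a rational slightly above it.

*-monoˡ₀ : ∀ {r p q} → 0ℚ ≤ r → p ≤ q → r * p ≤ r * q
*-monoˡ₀ {r} 0≤r = *-monoˡ-≤-nonNeg r {{nonNegative 0≤r}}

*-monoʳ₀ : ∀ {r p q} → 0ℚ ≤ r → p ≤ q → p * r ≤ q * r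
*-monoʳ₀ {r} 0≤r = *-monoʳ-≤-nonNeg r {{nonNegative 0≤r}}

0≤* : ∀ {p q} → 0ℚ ≤ p → 0ℚ ≤ q → 0ℚ ≤ p * q
0≤* {p} {q} 0≤p 0≤q = subst (_≤ p * q) (*-zeroʳ p) (*-monoˡ₀ 0≤p 0≤q)

0≤+ : ∀ {p q} → 0ℚ ≤ p → 0ℚ ≤ q → 0ℚ ≤ p + q
0≤+ = +-mono-≤

0≤p*p : ∀ p → 0ℚ ≤ p * p
0≤p*p p with ≤-total 0ℚ p
... | inj₁ 0≤p = 0≤* 0≤p 0≤p
... | inj₂ p≤0 = subst (0ℚ ≤_) (solve 1 (λ p → (:- p) :* (:- p) := p :* p) refl p)
                   (0≤* (neg-antimono-≤ p≤0) (neg-antimono-≤ p≤0))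

0≤q-p : ∀ {p q} → p ≤ q → 0ℚ ≤ q - p
0≤q-p {p} {q} p≤q = subst (_≤ q - p) (+-inverseʳ p) (+-monoˡ-≤ (- p) p≤q)

p≤q⇐0≤q-p : ∀ {p q} → 0ℚ ≤ q - p → p ≤ q
p≤q⇐0≤q-p {p} {q} h = subst₂ _≤_ (+-identityˡ p)
  (solve 2 (λ p q → q :- p :+ p := q) refl p q) (+-monoˡ-≤ p h)

*-cancelˡ₀ : ∀ {r p q} → 0ℚ < r → r * p ≤ r * q → p ≤ q
*-cancelˡ₀ {r} 0<r = *-cancelˡ-≤-pos r {{positive 0<r}}

*-cancelʳ₀ : ∀ {r p q} → 0ℚ < r → p * r ≤ q * r → p ≤ q
*-cancelʳ₀ {r} 0<r = *-cancelʳ-≤-pos r {{positive 0<r}}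

0≤1 : 0ℚ ≤ 1ℚ
0≤1 = <⇒≤ (positive⁻¹ 1ℚ)

p≤p+q : ∀ {p q} → 0ℚ ≤ q → p ≤ p + q
p≤p+q {p} {q} 0≤q = subst (_≤ p + q) (+-identityʳ p) (+-monoʳ-≤ p 0≤q)

p<p+q : ∀ {p q} → 0ℚ < q → p < p + q
p<p+q {p} {q} 0<q = subst (_< p + q) (+-identityʳ p) (+-monoʳ-< p 0<q)

≤-limit : ∀ {p q} → (∀ ε → 0ℚ < ε → p ≤ q + ε) → p ≤ q
≤-limit {p} {q} h with p ≤? q
... | yes p≤q = p≤q
... | no p≰q = contradiction (h (½ * (p - q)) (0<½* 0<p-q)) λ p≤ → <-irrefl refl (begin-strict
  p                                       ≤⟨ p≤ ⟩
  q + ½ * (p - q)                         <⟨ p<p+q (0<½* 0<p-q) ⟩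
  q + ½ * (p - q) + ½ * (p - q)           ≡⟨ +-assoc q _ _ ⟩
  q + (½ * (p - q) + ½ * (p - q))         ≡⟨ cong (q +_) (½*+½* (p - q)) ⟩
  q + (p - q)                             ≡⟨ solve 2 (λ p q → q :+ (p :- q) := p) refl p q ⟩
  p                                       ∎)
  where
  open ≤-Reasoning
  0<p-q : 0ℚ < p - q
  0<p-q = subst (_< p - q) (+-inverseʳ q) (+-monoˡ-< (- q) (≰⇒> p≰q))

two : ℚ
two = 1ℚ + 1ℚ

0≤two : 0ℚ ≤ two
0≤two = <⇒≤ (positive⁻¹ two)

-- Kept abstract because unification would otherwise unfold the normalisation of fractions.
abstract
  ι : ℤ → ℚ
  ι i = i / 1

  ι-def : ∀ i → ι i ≡ i / 1
  ι-def i = refl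

  ι-0 : ι (ℤ.+ 0) ≡ 0ℚ
  ι-0 = refl

  ι-1 : ι (ℤ.+ 1) ≡ 1ℚ
  ι-1 = refl

  toℚᵘ-ι : ∀ i → toℚᵘ (ι i) ℚᵘ.≃ ℚᵘ.mkℚᵘ i 0
  toℚᵘ-ι i = toℚᵘ-fromℚᵘ (ℚᵘ.mkℚᵘ i 0)

  ι-+ : ∀ i j → ι (i ℤ.+ j) ≡ ι i + ι j
  ι-+ i j = toℚᵘ-injective (ℚᵘ.≃-trans (toℚᵘ-ι (i ℤ.+ j)) (ℚᵘ.≃-trans
    (ℚᵘ.*≡* (cong (ℤ._* (ℤ.+ 1)) (sym (cong₂ ℤ._+_ (ℤ.*-identityʳ i) (ℤ.*-identityʳ j)))))
    (ℚᵘ.≃-sym (ℚᵘ.≃-trans (toℚᵘ-homo-+ (ι i) (ι j)) (ℚᵘ.+-cong (toℚᵘ-ι i) (toℚᵘ-ι j))))))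

  ι-* : ∀ i j → ι (i ℤ.* j) ≡ ι i * ι j
  ι-* i j = toℚᵘ-injective (ℚᵘ.≃-trans (toℚᵘ-ι (i ℤ.* j)) (ℚᵘ.≃-trans
    (ℚᵘ.*≡* refl)
    (ℚᵘ.≃-sym (ℚᵘ.≃-trans (toℚᵘ-homo-* (ι i) (ι j)) (ℚᵘ.*-cong (toℚᵘ-ι i) (toℚᵘ-ι j))))))

  ι-mono : ∀ {i j} → i ℤ.≤ j → ι i ≤ ι j
  ι-mono {i} {j} i≤j = toℚᵘ-cancel-≤ (ℚᵘ.≤-respˡ-≃ (ℚᵘ.≃-sym (toℚᵘ-ι i))
    (ℚᵘ.≤-respʳ-≃ (ℚᵘ.≃-sym (toℚᵘ-ι j)) (ℚᵘ.*≤* (ℤ.*-monoʳ-≤-nonNeg (ℤ.+ 1) i≤j))))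

  ι-cancel : ∀ {i j} → ι i ≤ ι j → i ℤ.≤ j
  ι-cancel {i} {j} h with ℚᵘ.≤-respˡ-≃ (toℚᵘ-ι i) (ℚᵘ.≤-respʳ-≃ (toℚᵘ-ι j) (toℚᵘ-mono-≤ h))
  ... | ℚᵘ.*≤* k = subst₂ ℤ._≤_ (ℤ.*-identityʳ i) (ℤ.*-identityʳ j) k

  /-*-ι : ∀ i n .{{_ : ℕ.NonZero n}} → (i / n) * ι (ℤ.+ n) ≡ ι i
  /-*-ι i n@(suc m) = toℚᵘ-injective (ℚᵘ.≃-trans (toℚᵘ-homo-* (i / n) (ι (ℤ.+ n)))
    (ℚᵘ.≃-trans (ℚᵘ.*-cong (toℚᵘ-fromℚᵘ (ℚᵘ.mkℚᵘ i m)) (toℚᵘ-ι (ℤ.+ n)))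
    (ℚᵘ.≃-trans (ℚᵘ.*≡* eq) (ℚᵘ.≃-sym (toℚᵘ-ι i)))))
    where
    eq : i ℤ.* ℤ.+ n ℤ.* ℤ.+ 1 ≡ i ℤ.* (ℤ.+ n ℤ.* ℤ.+ 1)
    eq = ℤ.*-assoc i (ℤ.+ n) (ℤ.+ 1)

q*↧q≡↥q : ∀ q → q * ι (ℤ.+ (↧ₙ q)) ≡ ι (↥ q)
q*↧q≡↥q q = trans (cong (_* ι (ℤ.+ (↧ₙ q))) (sym (↥p/↧p≡p q))) (/-*-ι (↥ q) (↧ₙ q))

toℚ : ℕ → ℚ
toℚ n = ι (ℤ.+ n)

toℚ-mono : ∀ {m n} → m ℕ.≤ n → toℚ m ≤ toℚ n
toℚ-mono m≤n = ι-mono (ℤ.+≤+ m≤n)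

toℚ-cancel : ∀ {m n} → toℚ m ≤ toℚ n → m ℕ.≤ n
toℚ-cancel h = ℤ.drop‿+≤+ (ι-cancel h)

toℚ-+ : ∀ m n → toℚ (m ℕ.+ n) ≡ toℚ m + toℚ n
toℚ-+ m n = ι-+ (ℤ.+ m) (ℤ.+ n)

toℚ-* : ∀ m n → toℚ (m ℕ.* n) ≡ toℚ m * toℚ n
toℚ-* m n = trans (cong ι (ℤ.pos-* m n)) (ι-* (ℤ.+ m) (ℤ.+ n))

toℚ-suc : ∀ n → toℚ (suc n) ≡ 1ℚ + toℚ n
toℚ-suc n = trans (toℚ-+ 1 n) (cong (_+ toℚ n) ι-1)

toℚ-2 : toℚ 2 ≡ two
toℚ-2 = trans (toℚ-suc 1) (cong (1ℚ +_) ι-1)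

0≤toℚ : ∀ n → 0ℚ ≤ toℚ n
0≤toℚ n = subst (_≤ toℚ n) ι-0 (toℚ-mono ℕ.z≤n)

1≤toℚ-suc : ∀ n → 1ℚ ≤ toℚ (suc n)
1≤toℚ-suc n = subst (_≤ toℚ (suc n)) ι-1 (toℚ-mono (ℕ.s≤s ℕ.z≤n))

0<toℚ-suc : ∀ n → 0ℚ < toℚ (suc n)
0<toℚ-suc n = <-≤-trans (positive⁻¹ 1ℚ) (1≤toℚ-suc n)

i≤∣i∣ : ∀ i → i ℤ.≤ ℤ.+ ℤ.∣ i ∣
i≤∣i∣ (ℤ.+ n)    = ℤ.≤-refl
i≤∣i∣ ℤ.-[1+ n ] = ℤ.-≤+

archimedean : ∀ q → ∃[ n ] q ≤ toℚ n
archimedean q with ≤-total q 0ℚ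
... | inj₁ q≤0 = 0 , ≤-trans q≤0 (0≤toℚ 0)
... | inj₂ 0≤q = ℤ.∣ ↥ q ∣ , (begin
  q                   ≡⟨ *-identityʳ q ⟨
  q * 1ℚ              ≤⟨ *-monoˡ₀ 0≤q (1≤toℚ-suc (ℕ.pred (↧ₙ q))) ⟩
  q * ι (ℤ.+ (↧ₙ q))    ≡⟨ q*↧q≡↥q q ⟩
  ι (↥ q)             ≤⟨ ι-mono (i≤∣i∣ (↥ q)) ⟩
  toℚ ℤ.∣ ↥ q ∣       ∎)
  where open ≤-Reasoning

archimedean* : ∀ {ε} B → 0ℚ < ε → ∃[ n ] B ≤ toℚ (suc n) * ε
archimedean* {ε} B 0<ε = n , (begin
  B                    ≡⟨ *-identityʳ B ⟨
  B * 1ℚ               ≡⟨ cong (B *_) (*-1/⁺ ε 0<ε) ⟨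
  B * (ε * ε⁻)         ≡⟨ rearrange B ε ε⁻ ⟩
  B * ε⁻ * ε  ≤⟨ *-monoʳ₀ (<⇒≤ 0<ε) (≤-trans (proj₂ (archimedean (B * ε⁻))) (toℚ-mono (ℕ.n≤1+n n))) ⟩
  toℚ (suc n) * ε      ∎)
  where
  open ≤-Reasoning
  ε⁻ = 1/⁺ ε 0<ε
  n  = proj₁ (archimedean (B * ε⁻))
  rearrange : ∀ b e f → b * (e * f) ≡ b * f * e
  rearrange = solve 3 (λ b e f → b :* (e :* f) := b :* f :* e) refl

0<^ : ∀ {x} n → 0ℚ < x → 0ℚ < x ^ n
0<^ zero    0<x = positive⁻¹ 1ℚ
0<^ {x} (suc n) 0<x = 0<* x (x ^ n) 0<x (0<^ n 0<x)

0≤^ : ∀ {x} n → 0ℚ ≤ x → 0ℚ ≤ x ^ n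
0≤^ zero    0≤x = 0≤1
0≤^ (suc n) 0≤x = 0≤* 0≤x (0≤^ n 0≤x)

^-mono : ∀ {x y} n → 0ℚ ≤ x → x ≤ y → x ^ n ≤ y ^ n
^-mono zero    0≤x x≤y = ≤-refl
^-mono (suc n) 0≤x x≤y = *-mono-≤₀ 0≤x x≤y (0≤^ n 0≤x) (^-mono n 0≤x x≤y)

bernoulli : ∀ {x} n → 0ℚ ≤ x → 1ℚ + toℚ n * x ≤ (1ℚ + x) ^ n
bernoulli {x} zero    0≤x = ≤-reflexive (trans (cong (1ℚ +_) (trans (cong (_* x) ι-0) (*-zeroˡ x))) (+-identityʳ 1ℚ))
bernoulli {x} (suc n) 0≤x = begin
  1ℚ + toℚ (suc n) * x                        ≡⟨ cong (λ t → 1ℚ + t * x) (toℚ-suc n) ⟩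
  1ℚ + (1ℚ + toℚ n) * x                       ≤⟨ p≤p+q (0≤* (0≤* (0≤toℚ n) 0≤x) 0≤x) ⟩
  1ℚ + (1ℚ + toℚ n) * x + toℚ n * x * x  ≡⟨ solve 2 (λ n x → con 1ℚ :+ (con 1ℚ :+ n) :* x :+ n :* x :* x
                                                   := (con 1ℚ :+ x) :* (con 1ℚ :+ n :* x)) refl (toℚ n) x ⟩
  (1ℚ + x) * (1ℚ + toℚ n * x)                 ≤⟨ *-monoˡ₀ (0≤+ 0≤1 0≤x) (bernoulli n 0≤x) ⟩
  (1ℚ + x) * (1ℚ + x) ^ n                     ∎
  where open ≤-Reasoning

geometric-step : ∀ c g n → (1ℚ - c) * g * (1ℚ + (1ℚ + n) * c) + g * (c * c * (1ℚ + n)) ≡ g * (1ℚ + n * c)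
geometric-step = solve 3 (λ c g n → (con 1ℚ :- c) :* g :* (con 1ℚ :+ (con 1ℚ :+ n) :* c) :+ g :* (c :* c :* (con 1ℚ :+ n))
  := g :* (con 1ℚ :+ n :* c)) refl

-- An explicit decay rate for powers of 1 - c, by induction from (1 - c)(1 + (n + 1) c) = 1 + n c -
-- (n + 1) c².
geometric-bound : ∀ {c} n → 0ℚ ≤ c → c ≤ 1ℚ → (1ℚ - c) ^ n * (1ℚ + toℚ n * c) ≤ 1ℚ
geometric-bound {c} zero    0≤c c≤1 = ≤-reflexive (begin
  1ℚ * (1ℚ + toℚ 0 * c)  ≡⟨ *-identityˡ _ ⟩
  1ℚ + toℚ 0 * c         ≡⟨ cong (λ t → 1ℚ + t * c) ι-0 ⟩
  1ℚ + 0ℚ * c            ≡⟨ cong (1ℚ +_) (*-zeroˡ c) ⟩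
  1ℚ + 0ℚ                ≡⟨ +-identityʳ 1ℚ ⟩
  1ℚ                     ∎)
  where open ≡-Reasoning
geometric-bound {c} (suc n) 0≤c c≤1 = begin
  γ * γ ^ n * (1ℚ + toℚ (suc n) * c)        ≡⟨ cong (λ t → γ * γ ^ n * (1ℚ + t * c)) (toℚ-suc n) ⟩
  γ * γ ^ n * (1ℚ + (1ℚ + toℚ n) * c)  ≤⟨ p≤p+q (0≤* (0≤^ n 0≤γ) (0≤* (0≤* 0≤c 0≤c) (0≤+ 0≤1 (0≤toℚ n)))) ⟩
  γ * γ ^ n * (1ℚ + (1ℚ + toℚ n) * c) + γ ^ n * (c * c * (1ℚ + toℚ n))
                                            ≡⟨ geometric-step c (γ ^ n) (toℚ n) ⟩
  γ ^ n * (1ℚ + toℚ n * c)                  ≤⟨ geometric-bound n 0≤c c≤1 ⟩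
  1ℚ                                        ∎
  where
  open ≤-Reasoning
  γ = 1ℚ - c
  0≤γ : 0ℚ ≤ γ
  0≤γ = 0≤q-p c≤1

geometric-vanishes : ∀ {c} g {ε} → 0ℚ < c → c ≤ 1ℚ → 0ℚ < ε → ∃[ n ] (1ℚ - c) ^ n * g ≤ ε
geometric-vanishes {c} g {ε} 0<c c≤1 0<ε = suc n , (begin
  γⁿ * g                               ≤⟨ *-monoˡ₀ 0≤γⁿ (proj₂ arch) ⟩
  -- The extra ε completes (n + 1) ε c to ε (1 + (n + 1) c), the factor that `geometric-bound`
  -- controls.
  γⁿ * (toℚ (suc n) * (ε * c))         ≤⟨ *-monoˡ₀ 0≤γⁿ (p≤p+q (<⇒≤ 0<ε)) ⟩
  γⁿ * (toℚ (suc n) * (ε * c) + ε)     ≡⟨ rearrange γⁿ (toℚ (suc n)) ε c ⟩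
  γⁿ * (1ℚ + toℚ (suc n) * c) * ε  ≤⟨ *-monoʳ₀ (<⇒≤ 0<ε) (geometric-bound (suc n) (<⇒≤ 0<c) c≤1) ⟩
  1ℚ * ε                               ≡⟨ *-identityˡ ε ⟩
  ε                                    ∎)
  where
  open ≤-Reasoning
  arch : ∃[ n ] g ≤ toℚ (suc n) * (ε * c)
  arch = archimedean* g (0<* ε c 0<ε 0<c)
  n = proj₁ arch
  γⁿ = (1ℚ - c) ^ suc n
  0≤γⁿ : 0ℚ ≤ γⁿ
  0≤γⁿ = 0≤^ (suc n) (0≤q-p c≤1)
  rearrange : ∀ g t e c → g * (t * (e * c) + e) ≡ g * (1ℚ + t * c) * e
  rearrange = solve 4 (λ g t e c → g :* (t :* (e :* c) :+ e) := g :* (con 1ℚ :+ t :* c) :* e) refl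

-- A discrete intermediate value principle, searching downwards from `J`. It yields grid
-- approximations of square roots, integer parts of logarithms and the doubling time.
last-holding : ∀ {p} {P : ℕ → Set p} → (∀ n → Dec (P n)) → ∀ J → P 0 → ¬ P J →
               ∃[ j ] (P j × ¬ P (suc j))
last-holding P? zero    p ¬p = contradiction p ¬p
last-holding P? (suc J) p ¬p with P? J
... | yes pJ = J , pJ , ¬p
... | no ¬pJ = last-holding P? J p ¬pJ

-- Finite sums and positive linear operators

sum-mono : ∀ {n} {f g : Fin n → ℚ} → (∀ i → f i ≤ g i) → sum f ≤ sum g
sum-mono {zero}  h = ≤-refl
sum-mono {suc n} h = +-mono-≤ (h zero) (sum-mono (h ∘ suc))

sum-nonNeg : ∀ {n} {f : Fin n → ℚ} → (∀ i → 0ℚ ≤ f i) → 0ℚ ≤ sum f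
sum-nonNeg {zero}  h = ≤-refl
sum-nonNeg {suc n} h = 0≤+ (h zero) (sum-nonNeg (h ∘ suc))

sum-zero : ∀ {n} {f : Fin n → ℚ} → (∀ i → f i ≡ 0ℚ) → sum f ≡ 0ℚ
sum-zero {zero}  h = refl
sum-zero {suc n} h = trans (cong₂ _+_ (h zero) (sum-zero (h ∘ suc))) (+-identityʳ 0ℚ)

term≤sum : ∀ {n} {f : Fin n → ℚ} → (∀ i → 0ℚ ≤ f i) → ∀ i → f i ≤ sum f
term≤sum {suc n} h zero    = p≤p+q (sum-nonNeg (h ∘ suc))
term≤sum {suc n} {f} h (suc i) = ≤-trans (term≤sum (h ∘ suc) i)
  (subst (_≤ f zero + sum (f ∘ suc)) (+-identityˡ _) (+-monoˡ-≤ _ (h zero)))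

sum≤* : ∀ {n} {f : Fin n → ℚ} {b} → (∀ i → f i ≤ b) → sum f ≤ toℚ n * b
sum≤* {zero} {b = b} h = ≤-reflexive (sym (trans (cong (_* b) ι-0) (*-zeroˡ b)))
sum≤* {suc n} {f} {b} h = begin
  f zero + sum (f ∘ suc)   ≤⟨ +-mono-≤ (h zero) (sum≤* (h ∘ suc)) ⟩
  b + toℚ n * b            ≡⟨ cong (_+ toℚ n * b) (*-identityˡ b) ⟨
  1ℚ * b + toℚ n * b       ≡⟨ *-distribʳ-+ b 1ℚ (toℚ n) ⟨
  (1ℚ + toℚ n) * b         ≡⟨ cong (_* b) (toℚ-suc n) ⟨
  toℚ (suc n) * b          ∎
  where open ≤-Reasoning

sum-linear : ∀ {n} a (x : Fin n → ℚ) b y → sum (λ j → a * x j + b * y j) ≡ a * sum x + b * sum y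
sum-linear a x b y = trans (∑-distrib-+ (λ j → a * x j) (λ j → b * y j))
  (sym (cong₂ _+_ (*-distribˡ-sum a x) (*-distribˡ-sum b y)))

sum-pick : ∀ {n} i (f : Fin n → ℚ) → (∀ j → j ≢ i → f j ≡ 0ℚ) → sum f ≡ f i
sum-pick zero    f h = trans (cong (f zero +_) (sum-zero λ j → h (suc j) λ ())) (+-identityʳ _)
sum-pick (suc i) f h = trans (cong₂ _+_ (h zero λ ()) (sum-pick i (f ∘ suc) λ j j≢i → h (suc j) (j≢i ∘ Fin.suc-injective)))
  (+-identityˡ _)

⟦_⟧ : Bool → ℚ
⟦ b ⟧ = if b then 1ℚ else 0ℚ

0≤⟦⟧ : ∀ b → 0ℚ ≤ ⟦ b ⟧
0≤⟦⟧ true  = 0≤1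
0≤⟦⟧ false = ≤-refl

⟦⟧≤1 : ∀ b → ⟦ b ⟧ ≤ 1ℚ
⟦⟧≤1 true  = ≤-refl
⟦⟧≤1 false = 0≤1

-- Nonnegative matrices are treated as operators, so that powers are `fold`s rather than matrix
-- products. Monotonicity expresses nonnegativity and also gives `congruent`: applied in both
-- directions it stands in for function extensionality.
record PositiveLinear {n} (B : (Fin n → ℚ) → Fin n → ℚ) : Set where
  field
    linear : ∀ a x b y i → B (λ j → a * x j + b * y j) i ≡ a * B x i + b * B y i
    mono   : ∀ {x y} → (∀ j → x j ≤ y j) → ∀ i → B x i ≤ B y i

  congruent : ∀ {x y} → (∀ j → x j ≡ y j) → ∀ i → B x i ≡ B y i
  congruent h i = ≤-antisym (mono (≤-reflexive ∘ h) i) (mono (≤-reflexive ∘ sym ∘ h) i)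

  scale : ∀ a x i → B (λ j → a * x j) i ≡ a * B x i
  scale a x i = begin
    B (λ j → a * x j) i              ≡⟨ congruent (λ j → sym (drop a (x j))) i ⟩
    B (λ j → a * x j + 0ℚ * x j) i   ≡⟨ linear a x 0ℚ x i ⟩
    a * B x i + 0ℚ * B x i           ≡⟨ drop a (B x i) ⟩
    a * B x i                        ∎
    where
    open ≡-Reasoning
    drop : ∀ a y → a * y + 0ℚ * y ≡ a * y
    drop a y = trans (cong (a * y +_) (*-zeroˡ y)) (+-identityʳ _)

  preserves-0≤ : ∀ {x} → (∀ j → 0ℚ ≤ x j) → ∀ i → 0ℚ ≤ B x i
  preserves-0≤ {x} h i = subst (_≤ B x i) (trans (scale 0ℚ x i) (*-zeroˡ (B x i)))
    (mono (λ j → subst (_≤ x j) (sym (*-zeroˡ (x j))) (h j)) i)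

open PositiveLinear public

id-positiveLinear : ∀ {n} → PositiveLinear {n} (λ z → z)
id-positiveLinear = record { linear = λ _ _ _ _ _ → refl ; mono = λ h → h }

∘-positiveLinear : ∀ {n} {B C : (Fin n → ℚ) → Fin n → ℚ} →
  PositiveLinear B → PositiveLinear C → PositiveLinear (λ z → B (C z))
∘-positiveLinear {B = B} {C} L M = record
  { linear = λ a x b y i → trans (congruent L (linear M a x b y) i) (linear L a (C x) b (C y) i)
  ; mono   = λ h → mono L (mono M h)
  }

fold-positiveLinear : ∀ {n} {B : (Fin n → ℚ) → Fin n → ℚ} →
  PositiveLinear B → ∀ k → PositiveLinear (λ z → fold z B k)
fold-positiveLinear L zero    = id-positiveLinear
fold-positiveLinear L (suc k) = ∘-positiveLinear L (fold-positiveLinear L k)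

fold-commute : ∀ {n} {A B : (Fin n → ℚ) → Fin n → ℚ} → PositiveLinear B →
  (∀ z i → B (A z) i ≡ A (B z) i) → ∀ k z i → fold (A z) B k i ≡ A (fold z B k) i
fold-commute L AB zero    z i = refl
fold-commute {B = B} L AB (suc k) z i =
  trans (congruent L (fold-commute L AB k z) i) (AB (fold z B k) i)

matrix-positiveLinear : ∀ {n} (M : Fin n → Fin n → ℚ) → (∀ i j → 0ℚ ≤ M i j) →
  PositiveLinear (λ z i → sum (λ j → M i j * z j))
matrix-positiveLinear M 0≤M = record
  { linear = λ a x b y i → trans
      (sum-cong-≗ λ j → distribute (M i j) a (x j) b (y j))
      (sum-linear a (λ j → M i j * x j) b (λ j → M i j * y j))
  ; mono = λ h i → sum-mono λ j → *-monoˡ₀ (0≤M i j) (h j)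
  }
  where
  distribute : ∀ m a x b y → m * (a * x + b * y) ≡ a * (m * x) + b * (m * y)
  distribute = solve 5 (λ m a x b y → m :* (a :* x :+ b :* y) := a :* (m :* x) :+ b :* (m :* y)) refl

id+-positiveLinear : ∀ {n} {A : (Fin n → ℚ) → Fin n → ℚ} →
  PositiveLinear A → PositiveLinear (λ z i → z i + A z i)
id+-positiveLinear {A = A} L = record
  { linear = λ a x b y i → trans (cong (a * x i + b * y i +_) (linear L a x b y i))
      (rearrange a (x i) b (y i) (A x i) (A y i))
  ; mono = λ h i → +-mono-≤ (h i) (mono L h i)
  }
  where
  rearrange : ∀ a x b y u v → a * x + b * y + (a * u + b * v) ≡ a * (x + u) + b * (y + v)
  rearrange = solve 6 (λ a x b y u v → a :* x :+ b :* y :+ (a :* u :+ b :* v) := a :* (x :+ u) :+ b :* (y :+ v)) refl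

-- Contraction of mixing operators

Supported : ∀ {n} → (Fin n → Bool) → (Fin n → ℚ) → Set
Supported S z = ∀ i → S i ≡ false → z i ≡ 0ℚ

-- In matrix terms: the entries of `B` are at most `K`, and those in the block of `S` are at least
-- `c`. The ratio c / K will be the contraction constant κ.
record Mixing {n} (S : Fin n → Bool) (c K : ℚ) (B : (Fin n → ℚ) → Fin n → ℚ) : Set where
  field
    positiveLinear : PositiveLinear B
    supported : ∀ {z} → Supported S z → Supported S (B z)
    minorant : ∀ {z} → (∀ j → 0ℚ ≤ z j) → Supported S z → ∀ i → S i ≡ true → c * sum z ≤ B z i
    majorant : ∀ {z} → (∀ j → 0ℚ ≤ z j) → ∀ i → B z i ≤ K * sum z

open Mixing public

combine : ∀ {n} {B : (Fin n → ℚ) → Fin n → ℚ} → PositiveLinear B → ∀ m g x z i →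
          B (λ j → (m + g) * x j - z j) i ≡ (m + g) * B x i - B z i
combine {B = B} L m g x z i = trans
  (congruent L (λ j → cong ((m + g) * x j +_) (minus (z j))) i)
  (trans (linear L (m + g) x (- 1ℚ) z i) (cong ((m + g) * B x i +_) (sym (minus (B z i)))))
  where
  minus : ∀ y → - y ≡ - 1ℚ * y
  minus = solve 1 (λ y → :- y := con (- 1ℚ) :* y) refl

combine′ : ∀ {n} {B : (Fin n → ℚ) → Fin n → ℚ} → PositiveLinear B → ∀ m x z i →
           B (λ j → z j - m * x j) i ≡ B z i - m * B x i
combine′ {B = B} L m x z i = trans
  (congruent L (λ j → expand m (x j) (z j)) i)
  (trans (linear L 1ℚ z (- m) x i) (sym (expand m (B x i) (B z i))))
  where
  expand : ∀ m x z → z - m * x ≡ 1ℚ * z + - m * x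
  expand = solve 3 (λ m x z → z :- m :* x := con 1ℚ :* z :+ (:- m) :* x) refl

-- On `S` the chain is B u ≥ c (sum u) = κ K t (sum x) ≥ κ t B x; off `S` both sides vanish. So the
-- average `t` of u relative to x becomes, up to the factor κ, a pointwise lower bound.
mixing-minorant : ∀ {n} {S : Fin n → Bool} {c K κ B} → Mixing S c K B → 0ℚ ≤ κ → κ * K ≡ c →
  ∀ {x u t} → (∀ j → 0ℚ ≤ x j) → Supported S x → (∀ j → 0ℚ ≤ u j) → Supported S u →
  0ℚ ≤ t → t * sum x ≡ sum u → ∀ i → κ * t * B x i ≤ B u i
mixing-minorant {S = S} {c} {K} {κ} {B} M 0≤κ κK {x} {u} {t} 0≤x x-supp 0≤u u-supp 0≤t tX i
  with S i in Si
... | false = ≤-reflexive (begin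
  κ * t * B x i   ≡⟨ cong (κ * t *_) (supported M x-supp i Si) ⟩
  κ * t * 0ℚ      ≡⟨ *-zeroʳ (κ * t) ⟩
  0ℚ              ≡⟨ supported M u-supp i Si ⟨
  B u i           ∎)
  where open ≡-Reasoning
... | true = begin
  κ * t * B x i          ≤⟨ *-monoˡ₀ (0≤* 0≤κ 0≤t) (majorant M 0≤x i) ⟩
  κ * t * (K * sum x)    ≡⟨ rearrange κ t K (sum x) ⟩
  κ * K * (t * sum x)    ≡⟨ cong₂ _*_ κK tX ⟩
  c * sum u              ≤⟨ minorant M 0≤u u-supp i Si ⟩
  B u i                  ∎
  where
  open ≤-Reasoning
  rearrange : ∀ k t K X → k * t * (K * X) ≡ k * K * (t * X)
  rearrange = solve 4 (λ k t K X → k :* t :* (K :* X) := k :* K :* (t :* X)) refl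

-- The quotient z / x has its values in an interval of length `g` starting at `m`. Written without
-- division, this allows zeros of x, where z then vanishes too.
record Between {n} (x : Fin n → ℚ) (m g : ℚ) (z : Fin n → ℚ) : Set where
  constructor between
  field
    lo : ∀ i → m * x i ≤ z i
    hi : ∀ i → z i ≤ (m + g) * x i

open Between public

between-map : ∀ {n} {B : (Fin n → ℚ) → Fin n → ℚ} → PositiveLinear B → ∀ {x m g z} →
              Between x m g z → Between (B x) m g (B z)
between-map {B = B} L {x} {m} {g} {z} (between l h) = between
  (λ i → subst (_≤ B z i) (scale L m x i) (mono L l i))
  (λ i → subst (B z i ≤_) (scale L (m + g) x i) (mono L h i))

-- Birkhoff–Hopf: B turns the total mass t (sum x) of z - m x into the pointwise gain κ t over m.
contraction : ∀ {n} {S : Fin n → Bool} {c K κ B} → Mixing S c K B → 0ℚ ≤ κ → κ * K ≡ c →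
  ∀ {x m g z} → (∀ j → 0ℚ ≤ x j) → Supported S x → 0ℚ < sum x → Between x m g z →
  ∃[ m′ ] Between (B x) m′ ((1ℚ - κ) * g) (B z)
contraction {S = S} {c} {K} {κ} {B} M 0≤κ κK {x} {m} {g} {z} 0≤x x-supp 0<X (between l h) =
  m + κ * t , between lo′ hi′
  where
  L = positiveLinear M
  X = sum x
  X⁻ = 1/⁺ X 0<X
  u u′ : Fin _ → ℚ
  u  j = z j - m * x j
  u′ j = (m + g) * x j - z j
  0≤u : ∀ j → 0ℚ ≤ u j
  0≤u j = 0≤q-p (l j)
  0≤u′ : ∀ j → 0ℚ ≤ u′ j
  0≤u′ j = 0≤q-p (h j)
  z-supp : Supported S z
  z-supp j Sj = ≤-antisym
    (subst (z j ≤_) (trans (cong ((m + g) *_) (x-supp j Sj)) (*-zeroʳ (m + g))) (h j))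
    (subst (_≤ z j) (trans (cong (m *_) (x-supp j Sj)) (*-zeroʳ m)) (l j))
  u-supp : Supported S u
  u-supp j Sj = trans (cong₂ (λ a b → a - m * b) (z-supp j Sj) (x-supp j Sj)) (vanish m)
    where
    vanish : ∀ m → 0ℚ - m * 0ℚ ≡ 0ℚ
    vanish = solve 1 (λ m → con 0ℚ :- m :* con 0ℚ := con 0ℚ) refl
  u′-supp : Supported S u′
  u′-supp j Sj = trans (cong₂ (λ a b → (m + g) * b - a) (z-supp j Sj) (x-supp j Sj)) (vanish (m + g))
    where
    vanish : ∀ m → m * 0ℚ - 0ℚ ≡ 0ℚ
    vanish = solve 1 (λ m → m :* con 0ℚ :- con 0ℚ := con 0ℚ) refl
  t = sum u * X⁻
  tX : t * X ≡ sum u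
  tX = trans (*-assoc (sum u) X⁻ X) (trans (cong (sum u *_) (trans (*-comm X⁻ X) (*-1/⁺ X 0<X)))
    (*-identityʳ (sum u)))
  0≤t : 0ℚ ≤ t
  0≤t = 0≤* (sum-nonNeg 0≤u) (<⇒≤ (0<1/⁺ X 0<X))
  sum-u+u′ : sum u + sum u′ ≡ g * X
  sum-u+u′ = trans (sym (∑-distrib-+ u u′)) (trans
    (sum-cong-≗ (λ j → gap m g (x j) (z j))) (sym (*-distribˡ-sum g x)))
    where
    gap : ∀ m g x z → z - m * x + ((m + g) * x - z) ≡ g * x
    gap = solve 4 (λ m g x z → z :- m :* x :+ ((m :+ g) :* x :- z) := g :* x) refl
  -- The distances `u` and `u′` to the two ends add up to g x, so their averages are `t` and g - t.
  -- The interval gains κ t below and κ (g - t) above, which shortens it by κ g whatever `t` is.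
  t′X : (g - t) * X ≡ sum u′
  t′X = begin
    (g - t) * X              ≡⟨ expand g t X ⟩
    g * X - t * X            ≡⟨ cong₂ _-_ (sym sum-u+u′) tX ⟩
    sum u + sum u′ - sum u   ≡⟨ cancel (sum u) (sum u′) ⟩
    sum u′                   ∎
    where
    open ≡-Reasoning
    expand : ∀ g t X → (g - t) * X ≡ g * X - t * X
    expand = solve 3 (λ g t X → (g :- t) :* X := g :* X :- t :* X) refl
    cancel : ∀ a b → a + b - a ≡ b
    cancel = solve 2 (λ a b → a :+ b :- a := b) refl
  0≤t′ : 0ℚ ≤ g - t
  0≤t′ = *-cancelʳ₀ 0<X (subst₂ _≤_ (sym (*-zeroˡ X)) (sym t′X) (sum-nonNeg 0≤u′))
  lo′ : ∀ i → (m + κ * t) * B x i ≤ B z i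
  lo′ i = p≤q⇐0≤q-p (subst (0ℚ ≤_)
    (trans (cong (_- κ * t * B x i) (combine′ L m x z i)) (rearrange (B z i) m κ t (B x i)))
    (0≤q-p (mixing-minorant M 0≤κ κK 0≤x x-supp 0≤u u-supp 0≤t tX i)))
    where
    rearrange : ∀ z m k t x → z - m * x - k * t * x ≡ z - (m + k * t) * x
    rearrange = solve 5 (λ z m k t x → z :- m :* x :- k :* t :* x := z :- (m :+ k :* t) :* x) refl
  hi′ : ∀ i → B z i ≤ (m + κ * t + (1ℚ - κ) * g) * B x i
  hi′ i = p≤q⇐0≤q-p (subst (0ℚ ≤_)
    (trans (cong (_- κ * (g - t) * B x i) (combine L m g x z i)) (rearrange (B z i) m g κ t (B x i)))
    (0≤q-p (mixing-minorant M 0≤κ κK 0≤x x-supp 0≤u′ u′-supp 0≤t′ t′X i)))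
    where
    rearrange : ∀ z m g k t x → (m + g) * x - z - k * (g - t) * x ≡ (m + k * t + (1ℚ - k) * g) * x - z
    rearrange = solve 6 (λ z m g k t x → (m :+ g) :* x :- z :- k :* (g :- t) :* x
      := (m :+ k :* t :+ (con 1ℚ :- k) :* g) :* x :- z) refl

fold-supported : ∀ {n} {S : Fin n → Bool} {c K B} → Mixing S c K B → ∀ k {z} →
  Supported S z → Supported S (fold z B k)
fold-supported M zero    z-supp = z-supp
fold-supported M (suc k) z-supp = supported M (fold-supported M k z-supp)

fold-sum-positive : ∀ {n} {S : Fin n → Bool} {c K B} → Mixing S c K B → 0ℚ < c → ∀ r → S r ≡ true →
  ∀ {x} → (∀ j → 0ℚ ≤ x j) → Supported S x → 0ℚ < sum x → ∀ k → 0ℚ < sum (fold x B k)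
fold-sum-positive M 0<c r Sr 0≤x x-supp 0<X zero    = 0<X
fold-sum-positive {c = c} {B = B} M 0<c r Sr {x} 0≤x x-supp 0<X (suc k) = <-≤-trans
  (0<* c (sum y) 0<c (fold-sum-positive M 0<c r Sr 0≤x x-supp 0<X k))
  (≤-trans (minorant M 0≤y (fold-supported M k x-supp) r Sr)
    (term≤sum (preserves-0≤ (positiveLinear M) 0≤y) r))
  where
  y = fold x B k
  0≤y : ∀ j → 0ℚ ≤ y j
  0≤y = preserves-0≤ (fold-positiveLinear (positiveLinear M) k) 0≤x

fold-contraction : ∀ {n} {S : Fin n → Bool} {c K κ B} → Mixing S c K B → 0ℚ < c → 0ℚ ≤ κ → κ * K ≡ c →
  ∀ r → S r ≡ true → ∀ {x m g z} → (∀ j → 0ℚ ≤ x j) → Supported S x → 0ℚ < sum x → Between x m g z →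
  ∀ k → ∃[ m′ ] Between (fold x B k) m′ ((1ℚ - κ) ^ k * g) (fold z B k)
fold-contraction M 0<c 0≤κ κK r Sr {x} {m} {g} {z} 0≤x x-supp 0<X b zero =
  m , subst (λ g → Between x m g z) (sym (*-identityˡ g)) b
fold-contraction {κ = κ} {B} M 0<c 0≤κ κK r Sr {x} {m} {g} {z} 0≤x x-supp 0<X b (suc k) =
  let m′ , b′ = fold-contraction M 0<c 0≤κ κK r Sr 0≤x x-supp 0<X b k
      m″ , b″ = contraction M 0≤κ κK
        (preserves-0≤ (fold-positiveLinear (positiveLinear M) k) 0≤x)
        (fold-supported M k x-supp) (fold-sum-positive M 0<c r Sr 0≤x x-supp 0<X k) b′
  in m″ , subst (λ g → Between (fold x B (suc k)) m″ g (fold z B (suc k)))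
       (sym (*-assoc (1ℚ - κ) ((1ℚ - κ) ^ k) g)) b″

-- The limit functional of a mixing operator

adjacency : ∀ {n} → Graph n → (Fin n → ℚ) → Fin n → ℚ
adjacency K z i = sum (λ j → ⟦ adj K i j ⟧ * z j)

adjacency-positiveLinear : ∀ {n} (K : Graph n) → PositiveLinear (adjacency K)
adjacency-positiveLinear K = matrix-positiveLinear (λ i j → ⟦ adj K i j ⟧) (λ i j → 0≤⟦⟧ (adj K i j))

positiveLinear-sum : ∀ {n} {B : (Fin n → ℚ) → Fin n → ℚ} → PositiveLinear B →
  ∀ {m} (a : Fin m → ℚ) (w : Fin m → Fin n → ℚ) i →
  B (λ s → sum (λ j → a j * w j s)) i ≡ sum (λ j → a j * B (w j) i)
positiveLinear-sum {n} {B} L {zero} a w i = begin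
  B (λ s → 0ℚ) i       ≡⟨ congruent L (λ s → sym (*-zeroˡ 0ℚ)) i ⟩
  B (λ s → 0ℚ * 0ℚ) i  ≡⟨ scale L 0ℚ (λ _ → 0ℚ) i ⟩
  0ℚ * B (λ s → 0ℚ) i  ≡⟨ *-zeroˡ (B (λ s → 0ℚ) i) ⟩
  0ℚ                   ∎
  where open ≡-Reasoning
positiveLinear-sum {n} {B} L {suc m} a w i = begin
  B (λ s → a zero * w zero s + rest s) i  ≡⟨ congruent L (λ s → cong (a zero * w zero s +_) (sym (*-identityˡ (rest s)))) i ⟩
  B (λ s → a zero * w zero s + 1ℚ * rest s) i      ≡⟨ linear L (a zero) (w zero) 1ℚ rest i ⟩
  a zero * B (w zero) i + 1ℚ * B rest i  ≡⟨ cong (a zero * B (w zero) i +_) (*-identityˡ (B rest i)) ⟩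
  a zero * B (w zero) i + B rest i  ≡⟨ cong (a zero * B (w zero) i +_) (positiveLinear-sum L (a ∘ suc) (w ∘ suc) i) ⟩
  a zero * B (w zero) i + sum (λ j → a (suc j) * B (w (suc j)) i) ∎
  where
  open ≡-Reasoning
  rest : Fin n → ℚ
  rest s = sum (λ j → a (suc j) * w (suc j) s)

between-weaken : ∀ {n} {x : Fin n → ℚ} {m g g′ z} → (∀ i → 0ℚ ≤ x i) → g ≤ g′ → Between x m g z → Between x m g′ z
between-weaken {x = x} {m} {g} {g′} 0≤x g≤g′ (between l h) = between l λ i →
  ≤-trans (h i) (*-monoʳ₀ (0≤x i) (+-monoʳ-≤ m g≤g′))

module Functional {n : ℕ} {S : Fin n → Bool} {c C κ : ℚ} {B : (Fin n → ℚ) → Fin n → ℚ}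
  (M : Mixing S c C B) (0<c : 0ℚ < c) (0<κ : 0ℚ < κ) (κ≤1 : κ ≤ 1ℚ) (κC : κ * C ≡ c)
  (r : Fin n) (Sr : S r ≡ true) where

  L-B : PositiveLinear B
  L-B = positiveLinear M

  χ : Fin n → ℚ
  χ i = ⟦ S i ⟧

  0≤χ : ∀ i → 0ℚ ≤ χ i
  0≤χ i = 0≤⟦⟧ (S i)

  χ-supported : Supported S χ
  χ-supported i Si = cong ⟦_⟧ Si

  χ-on : ∀ i → S i ≡ true → χ i ≡ 1ℚ
  χ-on i Si = cong ⟦_⟧ Si

  x : ℕ → Fin n → ℚ
  x k = fold χ B k

  0≤x : ∀ k i → 0ℚ ≤ x k i
  0≤x k = preserves-0≤ (fold-positiveLinear L-B k) 0≤χ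

  0<sum-x : ∀ k → 0ℚ < sum (x k)
  0<sum-x = fold-sum-positive M 0<c r Sr 0≤χ χ-supported
    (<-≤-trans (subst (0ℚ <_) (sym (χ-on r Sr)) (positive⁻¹ 1ℚ)) (term≤sum 0≤χ r))

  0<x : ∀ k i → S i ≡ true → 0ℚ < x k i
  0<x zero    i Si = subst (0ℚ <_) (sym (χ-on i Si)) (positive⁻¹ 1ℚ)
  0<x (suc k) i Si = <-≤-trans (0<* c (sum (x k)) 0<c (0<sum-x k))
    (minorant M (0≤x k) (fold-supported M k χ-supported) i Si)

  x⁻ : ℕ → ℚ
  x⁻ l = 1/⁺ (x l r) (0<x l r Sr)

  x-inverse : ∀ l → x l r * x⁻ l ≡ 1ℚ
  x-inverse l = *-1/⁺ (x l r) (0<x l r Sr)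

  0≤x⁻ : ∀ l → 0ℚ ≤ x⁻ l
  0≤x⁻ l = <⇒≤ (0<1/⁺ (x l r) (0<x l r Sr))

  -- An approximation of the pairing with the left Perron vector of `B`, normalised to take the
  -- value 1 at `χ`.
  Λ : ℕ → (Fin n → ℚ) → ℚ
  Λ l z = fold z B l r * x⁻ l

  *-x⁻ : ∀ l m → m * x l r * x⁻ l ≡ m
  *-x⁻ l m = trans (*-assoc m (x l r) (x⁻ l)) (trans (cong (m *_) (x-inverse l)) (*-identityʳ m))

  Λ-lo : ∀ l z {m g} → Between (x l) m g (fold z B l) → m ≤ Λ l z
  Λ-lo l z {m} b = subst (_≤ _) (*-x⁻ l m) (*-monoʳ₀ (0≤x⁻ l) (lo b r))

  Λ-hi : ∀ l z {m g} → Between (x l) m g (fold z B l) → Λ l z ≤ m + g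
  Λ-hi l z {m} {g} b = subst (_ ≤_) (*-x⁻ l (m + g)) (*-monoʳ₀ (0≤x⁻ l) (hi b r))

  Λ-χ : ∀ l → Λ l χ ≡ 1ℚ
  Λ-χ = x-inverse

  Λ-cong : ∀ l {y z} → (∀ i → y i ≡ z i) → Λ l y ≡ Λ l z
  Λ-cong l h = cong (_* x⁻ l) (congruent (fold-positiveLinear L-B l) h r)

  Λ-sum : ∀ l {m} (a : Fin m → ℚ) (w : Fin m → Fin n → ℚ) →
          Λ l (λ s → sum (λ j → a j * w j s)) ≡ sum (λ j → a j * Λ l (w j))
  Λ-sum l a w = begin
    fold (λ s → sum (λ j → a j * w j s)) B l r * x⁻ l  ≡⟨ cong (_* x⁻ l) (positiveLinear-sum (fold-positiveLinear L-B l) a w r) ⟩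
    sum (λ j → a j * fold (w j) B l r) * x⁻ l  ≡⟨ *-distribʳ-sum (x⁻ l) (λ j → a j * fold (w j) B l r) ⟩
    sum (λ j → a j * fold (w j) B l r * x⁻ l)  ≡⟨ sum-cong-≗ (λ j → *-assoc (a j) (fold (w j) B l r) (x⁻ l)) ⟩
    sum (λ j → a j * Λ l (w j))                         ∎
    where open ≡-Reasoning

  between-fold : ∀ {m g z} → Between χ m g z → ∀ l → Between (x l) m g (fold z B l)
  between-fold b l = between-map (fold-positiveLinear L-B l) b

  -- Contraction narrows the bracket to ε at some index k, and positivity of `B` carries that same
  -- bracket along all later iterates. That `m′` no longer moves gives the Cauchy property of `Λ`
  -- and a lower bound for its limit.
  between-eventually : ∀ {m g z} → Between χ m g z → ∀ ε → 0ℚ < ε →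
    ∃[ m′ ] ∃[ k ] (∀ l → k ℕ.≤ l → Between (x l) m′ ε (fold z B l))
  between-eventually {m} {g} {z} b ε 0<ε = proj₁ at-k , k , later
    where
    k : ℕ
    k = proj₁ (geometric-vanishes g 0<κ κ≤1 0<ε)
    at-k : ∃[ m′ ] Between (x k) m′ ((1ℚ - κ) ^ k * g) (fold z B k)
    at-k = fold-contraction M 0<c (<⇒≤ 0<κ) κC r Sr 0≤χ χ-supported (0<sum-x 0) b k
    at-k′ : Between (x k) (proj₁ at-k) ε (fold z B k)
    at-k′ = between-weaken (0≤x k) (proj₂ (geometric-vanishes g 0<κ κ≤1 0<ε)) (proj₂ at-k)
    later : ∀ l → k ℕ.≤ l → Between (x l) (proj₁ at-k) ε (fold z B l)
    later l k≤l = subst (λ l → Between (x l) (proj₁ at-k) ε (fold z B l)) (ℕ.m∸n+n≡m k≤l)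
      (subst₂ (λ y w → Between y (proj₁ at-k) ε w) (sym (fold-+ χ B (l ℕ.∸ k))) (sym (fold-+ z B (l ℕ.∸ k)))
        (between-map (fold-positiveLinear L-B (l ℕ.∸ k)) at-k′))

  Λ-close : ∀ z k l {m ε} → Between (x k) m ε (fold z B k) → Between (x l) m ε (fold z B l) →
            ℚ.∣ Λ k z - Λ l z ∣ ≤ ε
  Λ-close z k l {ε = ε} b b′ = abs≤
    (≤-trans (Λ-hi k z b) (+-monoˡ-≤ ε (Λ-lo l z b′)))
    (≤-trans (Λ-hi l z b′) (+-monoˡ-≤ ε (Λ-lo k z b)))

  Λ-real : ∀ {m g} z → Between χ m g z → ℝ
  Λ-real z b = mkℝ (λ l → Λ l z) λ ε 0<ε →
    let m′ , k , h = between-eventually b ε 0<ε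
    in k , λ p q k≤p k≤q → Λ-close z p q (h p k≤p) (h q k≤q)

  -- Applying A to the bracket m xₗ ≤ Bˡ z ≤ (m + ε) xₗ shows that Λ turns A into multiplication by Λ (A χ).
  module _ {A : (Fin n → ℚ) → Fin n → ℚ} (L-A : PositiveLinear A)
    (AB : ∀ z i → B (A z) i ≡ A (B z) i) where

    Λ-multiplicative : ∀ l z {m ε} → Between (x l) m ε (fold z B l) →
      m * Λ l (A χ) ≤ Λ l (A z) × Λ l (A z) ≤ (m + ε) * Λ l (A χ)
    Λ-multiplicative l z {m} {ε} b =
      subst (_≤ Λ l (A z)) (*-assoc m (fold (A χ) B l r) (x⁻ l)) (*-monoʳ₀ (0≤x⁻ l) (lo b′ r)) ,
      subst (Λ l (A z) ≤_) (*-assoc (m + ε) (fold (A χ) B l r) (x⁻ l)) (*-monoʳ₀ (0≤x⁻ l) (hi b′ r))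
      where
      b′ : Between (fold (A χ) B l) m ε (fold (A z) B l)
      b′ = between
        (λ i → subst₂ _≤_ (cong (m *_) (sym (fold-commute L-B AB l χ i))) (sym (fold-commute L-B AB l z i))
                 (lo (between-map L-A b) i))
        (λ i → subst₂ _≤_ (sym (fold-commute L-B AB l z i)) (cong ((m + ε) *_) (sym (fold-commute L-B AB l χ i)))
                 (hi (between-map L-A b) i))

    -- With ρ = Λ l (A χ), both numbers lie between m ρ and (m + δ) ρ. The length δ ρ is at most ε
    -- because ρ ≤ G and δ (|G| + 1) = ε; the summand 1 only keeps the divisor positive.
    Λ-eigen : ∀ {g G z} → Between χ 0ℚ g z → Between χ 0ℚ G (A χ) → ∀ ε → 0ℚ < ε →
      ∃[ k ] (∀ l → k ℕ.≤ l → ℚ.∣ Λ l (A z) - Λ l (A χ) * Λ l z ∣ ≤ ε)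
    Λ-eigen {g} {G} {z} b bA ε 0<ε = proj₁ (proj₂ ev) , λ l k≤l → close l (proj₂ (proj₂ ev) l k≤l)
      where
      0<G+1 : 0ℚ < ℚ.∣ G ∣ + 1ℚ
      0<G+1 = <-≤-trans (positive⁻¹ 1ℚ) (subst (_≤ ℚ.∣ G ∣ + 1ℚ) (+-identityˡ 1ℚ) (+-monoˡ-≤ 1ℚ (0≤∣p∣ G)))
      div : ∃[ δ ] (0ℚ < δ × δ * (ℚ.∣ G ∣ + 1ℚ) ≡ ε)
      div = divide 0<ε 0<G+1
      δ = proj₁ div
      ev : ∃[ m′ ] ∃[ k ] (∀ l → k ℕ.≤ l → Between (x l) m′ δ (fold z B l))
      ev = between-eventually b δ (proj₁ (proj₂ div))
      m = proj₁ ev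
      close : ∀ l → Between (x l) m δ (fold z B l) → ℚ.∣ Λ l (A z) - Λ l (A χ) * Λ l z ∣ ≤ ε
      close l b = abs≤
        (≤-trans (proj₂ (Λ-multiplicative l z b)) (≤-trans (≤-reflexive (expand m δ ρ))
          (+-mono-≤ (*-monoˡ₀ 0≤ρ (Λ-lo l z b)) δρ≤ε)))
        (≤-trans (*-monoˡ₀ 0≤ρ (Λ-hi l z b)) (≤-trans (≤-reflexive (trans (*-comm ρ (m + δ)) (expand′ m δ ρ)))
          (+-mono-≤ (proj₁ (Λ-multiplicative l z b)) δρ≤ε)))
        where
        ρ = Λ l (A χ)
        0≤ρ : 0ℚ ≤ ρ
        0≤ρ = Λ-lo l (A χ) (between-fold bA l)
        δρ≤ε : δ * ρ ≤ ε
        δρ≤ε = ≤-trans (*-monoˡ₀ (<⇒≤ (proj₁ (proj₂ div)))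
          (≤-trans (Λ-hi l (A χ) (between-fold bA l)) (≤-trans (≤-reflexive (+-identityˡ G))
            (≤-trans (p≤∣p∣ G) (p≤p+q 0≤1))))) (≤-reflexive (proj₂ (proj₂ div)))
        expand : ∀ m d r → (m + d) * r ≡ r * m + d * r
        expand = solve 3 (λ m d r → (m :+ d) :* r := r :* m :+ d :* r) refl
        expand′ : ∀ m d r → (m + d) * r ≡ m * r + d * r
        expand′ = solve 3 (λ m d r → (m :+ d) :* r := m :* r :+ d :* r) refl

    -- The Collatz-Wielandt principle: bracketing Bᵏ (A χ) = A xₖ by multiples of xₖ makes the
    -- rational vector xₖ itself a supersolution for m′ + ε, while m′ stays below the limit ρ.
    Λ-supersolution : ∀ {m g} → Between χ m g (A χ) → ∀ ε → 0ℚ < ε → ∃[ m′ ] ∃[ k ]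
      ((∀ i → A (x k) i ≤ (m′ + ε) * x k i) × (∀ l → k ℕ.≤ l → m′ ≤ Λ l (A χ)))
    Λ-supersolution b ε 0<ε =
      let m′ , k , h = between-eventually b ε 0<ε
      in m′ , k , (λ i → subst (_≤ (m′ + ε) * x k i) (fold-commute L-B AB k χ i) (hi (h k ℕ.≤-refl) i)) ,
         λ l k≤l → Λ-lo l (A χ) (h l k≤l)

-- Connected components

count : ∀ {n} → (Fin n → Bool) → ℕ
count f = ∣ tabulate f ∣

count-mono : ∀ {n} {f g : Fin n → Bool} → (∀ i → f i ≡ true → g i ≡ true) → count f ℕ.≤ count g
count-mono {zero} h = ℕ.z≤n
count-mono {suc n} {f} {g} h with f zero | g zero | h zero
... | true  | true  | _ = ℕ.s≤s (count-mono (h ∘ suc))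
... | true  | false | e = contradiction (e refl) λ ()
... | false | true  | _ = ℕ.m≤n⇒m≤1+n (count-mono (h ∘ suc))
... | false | false | _ = count-mono (h ∘ suc)

count-strict : ∀ {n} {f g : Fin n → Bool} → (∀ i → f i ≡ true → g i ≡ true) →
               ∀ k → f k ≡ false → g k ≡ true → count f ℕ.< count g
count-strict {suc n} {f} {g} h zero fk gk with f zero | g zero
count-strict {suc n} {f} {g} h zero refl refl | false | true = ℕ.s≤s (count-mono (h ∘ suc))
count-strict {suc n} {f} {g} h (suc k) fk gk with f zero | g zero | h zero
... | true  | true  | _ = ℕ.s≤s (count-strict (h ∘ suc) k fk gk)
... | true  | false | e = contradiction (e refl) λ ()
... | false | true  | _ = ℕ.m≤n⇒m≤1+n (count-strict (h ∘ suc) k fk gk)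
... | false | false | _ = count-strict (h ∘ suc) k fk gk

count≤n : ∀ {n} (f : Fin n → Bool) → count f ℕ.≤ n
count≤n f = ∣p∣≤n (tabulate f)

insert : ∀ {n} → Fin n → (Fin n → Bool) → Fin n → Bool
insert k S j = does (j ≟ k) ∨ S j

insert-⊇ : ∀ {n} (k : Fin n) S j → S j ≡ true → insert k S j ≡ true
insert-⊇ k S j Sj = trans (cong (does (j ≟ k) ∨_) Sj) (Bool.∨-zeroʳ _)

insert-∋ : ∀ {n} (k : Fin n) S → insert k S k ≡ true
insert-∋ k S = cong (_∨ S k) (dec-true (k ≟ k) refl)

insert⁻ : ∀ {n} (k : Fin n) S j → insert k S j ≡ true → j ≡ k ⊎ S j ≡ true
insert⁻ k S j h with j ≟ k
... | yes j≡k = inj₁ j≡k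
... | no  j≢k = inj₂ h

-- The identity summand removes periodicity: a walk may wait, so walks of different lengths can be
-- compared and bipartite components need no separate treatment.
lazy : ∀ {n} → Graph n → (Fin n → ℚ) → Fin n → ℚ
lazy K z i = z i + adjacency K z i

lazy-positiveLinear : ∀ {n} (K : Graph n) → PositiveLinear (lazy K)
lazy-positiveLinear K = id+-positiveLinear (adjacency-positiveLinear K)

lazy-fold-positiveLinear : ∀ {n} (K : Graph n) N → PositiveLinear (λ z → fold z (lazy K) N)
lazy-fold-positiveLinear K N = fold-positiveLinear (lazy-positiveLinear K) N

lazy≥ : ∀ {n} (K : Graph n) {z} → (∀ j → 0ℚ ≤ z j) → ∀ i → z i ≤ lazy K z i
lazy≥ K 0≤z i = p≤p+q (preserves-0≤ (adjacency-positiveLinear K) 0≤z i)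

lazy≥-adj : ∀ {n} (K : Graph n) {z} → (∀ j → 0ℚ ≤ z j) → ∀ i j → adj K i j ≡ true → z j ≤ lazy K z i
lazy≥-adj K {z} 0≤z i j ij = begin
  z j                    ≡⟨ *-identityˡ (z j) ⟨
  1ℚ * z j               ≡⟨ cong (λ b → ⟦ b ⟧ * z j) ij ⟨
  ⟦ adj K i j ⟧ * z j    ≤⟨ term≤sum (λ j → 0≤* (0≤⟦⟧ (adj K i j)) (0≤z j)) j ⟩
  adjacency K z i        ≤⟨ p≤p+q (0≤z i) ⟩
  adjacency K z i + z i  ≡⟨ +-comm (adjacency K z i) (z i) ⟩
  lazy K z i             ∎
  where open ≤-Reasoning

-- The entries (r , j) and (j , r) of (I + A)ᴺ are at least 1, stated through the action on
-- nonnegative vectors.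
record Linked {n} (K : Graph n) (N : ℕ) (r j : Fin n) : Set where
  field
    to   : ∀ {z} → (∀ i → 0ℚ ≤ z i) → z j ≤ fold z (lazy K) N r
    from : ∀ {z} → (∀ i → 0ℚ ≤ z i) → z r ≤ fold z (lazy K) N j

open Linked public

fold-lazy-0≤ : ∀ {n} (K : Graph n) N {z} → (∀ j → 0ℚ ≤ z j) → ∀ i → 0ℚ ≤ fold z (lazy K) N i
fold-lazy-0≤ K N = preserves-0≤ (lazy-fold-positiveLinear K N)

linked-suc : ∀ {n} {K : Graph n} {N r j} → Linked K N r j → Linked K (suc N) r j
linked-suc {K = K} {N} {r} {j} l = record
  { to   = λ 0≤z → ≤-trans (to l 0≤z) (lazy≥ K (fold-lazy-0≤ K N 0≤z) r)
  ; from = λ 0≤z → ≤-trans (from l 0≤z) (lazy≥ K (fold-lazy-0≤ K N 0≤z) j)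
  }

linked-step : ∀ {n} {K : Graph n} {N r j k} → Linked K N r j → adj K j k ≡ true → Linked K (suc N) r k
linked-step {K = K} {N} {r} {j} {k} l jk = record
  { to   = λ {z} 0≤z → ≤-trans (lazy≥-adj K 0≤z j k jk)
      (≤-trans (to l (preserves-0≤ (lazy-positiveLinear K) 0≤z))
        -- The new edge is used at the first application of `lazy`, whereas `fold` adds its extra
        -- application last; `lazy` commutes with its own iterates.
        (≤-reflexive (fold-commute {A = lazy K} (lazy-positiveLinear K) (λ _ _ → refl) N z r)))
  ; from = λ {z} 0≤z → ≤-trans (from l 0≤z)
      (lazy≥-adj K (fold-lazy-0≤ K N 0≤z) k j (trans (symm K k j) jk))
  }

AgreesOn : ∀ {n} → (Fin n → Bool) → Graph n → Graph n → Set
AgreesOn S H K = ∀ i j → S i ≡ true → S j ≡ true → adj H i j ≡ true → adj K i j ≡ true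

Closed : ∀ {n} → Graph n → (Fin n → Bool) → Set
Closed H S = ∀ i j → S i ≡ true → adj H i j ≡ true → S j ≡ true

-- The walks have to stay inside `members`, which is known only when the search ends; therefore
-- `linked` covers every graph that has the edges of `H` among the members. `least` is what keeps a
-- new component disjoint from a closed set avoiding its root.
record Component {n} (H : Graph n) (r : Fin n) : Set where
  field
    members : Fin n → Bool
    root    : members r ≡ true
    closed  : Closed H members
    least   : ∀ T → T r ≡ true → Closed H T → ∀ j → members j ≡ true → T j ≡ true
    steps   : ℕ
    linked  : ∀ K → AgreesOn members H K → ∀ j → members j ≡ true → Linked K steps r j

-- Each round adds the far end of an edge leaving `S`. The invariant n ≤ fuel + count S shows that
-- without fuel `S` already has n elements, so that no edge can leave it.
grow : ∀ {n} (H : Graph n) r (fuel : ℕ) S N → n ℕ.≤ fuel ℕ.+ count S → S r ≡ true →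
       (∀ T → T r ≡ true → Closed H T → ∀ j → S j ≡ true → T j ≡ true) →
       (∀ K → AgreesOn S H K → ∀ j → S j ≡ true → Linked K N r j) → Component H r
grow {n} H r fuel S N enough Sr least link
  with any? (λ i → any? (λ k → (S i Bool.≟ true) ×-dec (adj H i k Bool.≟ true) ×-dec (S k Bool.≟ false)))
... | no none = record { members = S ; root = Sr ; steps = N ; least = least ; linked = link
  ; closed = λ i j Si ij → Bool.¬-not λ Sj → none (i , j , Si , ij , Sj) }
... | yes (i , k , Si , ik , Sk) = continue fuel enough
  where
  S′ : Fin n → Bool
  S′ = insert k S
  more : count S ℕ.< count S′
  more = count-strict (insert-⊇ k S) k Sk (insert-∋ k S)
  least′ : ∀ T → T r ≡ true → Closed H T → ∀ j → S′ j ≡ true → T j ≡ true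
  least′ T Tr T-closed j S′j with insert⁻ k S j S′j
  ... | inj₂ Sj = least T Tr T-closed j Sj
  ... | inj₁ refl = T-closed i j (least T Tr T-closed i Si) ik
  link′ : ∀ K → AgreesOn S′ H K → ∀ j → S′ j ≡ true → Linked K (suc N) r j
  link′ K agree j S′j with insert⁻ k S j S′j
  ... | inj₂ Sj = linked-suc (link K (λ a b Sa Sb → agree a b (insert-⊇ k S a Sa) (insert-⊇ k S b Sb)) j Sj)
  ... | inj₁ refl = linked-step
    (link K (λ a b Sa Sb → agree a b (insert-⊇ k S a Sa) (insert-⊇ k S b Sb)) i Si)
    (agree i j (insert-⊇ k S i Si) (insert-∋ k S) ik)
  continue : ∀ fuel → n ℕ.≤ fuel ℕ.+ count S → Component H r
  continue zero    n≤ = contradiction (ℕ.<-≤-trans (ℕ.≤-<-trans n≤ more) (count≤n S′)) (ℕ.<-irrefl refl)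
  continue (suc f) n≤ = grow H r f S′ (suc N)
    (ℕ.≤-trans n≤ (ℕ.≤-trans (ℕ.≤-reflexive (sym (ℕ.+-suc f (count S)))) (ℕ.+-monoʳ-≤ f more)))
    (insert-⊇ k S r Sr) least′ link′

component : ∀ {n} (H : Graph n) r → Component H r
component {n} H r = grow H r n S 0 (ℕ.m≤m+n n _) (insert-∋ r _) least link
  where
  S : Fin n → Bool
  S = insert r (λ _ → false)
  least : ∀ T → T r ≡ true → Closed H T → ∀ j → S j ≡ true → T j ≡ true
  least T Tr _ j Sj with insert⁻ r (λ _ → false) j Sj
  ... | inj₁ refl = Tr
  link : ∀ K → AgreesOn S H K → ∀ j → S j ≡ true → Linked K 0 r j
  link K _ j Sj with insert⁻ r (λ _ → false) j Sj
  ... | inj₁ refl = record { to = λ _ → ≤-refl ; from = λ _ → ≤-refl }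

module Mix {n : ℕ} (K : Graph n) (S : Fin n → Bool) (edges : ∀ i j → adj K i j ≡ true → S i ≡ true)
  (r : Fin n) (N : ℕ) (link : ∀ j → S j ≡ true → Linked K N r j) where

  -- N steps lead from any member to `r` and N more from `r` to any member, so z j ≤ B z i for all
  -- members i and j and all nonnegative z.
  B : (Fin n → ℚ) → Fin n → ℚ
  B z = fold (fold z (lazy K) N) (lazy K) N

  adjacency-supported : ∀ z → Supported S (adjacency K z)
  adjacency-supported z i Si = sum-zero λ j → trans
    (cong (λ b → ⟦ b ⟧ * z j) (Bool.¬-not λ ij → contradiction (trans (sym (edges i j ij)) Si) λ ()))
    (*-zeroˡ (z j))

  fold-lazy-supported : ∀ N {z} → Supported S z → Supported S (fold z (lazy K) N)
  fold-lazy-supported zero    z-supp = z-supp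
  fold-lazy-supported (suc N) {z} z-supp i Si = trans
    (cong₂ _+_ (fold-lazy-supported N z-supp i Si) (adjacency-supported (fold z (lazy K) N) i Si)) (+-identityʳ 0ℚ)

  0<n : 0ℚ < toℚ n
  0<n = <-≤-trans (0<toℚ-suc 0) (toℚ-mono (inhabited r))
    where
    inhabited : ∀ {n} → Fin n → 1 ℕ.≤ n
    inhabited zero    = ℕ.s≤s ℕ.z≤n
    inhabited (suc i) = ℕ.s≤s ℕ.z≤n

  -- `c` is 1 / n because the bounds z j ≤ B z i are averaged over the n coordinates. `D` bounds the
  -- growth of the total mass in N steps, each of which multiplies it by at most 1 + n.
  c D C κ : ℚ
  c = 1/⁺ (toℚ n) 0<n
  D = (1ℚ + toℚ n) ^ N
  C = D * D

  sum-lazy : ∀ z → (∀ j → 0ℚ ≤ z j) → sum (lazy K z) ≤ (1ℚ + toℚ n) * sum z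
  sum-lazy z 0≤z = begin
    sum (lazy K z)                 ≡⟨ ∑-distrib-+ z (adjacency K z) ⟩
    sum z + sum (adjacency K z)  ≤⟨ +-monoʳ-≤ (sum z) (sum≤* λ i → sum-mono λ j → entry (adj K i j) j) ⟩
    sum z + toℚ n * sum z          ≡⟨ cong (_+ toℚ n * sum z) (*-identityˡ (sum z)) ⟨
    1ℚ * sum z + toℚ n * sum z     ≡⟨ *-distribʳ-+ (sum z) 1ℚ (toℚ n) ⟨
    (1ℚ + toℚ n) * sum z           ∎
    where
    open ≤-Reasoning
    entry : ∀ b j → ⟦ b ⟧ * z j ≤ z j
    entry b j = subst (⟦ b ⟧ * z j ≤_) (*-identityˡ (z j)) (*-monoʳ₀ (0≤z j) (⟦⟧≤1 b))

  0≤1+n : 0ℚ ≤ 1ℚ + toℚ n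
  0≤1+n = 0≤+ 0≤1 (0≤toℚ n)

  sum-fold-lazy : ∀ N {z} → (∀ j → 0ℚ ≤ z j) → sum (fold z (lazy K) N) ≤ (1ℚ + toℚ n) ^ N * sum z
  sum-fold-lazy zero    {z} 0≤z = ≤-reflexive (sym (*-identityˡ (sum z)))
  sum-fold-lazy (suc N) {z} 0≤z = ≤-trans (sum-lazy (fold z (lazy K) N) (fold-lazy-0≤ K N 0≤z))
    (≤-trans (*-monoˡ₀ 0≤1+n (sum-fold-lazy N 0≤z)) (≤-reflexive (sym (*-assoc (1ℚ + toℚ n) ((1ℚ + toℚ n) ^ N) (sum z)))))

  mixing : Mixing S c C B
  mixing = record
    { positiveLinear = ∘-positiveLinear (lazy-fold-positiveLinear K N) (lazy-fold-positiveLinear K N)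
    ; supported = λ z-supp → fold-lazy-supported N (fold-lazy-supported N z-supp)
    ; minorant = λ {z} 0≤z z-supp i Si → begin
        c * sum z  ≤⟨ *-monoˡ₀ (<⇒≤ (0<1/⁺ (toℚ n) 0<n)) (sum≤* {b = B z i} (λ j → entry 0≤z z-supp i Si j)) ⟩
        c * (toℚ n * B z i)   ≡⟨ *-assoc c (toℚ n) (B z i) ⟨
        c * toℚ n * B z i     ≡⟨ cong (_* B z i) (trans (*-comm c (toℚ n)) (*-1/⁺ (toℚ n) 0<n)) ⟩
        1ℚ * B z i            ≡⟨ *-identityˡ (B z i) ⟩
        B z i                 ∎
    ; majorant = λ {z} 0≤z i → begin
        B z i                       ≤⟨ term≤sum (fold-lazy-0≤ K N (fold-lazy-0≤ K N 0≤z)) i ⟩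
        sum (B z)                   ≤⟨ sum-fold-lazy N (fold-lazy-0≤ K N 0≤z) ⟩
        D * sum (fold z (lazy K) N) ≤⟨ *-monoˡ₀ (0≤^ N 0≤1+n) (sum-fold-lazy N 0≤z) ⟩
        D * (D * sum z)             ≡⟨ *-assoc D D (sum z) ⟨
        D * D * sum z               ∎
    }
    where
    open ≤-Reasoning
    entry : ∀ {z} → (∀ j → 0ℚ ≤ z j) → Supported S z → ∀ i → S i ≡ true → ∀ j → z j ≤ B z i
    entry {z} 0≤z z-supp i Si j = split (S j) refl
      where
      split : ∀ b → S j ≡ b → z j ≤ B z i
      split true  Sj = ≤-trans (to (link j Sj) 0≤z) (from (link i Si) (fold-lazy-0≤ K N 0≤z))
      split false Sj = subst (_≤ B z i) (sym (z-supp j Sj)) (fold-lazy-0≤ K N (fold-lazy-0≤ K N 0≤z) i)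

  1≤D : 1ℚ ≤ D
  1≤D = ≤-trans (p≤p+q (0≤* (0≤toℚ N) (0≤toℚ n))) (bernoulli N (0≤toℚ n))

  1≤C : 1ℚ ≤ C
  1≤C = *-mono-≤₀ 0≤1 1≤D 0≤1 1≤D

  0<C : 0ℚ < C
  0<C = <-≤-trans (positive⁻¹ 1ℚ) 1≤C

  0<c : 0ℚ < c
  0<c = 0<1/⁺ (toℚ n) 0<n

  κ = c * 1/⁺ C 0<C

  0<κ : 0ℚ < κ
  0<κ = 0<* c (1/⁺ C 0<C) 0<c (0<1/⁺ C 0<C)

  κC : κ * C ≡ c
  κC = trans (*-assoc c (1/⁺ C 0<C) C) (trans (cong (c *_) (trans (*-comm (1/⁺ C 0<C) C) (*-1/⁺ C 0<C))) (*-identityʳ c))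

  c≤1 : c ≤ 1ℚ
  c≤1 = begin
    c           ≡⟨ *-identityʳ c ⟨
    c * 1ℚ  ≤⟨ *-monoˡ₀ (<⇒≤ 0<c) (subst (_≤ toℚ n) ι-1 (toℚ-mono (ℕ.≤-trans (ℕ.s≤s ℕ.z≤n) (toℚ-0< 0<n)))) ⟩
    c * toℚ n   ≡⟨ trans (*-comm c (toℚ n)) (*-1/⁺ (toℚ n) 0<n) ⟩
    1ℚ          ∎
    where
    open ≤-Reasoning
    toℚ-0< : 0ℚ < toℚ n → 0 ℕ.< n
    toℚ-0< 0<n = ℕ.≰⇒> λ n≤0 → <-irrefl refl (<-≤-trans 0<n (subst (toℚ n ≤_) ι-0 (toℚ-mono n≤0)))

  κ≤1 : κ ≤ 1ℚ
  κ≤1 = *-cancelʳ₀ 0<C (subst₂ _≤_ (sym κC) (sym (*-identityˡ C)) (≤-trans c≤1 1≤C))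

  B-adjacency : ∀ z i → B (adjacency K z) i ≡ adjacency K (B z) i
  B-adjacency z i = trans (congruent (lazy-fold-positiveLinear K N) (commute z) i) (commute (fold z (lazy K) N) i)
    where
    step : ∀ z i → lazy K (adjacency K z) i ≡ adjacency K (lazy K z) i
    step z i = begin
      adjacency K z i + adjacency K (adjacency K z) i  ≡⟨ unit (adjacency K z i) (adjacency K (adjacency K z) i) ⟨
      1ℚ * adjacency K z i + 1ℚ * adjacency K (adjacency K z) i  ≡⟨ linear (adjacency-positiveLinear K) 1ℚ z 1ℚ (adjacency K z) i ⟨
      adjacency K (λ j → 1ℚ * z j + 1ℚ * adjacency K z j) i  ≡⟨ congruent (adjacency-positiveLinear K) (λ j → unit (z j) (adjacency K z j)) i ⟩
      adjacency K (lazy K z) i                                    ∎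
      where
      open ≡-Reasoning
      unit : ∀ a b → 1ℚ * a + 1ℚ * b ≡ a + b
      unit a b = cong₂ _+_ (*-identityˡ a) (*-identityˡ b)
    commute : ∀ z i → fold (adjacency K z) (lazy K) N i ≡ adjacency K (fold z (lazy K) N) i
    commute = fold-commute (lazy-positiveLinear K) step N

-- Supersolutions bound eigenvalues

adjacency-selfAdjoint : ∀ {n} (K : Graph n) (y z : Fin n → ℚ) →
  sum (λ i → y i * adjacency K z i) ≡ sum (λ j → z j * adjacency K y j)
adjacency-selfAdjoint K y z = begin
  sum (λ i → y i * sum (λ j → ⟦ adj K i j ⟧ * z j))  ≡⟨ sum-cong-≗ (λ i → *-distribˡ-sum (y i) (λ j → ⟦ adj K i j ⟧ * z j)) ⟩
  sum (λ i → sum (λ j → y i * (⟦ adj K i j ⟧ * z j)))  ≡⟨ ∑-comm (λ i j → y i * (⟦ adj K i j ⟧ * z j)) ⟩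
  sum (λ j → sum (λ i → y i * (⟦ adj K i j ⟧ * z j)))  ≡⟨ sum-cong-≗ (λ j → sum-cong-≗ (λ i → flip i j)) ⟩
  sum (λ j → sum (λ i → z j * (⟦ adj K j i ⟧ * y i)))  ≡⟨ sum-cong-≗ (λ j → *-distribˡ-sum (z j) (λ i → ⟦ adj K j i ⟧ * y i)) ⟨
  sum (λ j → z j * sum (λ i → ⟦ adj K j i ⟧ * y i))     ∎
  where
  open ≡-Reasoning
  swap : ∀ y a z → y * (a * z) ≡ z * (a * y)
  swap = solve 3 (λ y a z → y :* (a :* z) := z :* (a :* y)) refl
  flip : ∀ i j → y i * (⟦ adj K i j ⟧ * z j) ≡ z j * (⟦ adj K j i ⟧ * y i)
  flip i j = trans (cong (λ b → y i * (⟦ b ⟧ * z j)) (symm K i j)) (swap (y i) ⟦ adj K j i ⟧ (z j))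

∣sum∣≤ : ∀ {n} (f : Fin n → ℚ) → ℚ.∣ sum f ∣ ≤ sum (λ i → ℚ.∣ f i ∣)
∣sum∣≤ {zero}  f = ≤-refl
∣sum∣≤ {suc n} f = ≤-trans (∣p+q∣≤∣p∣+∣q∣ (f zero) (sum (f ∘ suc))) (+-monoʳ-≤ ℚ.∣ f zero ∣ (∣sum∣≤ (f ∘ suc)))

∣adjacency∣≤ : ∀ {n} (K : Graph n) z i → ℚ.∣ adjacency K z i ∣ ≤ adjacency K (λ j → ℚ.∣ z j ∣) i
∣adjacency∣≤ K z i = ≤-trans (∣sum∣≤ (λ j → ⟦ adj K i j ⟧ * z j)) (≤-reflexive (sum-cong-≗ λ j →
  trans (∣p*q∣≡∣p∣*∣q∣ ⟦ adj K i j ⟧ (z j)) (cong (_* ℚ.∣ z j ∣) (0≤p⇒∣p∣≡p (0≤⟦⟧ (adj K i j))))))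

-- Lagrange's identity by induction: a new term of weight c and value t raises the difference of the
-- two sides by c times the sum of cᵢ (yᵢ - t)².
weighted-cauchy-schwarz : ∀ {n} (c y : Fin n → ℚ) → (∀ i → 0ℚ ≤ c i) →
  sum (λ i → c i * y i) * sum (λ i → c i * y i) ≤ sum c * sum (λ i → c i * (y i * y i))
weighted-cauchy-schwarz {zero}  c y 0≤c = ≤-refl
weighted-cauchy-schwarz {suc n} c y 0≤c = p≤q⇐0≤q-p (subst (0ℚ ≤_)
  (regroup (c zero) (y zero) (sum c′) Y Q)
  (0≤+ (0≤q-p (weighted-cauchy-schwarz c′ y′ (0≤c ∘ suc)))
       (0≤* (0≤c zero) (subst (0ℚ ≤_) (deviation c′ y′) (sum-nonNeg λ i → 0≤* (0≤c (suc i)) (0≤p*p (y′ i - y zero)))))))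
  where
  c′ y′ : Fin n → ℚ
  c′ = c ∘ suc
  y′ = y ∘ suc
  Y Q : ℚ
  Y = sum (λ i → c′ i * y′ i)
  Q = sum (λ i → c′ i * (y′ i * y′ i))
  t = y zero
  regroup : ∀ c y C Y Q → C * Q - Y * Y + c * (Q - (y + y) * Y + y * y * C)
            ≡ (c + C) * (c * (y * y) + Q) - (c * y + Y) * (c * y + Y)
  regroup = solve 5 (λ c y C Y Q → C :* Q :- Y :* Y :+ c :* (Q :- (y :+ y) :* Y :+ y :* y :* C)
    := (c :+ C) :* (c :* (y :* y) :+ Q) :- (c :* y :+ Y) :* (c :* y :+ Y)) refl
  deviation : ∀ {m} (c y : Fin m → ℚ) → sum (λ i → c i * ((y i - t) * (y i - t))) ≡
    sum (λ i → c i * (y i * y i)) - (t + t) * sum (λ i → c i * y i) + t * t * sum c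
  deviation {zero}  c y = base t
    where
    base : ∀ t → 0ℚ ≡ 0ℚ - (t + t) * 0ℚ + t * t * 0ℚ
    base = solve 1 (λ t → con 0ℚ := con 0ℚ :- (t :+ t) :* con 0ℚ :+ t :* t :* con 0ℚ) refl
  deviation {suc m} c y = trans
    (cong (c zero * ((y zero - t) * (y zero - t)) +_) (deviation (c ∘ suc) (y ∘ suc)))
    (step (c zero) (y zero) t (sum (λ i → c (suc i) * (y (suc i) * y (suc i)))) (sum (λ i → c (suc i) * y (suc i))) (sum (c ∘ suc)))
    where
    step : ∀ c y t Q Y C → c * ((y - t) * (y - t)) + (Q - (t + t) * Y + t * t * C)
           ≡ c * (y * y) + Q - (t + t) * (c * y + Y) + t * t * (c + C)
    step = solve 6 (λ c y t Q Y C → c :* ((y :- t) :* (y :- t)) :+ (Q :- (t :+ t) :* Y :+ t :* t :* C)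
      := c :* (y :* y) :+ Q :- (t :+ t) :* (c :* y :+ Y) :+ t :* t :* (c :+ C)) refl

-- A rational certificate that the spectral radius is at most `lam`. Strict positivity allows
-- division by `w` and makes the weight of every coordinate count.
record Supersolution {n} (K : Graph n) (lam : ℚ) : Set where
  field
    w   : Fin n → ℚ
    0<w : ∀ i → 0ℚ < w i
    Aw≤ : ∀ i → adjacency K w i ≤ lam * w i
    0≤lam : 0ℚ ≤ lam

  0≤w : ∀ i → 0ℚ ≤ w i
  0≤w i = <⇒≤ (0<w i)

  -- Put a = w y. Cauchy-Schwarz with weights Aᵢⱼ wⱼ bounds the square of row i by (A w)ᵢ (A (w
  -- y²))ᵢ, which gives one factor `lam`; after summation, symmetry moves A from w y² to w, which
  -- gives the other.
  schur-test : ∀ a → sum (λ i → adjacency K a i * adjacency K a i) ≤ lam * lam * sum (λ i → a i * a i)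
  schur-test a = begin
    sum (λ i → adjacency K a i * adjacency K a i)      ≤⟨ sum-mono row ⟩
    sum (λ i → lam * (w i * adjacency K wyy i))  ≡⟨ *-distribˡ-sum lam (λ i → w i * adjacency K wyy i) ⟨
    lam * sum (λ i → w i * adjacency K wyy i)  ≡⟨ cong (lam *_) (adjacency-selfAdjoint K w wyy) ⟩
    lam * sum (λ j → wyy j * adjacency K w j)  ≤⟨ *-monoˡ₀ 0≤lam (sum-mono λ j → *-monoˡ₀ (0≤wyy j) (Aw≤ j)) ⟩
    lam * sum (λ j → wyy j * (lam * w j))  ≡⟨ cong (lam *_) (sum-cong-≗ λ j → trans (rearrange (w j) (y j) lam) (cong (λ t → lam * (t * t)) (wy j))) ⟩
    lam * sum (λ j → lam * (a j * a j))  ≡⟨ cong (lam *_) (*-distribˡ-sum lam (λ j → a j * a j)) ⟨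
    lam * (lam * sum (λ j → a j * a j))  ≡⟨ *-assoc lam lam (sum (λ j → a j * a j)) ⟨
    lam * lam * sum (λ i → a i * a i)                  ∎
    where
    open ≤-Reasoning
    y wyy : Fin n → ℚ
    y i = a i * 1/⁺ (w i) (0<w i)
    wyy i = w i * (y i * y i)
    0≤wyy : ∀ i → 0ℚ ≤ wyy i
    0≤wyy i = 0≤* (0≤w i) (0≤p*p (y i))
    rearrange : ∀ w y l → w * (y * y) * (l * w) ≡ l * ((w * y) * (w * y))
    rearrange = solve 3 (λ w y l → w :* (y :* y) :* (l :* w) := l :* ((w :* y) :* (w :* y))) refl
    wy : ∀ i → w i * y i ≡ a i
    wy i = trans (swap (w i) (a i) (1/⁺ (w i) (0<w i))) (trans (cong (a i *_) (*-1/⁺ (w i) (0<w i))) (*-identityʳ (a i)))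
      where
      swap : ∀ w a v → w * (a * v) ≡ a * (w * v)
      swap = solve 3 (λ w a v → w :* (a :* v) := a :* (w :* v)) refl
    row : ∀ i → adjacency K a i * adjacency K a i ≤ lam * (w i * adjacency K wyy i)
    row i = begin
      adjacency K a i * adjacency K a i
        ≡⟨ cong₂ _*_ Aa Aa ⟩
      sum (λ j → b j * y j) * sum (λ j → b j * y j)
        ≤⟨ weighted-cauchy-schwarz b y (λ j → 0≤* (0≤⟦⟧ (adj K i j)) (0≤w j)) ⟩
      adjacency K w i * sum (λ j → b j * (y j * y j))
        ≡⟨ cong (adjacency K w i *_) (sum-cong-≗ λ j → *-assoc ⟦ adj K i j ⟧ (w j) (y j * y j)) ⟩
      adjacency K w i * adjacency K wyy i
        ≤⟨ *-monoʳ₀ (preserves-0≤ (adjacency-positiveLinear K) 0≤wyy i) (Aw≤ i) ⟩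
      lam * w i * adjacency K wyy i
        ≡⟨ *-assoc lam (w i) (adjacency K wyy i) ⟩
      lam * (w i * adjacency K wyy i) ∎
      where
      b : Fin n → ℚ
      b j = ⟦ adj K i j ⟧ * w j
      Aa : adjacency K a i ≡ sum (λ j → b j * y j)
      Aa = sum-cong-≗ λ j → trans (cong (⟦ adj K i j ⟧ *_) (sym (wy j))) (sym (*-assoc ⟦ adj K i j ⟧ (w j) (y j)))

  -- Pair μ |z| ≤ A |z| + ε with `w`: symmetry and A w ≤ lam w turn it into μ T ≤ lam T + ε (sum w),
  -- where T is the pairing of `w` with |z|. Thus an eigenvalue beyond lam leaves only a small
  -- approximate eigenvector.
  approximate-eigenvector : ∀ {μ η ε} z → 0ℚ ≤ η → lam + η ≤ μ → (∀ i → ℚ.∣ adjacency K z i - μ * z i ∣ ≤ ε) →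
    η * sum (λ i → w i * ℚ.∣ z i ∣) ≤ ε * sum w
  approximate-eigenvector {μ} {η} {ε} z 0≤η lam+η≤μ h = p≤q⇐0≤q-p (subst (0ℚ ≤_) (cancel lam η T (ε * sum w)) (0≤q-p (begin
    (lam + η) * T  ≤⟨ *-monoʳ₀ (sum-nonNeg λ i → 0≤* (0≤w i) (0≤∣p∣ (z i))) lam+η≤μ ⟩
    μ * T                                             ≡⟨ *-distribˡ-sum μ (λ i → w i * ∣z∣ i) ⟩
    sum (λ i → μ * (w i * ∣z∣ i))                     ≤⟨ sum-mono row ⟩
    sum (λ i → w i * adjacency K ∣z∣ i + ε * w i)  ≡⟨ ∑-distrib-+ (λ i → w i * adjacency K ∣z∣ i) (λ i → ε * w i) ⟩
    sum (λ i → w i * adjacency K ∣z∣ i) + sum (λ i → ε * w i)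
                                                      ≡⟨ cong₂ _+_ (adjacency-selfAdjoint K w ∣z∣) (sym (*-distribˡ-sum ε w)) ⟩
    sum (λ j → ∣z∣ j * adjacency K w j) + ε * sum w  ≤⟨ +-monoˡ-≤ (ε * sum w) (sum-mono λ j → *-monoˡ₀ (0≤∣p∣ (z j)) (Aw≤ j)) ⟩
    sum (λ j → ∣z∣ j * (lam * w j)) + ε * sum w  ≡⟨ cong (_+ ε * sum w) (sum-cong-≗ λ j → swap (∣z∣ j) lam (w j)) ⟩
    sum (λ j → lam * (w j * ∣z∣ j)) + ε * sum w  ≡⟨ cong (_+ ε * sum w) (*-distribˡ-sum lam (λ j → w j * ∣z∣ j)) ⟨
    lam * T + ε * sum w                               ∎)))
    where
    open ≤-Reasoning
    ∣z∣ : Fin n → ℚ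
    ∣z∣ i = ℚ.∣ z i ∣
    T = sum (λ i → w i * ∣z∣ i)
    cancel : ∀ l η T W → l * T + W - (l + η) * T ≡ W - η * T
    cancel = solve 4 (λ l η T W → l :* T :+ W :- (l :+ η) :* T := W :- η :* T) refl
    swap : ∀ z l w → z * (l * w) ≡ l * (w * z)
    swap = solve 3 (λ z l w → z :* (l :* w) := l :* (w :* z)) refl
    0≤μ : 0ℚ ≤ μ
    0≤μ = ≤-trans (0≤+ 0≤lam 0≤η) lam+η≤μ
    bound : ∀ i → μ * ∣z∣ i ≤ adjacency K ∣z∣ i + ε
    bound i = begin
      μ * ∣z∣ i                                     ≡⟨ cong (_* ∣z∣ i) (0≤p⇒∣p∣≡p 0≤μ) ⟨
      ℚ.∣ μ ∣ * ∣z∣ i                               ≡⟨ ∣p*q∣≡∣p∣*∣q∣ μ (z i) ⟨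
      ℚ.∣ μ * z i ∣  ≡⟨ cong ℚ.∣_∣ (difference (μ * z i) (adjacency K z i)) ⟩
      ℚ.∣ adjacency K z i - (adjacency K z i - μ * z i) ∣
                                                    ≤⟨ ∣p-q∣≤∣p∣+∣q∣ (adjacency K z i) (adjacency K z i - μ * z i) ⟩
      ℚ.∣ adjacency K z i ∣ + ℚ.∣ adjacency K z i - μ * z i ∣
                                                    ≤⟨ +-mono-≤ (∣adjacency∣≤ K z i) (h i) ⟩
      adjacency K ∣z∣ i + ε                         ∎
      where
      difference : ∀ a b → a ≡ b - (b - a)
      difference = solve 2 (λ a b → a := b :- (b :- a)) refl
    row : ∀ i → μ * (w i * ∣z∣ i) ≤ w i * adjacency K ∣z∣ i + ε * w i
    row i = subst₂ _≤_ (assoc (w i) μ (∣z∣ i)) (expand (w i) (adjacency K ∣z∣ i) ε) (*-monoˡ₀ (0≤w i) (bound i))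
      where
      assoc : ∀ w m z → w * (m * z) ≡ m * (w * z)
      assoc = solve 3 (λ w m z → w :* (m :* z) := m :* (w :* z)) refl
      expand : ∀ w a e → w * (a + e) ≡ w * a + e * w
      expand = solve 3 (λ w a e → w :* (a :+ e) := w :* a :+ e :* w) refl

-- A single rational comparison decides, at an index N beyond which both sequences vary by at most ε
-- / 8. If x exceeds y by more than ε / 2 there, it exceeds y by ε / 4 ever after. This is what
-- permits proofs by contradiction of inequalities between reals.
≮ᵣ⇒≥ᵣ : ∀ x y → ¬ (y <ᵣ x) → x ≤ᵣ y
≮ᵣ⇒≥ᵣ x y ¬y<x ε 0<ε = N , λ n N≤n → decide n N≤n (seq x N ≤? seq y N + ½ * ε)
  where
  δ = ½ * (½ * (½ * ε))
  0<δ : 0ℚ < δ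
  0<δ = 0<½* (0<½* (0<½* 0<ε))
  N₁ = proj₁ (cauchy x δ 0<δ)
  N₂ = proj₁ (cauchy y δ 0<δ)
  N = N₁ ℕ.⊔ N₂
  x-close : ∀ m n → N ℕ.≤ m → N ℕ.≤ n → seq x m ≤ seq x n + δ
  x-close m n N≤m N≤n = abs≤⁻¹ (seq x m) (seq x n)
    (proj₂ (cauchy x δ 0<δ) m n (ℕ.m⊔n≤o⇒m≤o N₁ N₂ N≤m) (ℕ.m⊔n≤o⇒m≤o N₁ N₂ N≤n))
  y-close : ∀ m n → N ℕ.≤ m → N ℕ.≤ n → seq y m ≤ seq y n + δ
  y-close m n N≤m N≤n = abs≤⁻¹ (seq y m) (seq y n)
    (proj₂ (cauchy y δ 0<δ) m n (ℕ.m⊔n≤o⇒n≤o N₁ N₂ N≤m) (ℕ.m⊔n≤o⇒n≤o N₁ N₂ N≤n))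
  collect : ∀ y e → y + ½ * (½ * (½ * e)) + ½ * e + ½ * (½ * (½ * e)) + ½ * (½ * e) ≡ y + e
  collect = solve 2 (λ y e → y :+ con ½ :* (con ½ :* (con ½ :* e)) :+ con ½ :* e :+ con ½ :* (con ½ :* (con ½ :* e)) :+ con ½ :* (con ½ :* e) := y :+ e) refl
  collect′ : ∀ y e → y + ½ * (½ * (½ * e)) + ½ * (½ * e) + ½ * (½ * (½ * e)) ≡ y + ½ * e
  collect′ = solve 2 (λ y e → y :+ con ½ :* (con ½ :* (con ½ :* e)) :+ con ½ :* (con ½ :* e) :+ con ½ :* (con ½ :* (con ½ :* e)) := y :+ con ½ :* e) refl
  decide : ∀ n → N ℕ.≤ n → Dec (seq x N ≤ seq y N + ½ * ε) → seq x n ≤ seq y n + ε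
  decide n N≤n (yes h) = begin
    seq x n                               ≤⟨ x-close n N N≤n ℕ.≤-refl ⟩
    seq x N + δ                           ≤⟨ +-monoˡ-≤ δ h ⟩
    seq y N + ½ * ε + δ  ≤⟨ +-monoˡ-≤ δ (+-monoˡ-≤ (½ * ε) (y-close N n ℕ.≤-refl N≤n)) ⟩
    seq y n + δ + ½ * ε + δ               ≤⟨ p≤p+q (<⇒≤ (0<½* (0<½* 0<ε))) ⟩
    seq y n + δ + ½ * ε + δ + ½ * (½ * ε) ≡⟨ collect (seq y n) ε ⟩
    seq y n + ε                           ∎
    where open ≤-Reasoning
  decide n N≤n (no h) = contradiction (½ * (½ * ε) , 0<½* (0<½* 0<ε) , N , λ m N≤m → +-cancelʳ (begin
    seq y m + ½ * (½ * ε) + δ  ≤⟨ +-monoˡ-≤ δ (+-monoˡ-≤ (½ * (½ * ε)) (y-close m N N≤m ℕ.≤-refl)) ⟩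
    seq y N + δ + ½ * (½ * ε) + δ         ≡⟨ collect′ (seq y N) ε ⟩
    seq y N + ½ * ε                       ≤⟨ <⇒≤ (≰⇒> h) ⟩
    seq x N                               ≤⟨ x-close N m ℕ.≤-refl N≤m ⟩
    seq x m + δ                           ∎)) ¬y<x
    where
    open ≤-Reasoning
    +-cancelʳ : ∀ {p q} → p + δ ≤ q + δ → p ≤ q
    +-cancelʳ {p} {q} h = subst₂ _≤_ (drop p δ) (drop q δ) (+-monoˡ-≤ (- δ) h)
      where
      drop : ∀ p d → p + d - d ≡ p
      drop = solve 2 (λ p d → p :+ d :- d := p) refl

indicator-seq : ∀ b l → seq (if b then 1ℝ else 0ℝ) l ≡ ⟦ b ⟧
indicator-seq true  l = refl
indicator-seq false l = refl

∑-*-seq : ∀ {n} (f g : Fin n → ℝ) l →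
  seq (∑ (λ j → f j *ᵣ g j)) l ≡ sum (λ j → seq (f j) l * seq (g j) l)
∑-*-seq {zero}  f g l = refl
∑-*-seq {suc n} f g l = cong (seq (f zero) l * seq (g zero) l +_) (∑-*-seq (f ∘ suc) (g ∘ suc) l)

adjacencyMatrix-seq : ∀ {n} (K : Graph n) i j l → seq (adjacencyMatrix K i j) l ≡ ⟦ adj K i j ⟧
adjacencyMatrix-seq K i j l = indicator-seq (adj K i j) l

∑-adjacencyMatrix-seq : ∀ {n} (K : Graph n) (z : Fin n → ℝ) i l →
  seq (∑ (λ j → adjacencyMatrix K i j *ᵣ z j)) l ≡ sum (λ j → seq (adjacencyMatrix K i j) l * seq (z j) l)
∑-adjacencyMatrix-seq K z i l = ∑-*-seq (λ j → adjacencyMatrix K i j) z l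

adjacencyMatrix-*-seq : ∀ {n} (K : Graph n) (z : Fin n → ℝ) i l j →
  seq (adjacencyMatrix K i j) l * seq (z j) l ≡ ⟦ adj K i j ⟧ * seq (z j) l
adjacencyMatrix-*-seq K z i l j = cong (_* seq (z j) l) (adjacencyMatrix-seq K i j l)

sum-adjacencyMatrix-seq : ∀ {n} (K : Graph n) (z : Fin n → ℝ) i l →
  sum (λ j → seq (adjacencyMatrix K i j) l * seq (z j) l) ≡ adjacency K (λ j → seq (z j) l) i
sum-adjacencyMatrix-seq {n} K z i l =
  sum-cong-≗ {n} {λ j → seq (adjacencyMatrix K i j) l * seq (z j) l} {λ j → ⟦ adj K i j ⟧ * seq (z j) l} (adjacencyMatrix-*-seq K z i l)

∑-adjacency-seq : ∀ {n} (K : Graph n) (z : Fin n → ℝ) i l →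
  seq (∑ (λ j → adjacencyMatrix K i j *ᵣ z j)) l ≡ adjacency K (λ j → seq (z j) l) i
∑-adjacency-seq K z i l = subst (seq (∑ (λ j → adjacencyMatrix K i j *ᵣ z j)) l ≡_)
  (sum-adjacencyMatrix-seq K z i l) (∑-adjacencyMatrix-seq K z i l)

eventually-all : ∀ {n} {P : Fin n → ℕ → Set} → (∀ j → ∃[ N ] (∀ l → N ℕ.≤ l → P j l)) →
                 ∃[ N ] (∀ l → N ℕ.≤ l → ∀ j → P j l)
eventually-all {zero}  h = 0 , λ _ _ ()
eventually-all {suc n} {P} h = N ℕ.⊔ N′ , λ where
    l ≥ zero    → proj₂ (h zero) l (ℕ.m⊔n≤o⇒m≤o N N′ ≥)
    l ≥ (suc j) → proj₂ rest l (ℕ.m⊔n≤o⇒n≤o N N′ ≥) j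
  where
  rest : ∃[ N ] (∀ l → N ℕ.≤ l → ∀ j → P (suc j) l)
  rest = eventually-all (h ∘ suc)
  N  = proj₁ (h zero)
  N′ = proj₁ rest

approximate-eigenvectors-vanish : ∀ {n} (K : Graph n) {lam} → Supersolution K lam →
  ∀ (z : ℕ → Fin n → ℚ) (μ : ℕ → ℚ) η → 0ℚ < η → ∀ N → (∀ l → N ℕ.≤ l → lam + η ≤ μ l) →
  (∀ j ε → 0ℚ < ε → ∃[ N ] (∀ l → N ℕ.≤ l → ℚ.∣ adjacency K (z l) j - μ l * z l j ∣ ≤ ε)) →
  ∀ i δ → 0ℚ < δ → ∃[ N ] (∀ l → N ℕ.≤ l → ℚ.∣ z l i ∣ ≤ δ)
approximate-eigenvectors-vanish {n} K {lam} super z μ η 0<η N gap eigen i δ 0<δ = N ℕ.⊔ N′ , λ l l≥ →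
  *-cancelˡ₀ {η * w i} (0<* η (w i) 0<η (0<w i))
    (bound l (gap l (ℕ.m⊔n≤o⇒m≤o N N′ l≥)) (proj₂ eventually l (ℕ.m⊔n≤o⇒n≤o N N′ l≥)))
  where
  open Supersolution super
  0<W : 0ℚ < sum w
  0<W = <-≤-trans (0<w i) (term≤sum 0≤w i)
  div : ∃[ ε ] (0ℚ < ε × ε * sum w ≡ η * w i * δ)
  div = divide (0<* (η * w i) δ (0<* η (w i) 0<η (0<w i)) 0<δ) 0<W
  ε = proj₁ div
  eventually : ∃[ N ] (∀ l → N ℕ.≤ l → ∀ j → ℚ.∣ adjacency K (z l) j - μ l * z l j ∣ ≤ ε)
  eventually = eventually-all λ j → eigen j ε (proj₁ (proj₂ div))
  N′ = proj₁ eventually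
  bound : ∀ l → lam + η ≤ μ l → (∀ j → ℚ.∣ adjacency K (z l) j - μ l * z l j ∣ ≤ ε) →
          η * w i * ℚ.∣ z l i ∣ ≤ η * w i * δ
  bound l μ≥ close = begin
    η * w i * ℚ.∣ z l i ∣                 ≡⟨ *-assoc η (w i) ℚ.∣ z l i ∣ ⟩
    η * (w i * ℚ.∣ z l i ∣)  ≤⟨ *-monoˡ₀ (<⇒≤ 0<η) (term≤sum (λ j → 0≤* (0≤w j) (0≤∣p∣ (z l j))) i) ⟩
    η * sum (λ j → w j * ℚ.∣ z l j ∣)     ≤⟨ approximate-eigenvector (z l) (<⇒≤ 0<η) μ≥ close ⟩
    ε * sum w                             ≡⟨ proj₂ (proj₂ div) ⟩
    η * w i * δ                           ∎
    where open ≤-Reasoning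

_≈_seq : (ℕ → ℚ) → (ℕ → ℚ) → Set
f ≈ g seq = ∀ ε → 0ℚ < ε → ∃[ N ] (∀ l → N ℕ.≤ l → ℚ.∣ f l - g l ∣ ≤ ε)

≈ᵣ⇒seq : ∀ x y {f g} → (∀ l → seq x l ≡ f l) → (∀ l → seq y l ≡ g l) → x ≈ᵣ y → f ≈ g seq
≈ᵣ⇒seq x y xf yg h ε 0<ε = proj₁ (h ε 0<ε) , λ l l≥ →
  subst₂ (λ s t → ℚ.∣ s - t ∣ ≤ ε) (xf l) (yg l) (proj₂ (h ε 0<ε) l l≥)

seq⇒≈ᵣ : ∀ x y {f g} → (∀ l → seq x l ≡ f l) → (∀ l → seq y l ≡ g l) → f ≈ g seq → x ≈ᵣ y
seq⇒≈ᵣ x y xf yg h ε 0<ε = proj₁ (h ε 0<ε) , λ l l≥ →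
  subst₂ (λ s t → ℚ.∣ s - t ∣ ≤ ε) (sym (xf l)) (sym (yg l)) (proj₂ (h ε 0<ε) l l≥)

*ᵣ-seq : ∀ x y l → seq (x *ᵣ y) l ≡ seq x l * seq y l
*ᵣ-seq x y l = refl

EigenvectorSeq : ∀ {n} → Graph n → ℝ → (Fin n → ℝ) → Set
EigenvectorSeq K μ z = ∀ i → (λ l → adjacency K (λ j → seq (z j) l) i) ≈ (λ l → seq μ l * seq (z i) l) seq

eigenvector-seq : ∀ {n} (K : Graph n) μ (z : Fin n → ℝ) →
  (∀ i → ∑ (λ j → adjacencyMatrix K i j *ᵣ z j) ≈ᵣ μ *ᵣ z i) → EigenvectorSeq K μ z
eigenvector-seq K μ z h i = ≈ᵣ⇒seq (∑ (λ j → adjacencyMatrix K i j *ᵣ z j)) (μ *ᵣ z i)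
  {λ l → adjacency K (λ j → seq (z j) l) i} {λ l → seq μ l * seq (z i) l}
  (λ l → ∑-adjacency-seq K z i l) (λ l → *ᵣ-seq μ (z i) l) (h i)

eigenvector-seq⁻ : ∀ {n} (K : Graph n) μ (z : Fin n → ℝ) → EigenvectorSeq K μ z →
  ∀ i → ∑ (λ j → adjacencyMatrix K i j *ᵣ z j) ≈ᵣ μ *ᵣ z i
eigenvector-seq⁻ K μ z h i = seq⇒≈ᵣ (∑ (λ j → adjacencyMatrix K i j *ᵣ z j)) (μ *ᵣ z i)
  {λ l → adjacency K (λ j → seq (z j) l) i} {λ l → seq μ l * seq (z i) l}
  (λ l → ∑-adjacency-seq K z i l) (λ l → *ᵣ-seq μ (z i) l) (h i)

-- If ρ + ε ≤ μ eventually, a supersolution with lam ≤ ρ + ε / 2 still lies ε / 2 below μ, and this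
-- gap forces every coordinate of the eigenvector to tend to 0.
eigenvalue≤ : ∀ {n} (K : Graph n) (ρ : ℝ) →
  (∀ ε → 0ℚ < ε → ∃[ lam ] (Supersolution K lam × ∃[ k ] (∀ l → k ℕ.≤ l → lam ≤ seq ρ l + ε))) →
  ∀ μ z → ¬ (∀ i → z i ≈ᵣ 0ℝ) → EigenvectorSeq K μ z → μ ≤ᵣ ρ
eigenvalue≤ {n} K ρ super μ z z≢0 eigen = ≮ᵣ⇒≥ᵣ μ ρ contra
  where
  contra : ¬ (ρ <ᵣ μ)
  contra (ε , 0<ε , N , ρ+ε≤μ) = z≢0 λ i δ 0<δ → proj₁ (vanish i δ 0<δ) , λ l l≥ →
    subst (_≤ δ) (cong ℚ.∣_∣ (sym (drop (seq (z i) l)))) (proj₂ (vanish i δ 0<δ) l l≥)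
    where
    drop : ∀ p → p - 0ℚ ≡ p
    drop = solve 1 (λ p → p :- con 0ℚ := p) refl
    η lam : ℚ
    η = ½ * ε
    lam = proj₁ (super η (0<½* 0<ε))
    k = proj₁ (proj₂ (proj₂ (super η (0<½* 0<ε))))
    gap : ∀ l → N ℕ.⊔ k ℕ.≤ l → lam + η ≤ seq μ l
    gap l l≥ = begin
      lam + η  ≤⟨ +-monoˡ-≤ η (proj₂ (proj₂ (proj₂ (super η (0<½* 0<ε)))) l (ℕ.m⊔n≤o⇒n≤o N k l≥)) ⟩
      seq ρ l + η + η       ≡⟨ +-assoc (seq ρ l) η η ⟩
      seq ρ l + (η + η)     ≡⟨ cong (seq ρ l +_) (½*+½* ε) ⟩
      seq ρ l + ε           ≤⟨ ρ+ε≤μ l (ℕ.m⊔n≤o⇒m≤o N k l≥) ⟩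
      seq μ l               ∎
      where open ≤-Reasoning
    vanish : ∀ i δ → 0ℚ < δ → ∃[ N ] (∀ l → N ℕ.≤ l → ℚ.∣ seq (z i) l ∣ ≤ δ)
    vanish = approximate-eigenvectors-vanish K (proj₁ (proj₂ (super η (0<½* 0<ε)))) (λ l j → seq (z j) l) (seq μ)
      η (0<½* 0<ε) (N ℕ.⊔ k) gap eigen

-- The Perron eigenvector of a component

module Perron {n : ℕ} (K : Graph n) (S : Fin n → Bool) (edges : ∀ i j → adj K i j ≡ true → S i ≡ true)
  (r : Fin n) (Sr : S r ≡ true) (N : ℕ) (link : ∀ j → S j ≡ true → Linked K N r j) where

  open Mix K S edges r N link
  open Functional mixing 0<c 0<κ κ≤1 κC r Sr

  A : (Fin n → ℚ) → Fin n → ℚ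
  A = adjacency K

  L-A : PositiveLinear A
  L-A = adjacency-positiveLinear K

  -- Unit vectors cut off outside `S`, where a bracket by multiples of `χ` would be impossible. They
  -- sum to `χ`.
  e : Fin n → Fin n → ℚ
  e j s = ⟦ does (s ≟ j) ⟧ * χ s

  e-diagonal : ∀ j → e j j ≡ χ j
  e-diagonal j = trans (cong (λ b → ⟦ b ⟧ * χ j) (dec-true (j ≟ j) refl)) (*-identityˡ (χ j))

  e-off : ∀ j s → s ≢ j → e j s ≡ 0ℚ
  e-off j s s≢j = trans (cong (λ b → ⟦ b ⟧ * χ s) (dec-false (s ≟ j) s≢j)) (*-zeroˡ (χ s))

  e-between : ∀ j → Between χ 0ℚ 1ℚ (e j)
  e-between j = between
    (λ s → subst (_≤ e j s) (sym (*-zeroˡ (χ s))) (0≤* (0≤⟦⟧ (does (s ≟ j))) (0≤χ s)))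
    (λ s → subst (λ t → e j s ≤ t * χ s) (sym (+-identityˡ 1ℚ)) (*-monoʳ₀ (0≤χ s) (⟦⟧≤1 (does (s ≟ j)))))

  edge-χ : ∀ i s → ⟦ adj K i s ⟧ * χ s ≡ ⟦ adj K s i ⟧ * χ i
  edge-χ i s = cases (adj K i s) refl
    where
    cases : ∀ b → adj K i s ≡ b → ⟦ adj K i s ⟧ * χ s ≡ ⟦ adj K s i ⟧ * χ i
    cases true  is = cong₂ _*_ (cong ⟦_⟧ (symm K i s))
      (trans (χ-on s (edges s i (trans (symm K s i) is))) (sym (χ-on i (edges i s is))))
    cases false is = trans (cong (λ b → ⟦ b ⟧ * χ s) is) (trans (*-zeroˡ (χ s)) (sym
      (trans (cong (λ b → ⟦ b ⟧ * χ i) (trans (symm K s i) is)) (*-zeroˡ (χ i)))))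

  -- Symmetry of `K` enters here: combining the vectors e j with the entries of row i gives A (e i).
  -- Hence the eigenvalue equation of the functional `Λ` is that of its vector of values.
  row : ∀ i s → sum (λ j → ⟦ adj K i j ⟧ * e j s) ≡ A (e i) s
  row i s = begin
    sum (λ j → ⟦ adj K i j ⟧ * e j s)  ≡⟨ sum-pick s (λ j → ⟦ adj K i j ⟧ * e j s) (λ j j≢s → trans (cong (⟦ adj K i j ⟧ *_) (e-off j s (j≢s ∘ sym))) (*-zeroʳ ⟦ adj K i j ⟧)) ⟩
    ⟦ adj K i s ⟧ * e s s               ≡⟨ cong (⟦ adj K i s ⟧ *_) (e-diagonal s) ⟩
    ⟦ adj K i s ⟧ * χ s                 ≡⟨ edge-χ i s ⟩
    ⟦ adj K s i ⟧ * χ i                 ≡⟨ cong (⟦ adj K s i ⟧ *_) (e-diagonal i) ⟨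
    ⟦ adj K s i ⟧ * e i i  ≡⟨ sum-pick i (λ t → ⟦ adj K s t ⟧ * e i t) (λ t t≢i → trans (cong (⟦ adj K s t ⟧ *_) (e-off i t t≢i)) (*-zeroʳ ⟦ adj K s t ⟧)) ⟨
    A (e i) s                           ∎
    where open ≡-Reasoning

  Aχ-between : Between χ 0ℚ (toℚ n) (A χ)
  Aχ-between = between
    (λ i → subst (_≤ A χ i) (sym (*-zeroˡ (χ i))) (preserves-0≤ L-A 0≤χ i))
    (λ i → cases i (S i) refl)
    where
    entry : ∀ i j → ⟦ adj K i j ⟧ * χ j ≤ 1ℚ
    entry i j = ≤-trans (*-mono-≤₀ (0≤⟦⟧ (adj K i j)) (⟦⟧≤1 (adj K i j)) (0≤χ j) (⟦⟧≤1 (S j))) (≤-reflexive (*-identityˡ 1ℚ))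
    cases : ∀ i b → S i ≡ b → A χ i ≤ (0ℚ + toℚ n) * χ i
    cases i true  Si = ≤-trans (sum≤* (entry i)) (≤-reflexive (cong₂ _*_ (sym (+-identityˡ (toℚ n))) (sym (χ-on i Si))))
    cases i false Si = ≤-reflexive (trans (adjacency-supported χ i Si) (sym (trans (cong ((0ℚ + toℚ n) *_) (χ-supported i Si)) (*-zeroʳ (0ℚ + toℚ n)))))

  ρ : ℝ
  ρ = Λ-real (A χ) Aχ-between

  v : Fin n → ℝ
  v j = Λ-real (e j) (e-between j)

  v-row : ∀ i l → A (λ j → Λ l (e j)) i ≡ Λ l (A (e i))
  v-row i l = trans (sym (Λ-sum l (λ j → ⟦ adj K i j ⟧) e)) (Λ-cong l (row i))

  v-eigenvector : EigenvectorSeq K ρ v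
  v-eigenvector i ε 0<ε = proj₁ eigen , λ l l≥ →
    subst (λ t → ℚ.∣ t - Λ l (A χ) * Λ l (e i) ∣ ≤ ε) (sym (v-row i l)) (proj₂ eigen l l≥)
    where
    eigen : ∃[ k ] (∀ l → k ℕ.≤ l → ℚ.∣ Λ l (A (e i)) - Λ l (A χ) * Λ l (e i) ∣ ≤ ε)
    eigen = Λ-eigen L-A B-adjacency (e-between i) Aχ-between ε 0<ε

  -- The normalisation Λ χ = 1, read on the unit vectors; it excludes v = 0.
  v-sum : ∀ l → sum (λ j → Λ l (e j)) ≡ 1ℚ
  v-sum l = begin
    sum (λ j → Λ l (e j))  ≡⟨ sum-cong-≗ {n} {λ j → 1ℚ * Λ l (e j)} {λ j → Λ l (e j)} (λ j → *-identityˡ (Λ l (e j))) ⟨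
    sum (λ j → 1ℚ * Λ l (e j))             ≡⟨ Λ-sum l (λ _ → 1ℚ) e ⟨
    Λ l (λ s → sum (λ j → 1ℚ * e j s))  ≡⟨ Λ-cong l (λ s → trans (sum-pick s (λ j → 1ℚ * e j s) (λ j j≢s → trans (*-identityˡ (e j s)) (e-off j s (j≢s ∘ sym))))
                                                (trans (*-identityˡ (e s s)) (e-diagonal s))) ⟩
    Λ l χ                                  ≡⟨ Λ-χ l ⟩
    1ℚ                                     ∎
    where open ≡-Reasoning

  v≢0 : ¬ (∀ i → v i ≈ᵣ 0ℝ)
  v≢0 v≈0 = <-irrefl refl (begin-strict
    1ℚ                           ≡⟨ v-sum (proj₁ small) ⟨
    sum (λ j → Λ (proj₁ small) (e j)) ≤⟨ sum≤* (λ j → ≤-trans (abs≤⁻¹ (Λ (proj₁ small) (e j)) 0ℚ (proj₂ small (proj₁ small) ℕ.≤-refl j)) (≤-reflexive (+-identityˡ δ))) ⟩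
    toℚ n * δ                    ≡⟨ trans (*-comm (toℚ n) δ) (proj₂ (proj₂ div)) ⟩
    ½                            <⟨ p<p+q (positive⁻¹ ½) ⟩
    1ℚ                           ∎)
    where
    open ≤-Reasoning
    div : ∃[ δ ] (0ℚ < δ × δ * toℚ n ≡ ½)
    div = divide (positive⁻¹ ½) 0<n
    δ = proj₁ div
    small : ∃[ N ] (∀ l → N ℕ.≤ l → ∀ j → ℚ.∣ Λ l (e j) - 0ℚ ∣ ≤ δ)
    small = eventually-all λ j → v≈0 j δ (proj₁ (proj₂ div))

  -- The iterate xₖ vanishes outside `S`. Adding 1 there makes it positive everywhere and leaves A
  -- xₖ unchanged, since no edge of `K` has an end outside `S`.
  supersolution : ∀ k {lam} → (∀ i → A (x k) i ≤ lam * x k i) → Supersolution K lam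
  supersolution k {lam} Ax≤ = record
    { w = w
    ; 0<w = λ i → cases i (S i) refl
    ; Aw≤ = λ i → ≤-trans (≤-reflexive (Aw i)) (≤-trans (Ax≤ i) (*-monoˡ₀ 0≤lam (p≤p+q (0≤q-p (⟦⟧≤1 (S i))))))
    ; 0≤lam = 0≤lam
    }
    where
    w : Fin n → ℚ
    w i = x k i + (1ℚ - χ i)
    0≤lam : 0ℚ ≤ lam
    0≤lam = *-cancelʳ₀ (0<x k r Sr) (subst (_≤ lam * x k r) (sym (*-zeroˡ (x k r)))
      (≤-trans (preserves-0≤ L-A (0≤x k) r) (Ax≤ r)))
    cases : ∀ i b → S i ≡ b → 0ℚ < w i
    cases i true  Si = <-≤-trans (0<x k i Si) (p≤p+q (0≤q-p (⟦⟧≤1 (S i))))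
    cases i false Si = <-≤-trans (positive⁻¹ 1ℚ) (≤-reflexive (sym (trans
      (cong₂ (λ a b → a + (1ℚ - b)) (fold-supported mixing k χ-supported i Si) (χ-supported i Si)) refl)))
    Aw : ∀ i → A w i ≡ A (x k) i
    Aw i = sum-cong-≗ {n} {λ j → ⟦ adj K i j ⟧ * w j} {λ j → ⟦ adj K i j ⟧ * x k j} λ j → entry j (adj K i j) refl
      where
      entry : ∀ j b → adj K i j ≡ b → ⟦ adj K i j ⟧ * w j ≡ ⟦ adj K i j ⟧ * x k j
      entry j true  ij = cong (⟦ adj K i j ⟧ *_) (trans
        (cong (λ t → x k j + (1ℚ - t)) (χ-on j (edges j i (trans (symm K j i) ij)))) (+-identityʳ (x k j)))
      entry j false ij = trans (cong (λ b → ⟦ b ⟧ * w j) ij) (trans (*-zeroˡ (w j))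
        (sym (trans (cong (λ b → ⟦ b ⟧ * x k j) ij) (*-zeroˡ (x k j)))))

  supersolutions : ∀ ε → 0ℚ < ε → ∃[ lam ] (Supersolution K lam × ∃[ k ] (∀ l → k ℕ.≤ l → lam ≤ seq ρ l + ε))
  supersolutions ε 0<ε = m + ε , supersolution k (proj₁ (proj₂ (proj₂ super))) , k ,
    λ l k≤l → +-monoˡ-≤ ε (proj₂ (proj₂ (proj₂ super)) l k≤l)
    where
    super : ∃[ m ] ∃[ k ] ((∀ i → A (x k) i ≤ (m + ε) * x k i) × (∀ l → k ℕ.≤ l → m ≤ Λ l (A χ)))
    super = Λ-supersolution L-A B-adjacency Aχ-between ε 0<ε
    m = proj₁ super
    k = proj₁ (proj₂ super)

  spectralRadius : IsSpectralRadius K ρ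
  spectralRadius = (v , v≢0 , eigenvector-seq⁻ K ρ v v-eigenvector) ,
    λ where μ (z , z≢0 , Az≈) → eigenvalue≤ K ρ supersolutions μ z z≢0 (eigenvector-seq K μ z Az≈)

-- Square roots

square-≤ : ∀ {s t ε} → 0ℚ ≤ t → 0ℚ ≤ ε → s * s ≤ t * t + ε * ε → s ≤ t + ε
square-≤ {s} {t} {ε} 0≤t 0≤ε h = decide (s ≤? t + ε)
  where
  decide : Dec (s ≤ t + ε) → s ≤ t + ε
  decide (yes p) = p
  decide (no p)  = contradiction h (<⇒≱ (begin-strict
    t * t + ε * ε                 ≤⟨ p≤p+q (0≤+ (0≤* 0≤t 0≤ε) (0≤* 0≤t 0≤ε)) ⟩
    t * t + ε * ε + (t * ε + t * ε) ≡⟨ expand t ε ⟩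
    (t + ε) * (t + ε)             ≤⟨ *-monoˡ₀ 0≤t+ε (<⇒≤ t+ε<s) ⟩
    (t + ε) * s                   <⟨ *-monoˡ-<-pos s {{positive (≤-<-trans 0≤t+ε t+ε<s)}} t+ε<s ⟩
    s * s                         ∎))
    where
    open ≤-Reasoning
    <⇒≱ : ∀ {p q} → p < q → ¬ (q ≤ p)
    <⇒≱ p<q q≤p = <-irrefl refl (<-≤-trans p<q q≤p)
    t+ε<s : t + ε < s
    t+ε<s = ≰⇒> p
    0≤t+ε : 0ℚ ≤ t + ε
    0≤t+ε = 0≤+ 0≤t 0≤ε
    expand : ∀ t e → t * t + e * e + (t * e + t * e) ≡ (t + e) * (t + e)
    expand = solve 2 (λ t e → t :* t :+ e :* e :+ (t :* e :+ t :* e) := (t :+ e) :* (t :+ e)) refl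

p≤p*p+1 : ∀ p → p ≤ p * p + 1ℚ
p≤p*p+1 p with ≤-total p 1ℚ
... | inj₁ p≤1 = ≤-trans p≤1 (subst (_≤ p * p + 1ℚ) (+-identityˡ 1ℚ) (+-monoˡ-≤ 1ℚ (0≤p*p p)))
... | inj₂ 1≤p = ≤-trans (subst (_≤ p * p) (*-identityʳ p) (*-monoˡ₀ (≤-trans 0≤1 1≤p) 1≤p)) (p≤p+q 0≤1)

small-divisor : ∀ {M ε} → 0ℚ ≤ M → 0ℚ < ε → ∃[ δ ] (0ℚ < δ × δ ≤ 1ℚ × δ * M ≤ ε)
small-divisor {M} {ε} 0≤M 0<ε = δ , 0<δ , ≤-trans δ≤ (p⊓q≤q ε 1ℚ) , ≤-trans δM≤ (p⊓q≤p ε 1ℚ)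
  where
  0<ε⊓1 : 0ℚ < ε ⊓ 1ℚ
  0<ε⊓1 with ≤-total ε 1ℚ
  ... | inj₁ ε≤1 = subst (0ℚ <_) (sym (p≤q⇒p⊓q≡p ε≤1)) 0<ε
  ... | inj₂ 1≤ε = subst (0ℚ <_) (sym (p≥q⇒p⊓q≡q 1≤ε)) (positive⁻¹ 1ℚ)
  0<M+1 : 0ℚ < M + 1ℚ
  0<M+1 = <-≤-trans (positive⁻¹ 1ℚ) (subst (_≤ M + 1ℚ) (+-identityˡ 1ℚ) (+-monoˡ-≤ 1ℚ 0≤M))
  div : ∃[ δ ] (0ℚ < δ × δ * (M + 1ℚ) ≡ ε ⊓ 1ℚ)
  div = divide 0<ε⊓1 0<M+1
  δ = proj₁ div
  0<δ = proj₁ (proj₂ div)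
  δM≤ : δ * M ≤ ε ⊓ 1ℚ
  δM≤ = ≤-trans (*-monoˡ₀ (<⇒≤ 0<δ) (p≤p+q 0≤1)) (≤-reflexive (proj₂ (proj₂ div)))
  δ≤ : δ ≤ ε ⊓ 1ℚ
  δ≤ = ≤-trans (subst (_≤ δ * (M + 1ℚ)) (*-identityʳ δ) (*-monoˡ₀ (<⇒≤ 0<δ)
    (subst (_≤ M + 1ℚ) (+-identityˡ 1ℚ) (+-monoˡ-≤ 1ℚ 0≤M)))) (≤-reflexive (proj₂ (proj₂ div)))

≤-limit* : ∀ {p q} M → 0ℚ ≤ M → (∀ ε → 0ℚ < ε → ε ≤ 1ℚ → p ≤ q + ε * M) → p ≤ q
≤-limit* {p} {q} M 0≤M h = ≤-limit λ ε 0<ε →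
  let δ , 0<δ , δ≤1 , δM≤ε = small-divisor 0≤M 0<ε in ≤-trans (h δ 0<δ δ≤1) (+-monoʳ-≤ q δM≤ε)

-- Take the last point s of a grid of mesh η whose square is at most q. The next square exceeds s²
-- by η (2 s + η), which is at most η M since s ≤ q + 1 and η ≤ 1.
sqrt-approximation : ∀ q ε → 0ℚ ≤ q → 0ℚ < ε → ∃[ s ] (0ℚ ≤ s × s * s ≤ q × q ≤ s * s + ε)
sqrt-approximation q ε 0≤q 0<ε = s , 0≤s , proj₁ (proj₂ last) , (begin
  q                           ≤⟨ <⇒≤ (≰⇒> (proj₂ (proj₂ last))) ⟩
  t (suc j) * t (suc j)  ≡⟨ cong (λ u → u * u) (trans (cong (_* η) (toℚ-suc j)) (trans (*-distribʳ-+ η 1ℚ (toℚ j)) (cong (_+ s) (*-identityˡ η)))) ⟩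
  (η + s) * (η + s)           ≡⟨ expand η s ⟩
  s * s + η * (s + s + η)  ≤⟨ +-monoʳ-≤ (s * s) (*-monoˡ₀ (<⇒≤ 0<η) (+-mono-≤ (+-mono-≤ s≤q+1 s≤q+1) η≤1)) ⟩
  s * s + η * M               ≤⟨ +-monoʳ-≤ (s * s) (proj₂ (proj₂ (proj₂ small))) ⟩
  s * s + ε                   ∎)
  where
  open ≤-Reasoning
  M = q + 1ℚ + (q + 1ℚ) + 1ℚ
  small : ∃[ δ ] (0ℚ < δ × δ ≤ 1ℚ × δ * M ≤ ε)
  small = small-divisor (0≤+ (0≤+ (0≤+ 0≤q 0≤1) (0≤+ 0≤q 0≤1)) 0≤1) 0<ε
  η = proj₁ small
  0<η = proj₁ (proj₂ small)
  η≤1 = proj₁ (proj₂ (proj₂ small))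
  t : ℕ → ℚ
  t j = toℚ j * η
  far : ∃[ n ] q + 1ℚ ≤ toℚ (suc n) * η
  far = archimedean* (q + 1ℚ) 0<η
  bnd = suc (proj₁ far)
  1≤tJ : 1ℚ ≤ t bnd
  1≤tJ = ≤-trans (subst (_≤ q + 1ℚ) (+-identityˡ 1ℚ) (+-monoˡ-≤ 1ℚ 0≤q)) (proj₂ far)
  t0 : t 0 * t 0 ≤ q
  t0 = ≤-trans (≤-reflexive (trans (cong (λ u → u * u) (trans (cong (_* η) ι-0) (*-zeroˡ η))) (*-zeroˡ 0ℚ))) 0≤q
  beyond : ¬ (t bnd * t bnd ≤ q)
  beyond h = <-irrefl refl (begin-strict
    q              <⟨ p<p+q (positive⁻¹ 1ℚ) ⟩
    q + 1ℚ         ≤⟨ proj₂ far ⟩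
    t bnd            ≡⟨ *-identityʳ (t bnd) ⟨
    t bnd * 1ℚ       ≤⟨ *-monoˡ₀ (≤-trans 0≤1 1≤tJ) 1≤tJ ⟩
    t bnd * t bnd      ≤⟨ h ⟩
    q              ∎)
  last : ∃[ j ] (t j * t j ≤ q × ¬ (t (suc j) * t (suc j) ≤ q))
  last = last-holding (λ j → t j * t j ≤? q) bnd t0 beyond
  j = proj₁ last
  s = t j
  0≤s : 0ℚ ≤ s
  0≤s = 0≤* (0≤toℚ j) (<⇒≤ 0<η)
  s≤q+1 : s ≤ q + 1ℚ
  s≤q+1 = ≤-trans (p≤p*p+1 s) (+-monoˡ-≤ 1ℚ (proj₁ (proj₂ last)))
  expand : ∀ η s → (η + s) * (η + s) ≡ s * s + η * (s + s + η)
  expand = solve 2 (λ η s → (η :+ s) :* (η :+ s) := s :* s :+ η :* (s :+ s :+ η)) refl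

recip : ℕ → ℚ
recip n = 1/⁺ (toℚ (suc n)) (0<toℚ-suc n)

0<recip : ∀ n → 0ℚ < recip n
0<recip n = 0<1/⁺ (toℚ (suc n)) (0<toℚ-suc n)

recip-vanishes : ∀ ε → 0ℚ < ε → ∃[ N ] (∀ n → N ℕ.≤ n → recip n ≤ ε)
recip-vanishes ε 0<ε = N , λ n N≤n → *-cancelˡ₀ {toℚ (suc n)} (0<toℚ-suc n) (begin
  toℚ (suc n) * recip n    ≡⟨ *-1/⁺ (toℚ (suc n)) (0<toℚ-suc n) ⟩
  1ℚ                       ≤⟨ proj₂ (archimedean* 1ℚ 0<ε) ⟩
  toℚ (suc N) * ε          ≤⟨ *-monoʳ₀ (<⇒≤ 0<ε) (toℚ-mono (ℕ.s≤s N≤n)) ⟩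
  toℚ (suc n) * ε          ∎)
  where
  open ≤-Reasoning
  N = proj₁ (archimedean* 1ℚ 0<ε)

-- Clipping at 0 makes all terms admissible for `sqrt-approximation` and, by hypothesis, eventually
-- changes none.
module Sqrt (x : ℝ) (0≤x : ∃[ N ] (∀ n → N ℕ.≤ n → 0ℚ ≤ seq x n)) where

  y : ℝ
  y = x ⊔ᵣ fromℚ 0ℚ

  approximation : ∀ n → ∃[ s ] (0ℚ ≤ s × s * s ≤ seq y n × seq y n ≤ s * s + recip n)
  approximation n = sqrt-approximation (seq y n) (recip n) (p≤q⊔p (seq x n) 0ℚ) (0<recip n)

  s : ℕ → ℚ
  s n = proj₁ (approximation n)

  0≤s : ∀ n → 0ℚ ≤ s n
  0≤s n = proj₁ (proj₂ (approximation n))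

  s*s≤y : ∀ n → s n * s n ≤ seq y n
  s*s≤y n = proj₁ (proj₂ (proj₂ (approximation n)))

  y≤s*s : ∀ n → seq y n ≤ s n * s n + recip n
  y≤s*s n = proj₂ (proj₂ (proj₂ (approximation n)))

  -- To move the root by at most ε the square may move by ε²: one half of it pays for the change of
  -- y, the other for the error of the approximation.
  s-step : ∀ ε → 0ℚ < ε → ∀ m n → ℚ.∣ seq y m - seq y n ∣ ≤ ½ * (ε * ε) → recip n ≤ ½ * (ε * ε) → s m ≤ s n + ε
  s-step ε 0<ε m n close recip≤ = square-≤ (0≤s n) (<⇒≤ 0<ε) (begin
    s m * s m                                     ≤⟨ s*s≤y m ⟩
    seq y m                                       ≤⟨ abs≤⁻¹ (seq y m) (seq y n) close ⟩
    seq y n + ½ * (ε * ε)  ≤⟨ +-monoˡ-≤ (½ * (ε * ε)) (≤-trans (y≤s*s n) (+-monoʳ-≤ (s n * s n) recip≤)) ⟩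
    s n * s n + ½ * (ε * ε) + ½ * (ε * ε)  ≡⟨ +-assoc (s n * s n) (½ * (ε * ε)) (½ * (ε * ε)) ⟩
    s n * s n + (½ * (ε * ε) + ½ * (ε * ε))       ≡⟨ cong (s n * s n +_) (½*+½* (ε * ε)) ⟩
    s n * s n + ε * ε                             ∎)
    where open ≤-Reasoning

  s-cauchy : ∀ ε → 0ℚ < ε → ∃[ N ] (∀ m n → N ℕ.≤ m → N ℕ.≤ n → ℚ.∣ s m - s n ∣ ≤ ε)
  s-cauchy ε 0<ε = N₁ ℕ.⊔ N₂ , λ m n m≥ n≥ → abs≤
    (s-step ε 0<ε m n (close m n m≥ n≥) (proj₂ (recip-vanishes δ 0<δ) n (ℕ.m⊔n≤o⇒n≤o N₁ N₂ n≥)))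
    (s-step ε 0<ε n m (close n m n≥ m≥) (proj₂ (recip-vanishes δ 0<δ) m (ℕ.m⊔n≤o⇒n≤o N₁ N₂ m≥)))
    where
    δ = ½ * (ε * ε)
    0<δ : 0ℚ < δ
    0<δ = 0<½* (0<* ε ε 0<ε 0<ε)
    N₁ = proj₁ (cauchy y δ 0<δ)
    N₂ = proj₁ (recip-vanishes δ 0<δ)
    close : ∀ m n → N₁ ℕ.⊔ N₂ ℕ.≤ m → N₁ ℕ.⊔ N₂ ℕ.≤ n → ℚ.∣ seq y m - seq y n ∣ ≤ δ
    close m n m≥ n≥ = proj₂ (cauchy y δ 0<δ) m n (ℕ.m⊔n≤o⇒m≤o N₁ N₂ m≥) (ℕ.m⊔n≤o⇒m≤o N₁ N₂ n≥)

  √x : ℝ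
  √x = mkℝ s s-cauchy

  isSqrt : IsSqrt x √x
  isSqrt = (λ ε 0<ε → 0 , λ n _ → 0≤+ (0≤s n) (<⇒≤ 0<ε)) , λ ε 0<ε → N₁ ℕ.⊔ proj₁ (recip-vanishes ε 0<ε) , λ n n≥ →
    close ε 0<ε n (ℕ.m⊔n≤o⇒m≤o N₁ _ n≥) (proj₂ (recip-vanishes ε 0<ε) n (ℕ.m⊔n≤o⇒n≤o N₁ _ n≥))
    where
    N₁ = proj₁ 0≤x
    close : ∀ ε → 0ℚ < ε → ∀ n → N₁ ℕ.≤ n → recip n ≤ ε → ℚ.∣ s n * s n - seq x n ∣ ≤ ε
    close ε 0<ε n n≥ recip≤ = abs≤
      (≤-trans (subst (s n * s n ≤_) y≡x (s*s≤y n)) (p≤p+q (<⇒≤ 0<ε)))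
      (≤-trans (subst (_≤ s n * s n + recip n) y≡x (y≤s*s n)) (+-monoʳ-≤ (s n * s n) recip≤))
      where
      y≡x : seq y n ≡ seq x n
      y≡x = p≥q⇒p⊔q≡p (proj₂ 0≤x n n≥)

-- The degree-square inequality

_⊑_ : ∀ {n} → Graph n → Graph n → Set
K ⊑ H = ∀ u v → adj K u v ≡ true → adj H u v ≡ true

⊑⇒⊆ᴳ : ∀ {n} {K H : Graph n} → K ⊑ H → K ⊆ᴳ H
⊑⇒⊆ᴳ K⊑H = record { emb = λ v → v ; injective = λ e → e ; preserves = K⊑H }

foldr-⊔-≥ : ∀ {n} (f : Fin n → ℕ) i → f i ℕ.≤ foldr ℕ._⊔_ 0 f
foldr-⊔-≥ f zero    = ℕ.m≤m⊔n _ _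
foldr-⊔-≥ f (suc i) = ℕ.≤-trans (foldr-⊔-≥ (f ∘ suc) i) (ℕ.m≤n⊔m _ _)

foldr-⊔-≤ : ∀ {n} (f : Fin n → ℕ) {b} → (∀ i → f i ℕ.≤ b) → foldr ℕ._⊔_ 0 f ℕ.≤ b
foldr-⊔-≤ {zero}  f h = ℕ.z≤n
foldr-⊔-≤ {suc n} f h = ℕ.⊔-lub (h zero) (foldr-⊔-≤ (f ∘ suc) (h ∘ suc))

degree≤Δ : ∀ {n} (G : Graph n) v → degree G v ℕ.≤ Δ G
degree≤Δ G v = foldr-⊔-≥ (degree G) v

Δ≤ : ∀ {n} (G : Graph n) {b} → (∀ v → degree G v ℕ.≤ b) → Δ G ℕ.≤ b
Δ≤ G = foldr-⊔-≤ (degree G)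

degree-mono : ∀ {n} {K H : Graph n} → K ⊑ H → ∀ v → degree K v ℕ.≤ degree H v
degree-mono K⊑H v = count-mono (K⊑H v)

Δ-mono : ∀ {n} {K H : Graph n} → K ⊑ H → Δ K ℕ.≤ Δ H
Δ-mono {K = K} {H} K⊑H = Δ≤ K λ v → ℕ.≤-trans (degree-mono {K = K} {H} K⊑H v) (degree≤Δ H v)

fromℕ-seq : ∀ k l → seq (fromℕ k) l ≡ toℚ k
fromℕ-seq k l = sym (ι-def (ℤ.+ k))

-- The coefficient of ε in `square-bound`, collected from (s + 2 ε)² = s² + 4 ε (s + ε) and crude
-- bounds for s. It does not depend on ε, which is what the passage to the limit requires.
slack : ℚ → ℚ → ℚ
slack d D = (D + 1ℚ) + two * (two * (ℚ.∣ d ∣ * D + (D + 1ℚ) + 1ℚ + 1ℚ))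

square-bound : ∀ {lam s dl d′ D ε} → 0ℚ ≤ lam → 0ℚ ≤ s → 0ℚ ≤ ε → ε ≤ 1ℚ → 0ℚ ≤ D →
  lam ≤ s + ε + ε → s * s ≤ dl * D + ε → dl ≤ d′ + ε →
  lam * lam ≤ d′ * D + ε * slack d′ D
square-bound {lam} {s} {dl} {d′} {D} {ε} 0≤lam 0≤s 0≤ε ε≤1 0≤D lam≤ s²≤ dl≤ = begin
  lam * lam                                       ≤⟨ *-mono-≤₀ 0≤lam lam≤ 0≤lam lam≤ ⟩
  (s + ε + ε) * (s + ε + ε)                       ≡⟨ expand s ε ⟩
  s * s + ε * (two * (two * (s + ε)))  ≤⟨ +-mono-≤ s²≤₁ (*-monoˡ₀ 0≤ε (*-monoˡ₀ 0≤two (*-monoˡ₀ 0≤two s+ε≤))) ⟩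
  d′ * D + ε * (D + 1ℚ) + ε * (two * (two * (U + 1ℚ + 1ℚ)))
                                                  ≡⟨ collect (d′ * D) ε (D + 1ℚ) (two * (two * (U + 1ℚ + 1ℚ))) ⟩
  d′ * D + ε * ((D + 1ℚ) + two * (two * (U + 1ℚ + 1ℚ))) ∎
  where
  open ≤-Reasoning
  U = ℚ.∣ d′ ∣ * D + (D + 1ℚ)
  expand : ∀ s e → (s + e + e) * (s + e + e) ≡ s * s + e * (two * (two * (s + e)))
  expand = solve 2 (λ s e → (s :+ e :+ e) :* (s :+ e :+ e) := s :* s :+ e :* (con (1ℚ + 1ℚ) :* (con (1ℚ + 1ℚ) :* (s :+ e)))) refl
  collect : ∀ q e a b → q + e * a + e * b ≡ q + e * (a + b)
  collect = solve 4 (λ q e a b → q :+ e :* a :+ e :* b := q :+ e :* (a :+ b)) refl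
  distribute : ∀ d D e → (d + e) * D + e ≡ d * D + e * (D + 1ℚ)
  distribute = solve 3 (λ d D e → (d :+ e) :* D :+ e := d :* D :+ e :* (D :+ con 1ℚ)) refl
  s²≤₁ : s * s ≤ d′ * D + ε * (D + 1ℚ)
  s²≤₁ = ≤-trans s²≤ (≤-trans (+-monoˡ-≤ ε (*-monoʳ₀ 0≤D dl≤)) (≤-reflexive (distribute d′ D ε)))
  s+ε≤ : s + ε ≤ U + 1ℚ + 1ℚ
  s+ε≤ = +-mono-≤ (≤-trans (p≤p*p+1 s) (+-monoˡ-≤ 1ℚ (≤-trans s²≤₁
    (+-mono-≤ (*-monoʳ₀ 0≤D (p≤∣p∣ d′)) (subst (ε * (D + 1ℚ) ≤_) (*-identityˡ (D + 1ℚ)) (*-monoʳ₀ (0≤+ 0≤D 0≤1) ε≤1)))))) ε≤1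

BoundedBy : ∀ {n} → ℝ → Graph n → Set
BoundedBy d K = ∀ ρ s → IsSpectralRadius K ρ → IsSqrt (d *ᵣ fromℕ (Δ K)) s → ρ ≤ᵣ s

eventually-nonNeg : ∀ d → 0ℝ <ᵣ d → ∀ k → ∃[ N ] (∀ n → N ℕ.≤ n → 0ℚ ≤ seq (d *ᵣ fromℕ k) n)
eventually-nonNeg d (ε , 0<ε , N , h) k = N , λ n N≤n →
  subst (0ℚ ≤_) (sym (*ᵣ-seq d (fromℕ k) n)) (0≤* (≤-trans (<⇒≤ 0<ε) (≤-trans (≤-reflexive (sym (+-identityˡ ε))) (h n N≤n)))
    (subst (0ℚ ≤_) (sym (fromℕ-seq k n)) (0≤toℚ k)))

-- Schur's test is applied with lam ≤ ρ + ε ≤ √(d Δ) + 2 ε, read at one index `l` beyond all four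
-- moduli involved, and then ε tends to 0.
supersolutions⇒bound : ∀ {n} (K : Graph n) d d′ → 0ℝ <ᵣ d → d ≤ᵣ fromℚ d′ → BoundedBy d K →
  ∀ ρ → IsSpectralRadius K ρ →
  (∀ ε → 0ℚ < ε → ∃[ lam ] (Supersolution K lam × ∃[ k ] (∀ l → k ℕ.≤ l → lam ≤ seq ρ l + ε))) →
  ∀ a → sum (λ i → adjacency K a i * adjacency K a i) ≤ d′ * toℚ (Δ K) * sum (λ i → a i * a i)
supersolutions⇒bound K d d′ 0<d d≤d′ bounded ρ isρ super a = ≤-limit* (M * Q) (0≤* 0≤M 0≤Q) step
  where
  D = toℚ (Δ K)
  0≤D : 0ℚ ≤ D
  0≤D = 0≤toℚ (Δ K)
  Q = sum (λ i → a i * a i)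
  0≤Q : 0ℚ ≤ Q
  0≤Q = sum-nonNeg λ i → 0≤p*p (a i)
  M = slack d′ D
  0≤M : 0ℚ ≤ M
  0≤M = 0≤+ (0≤+ 0≤D 0≤1) (0≤* 0≤two (0≤* 0≤two (0≤+ (0≤+ (0≤+ (0≤* (0≤∣p∣ d′) 0≤D) (0≤+ 0≤D 0≤1)) 0≤1) 0≤1)))
  open Sqrt (d *ᵣ fromℕ (Δ K)) (eventually-nonNeg d 0<d (Δ K))
  ρ≤s : ρ ≤ᵣ √x
  ρ≤s = bounded ρ √x isρ isSqrt
  step : ∀ ε → 0ℚ < ε → ε ≤ 1ℚ → sum (λ i → adjacency K a i * adjacency K a i) ≤ d′ * D * Q + ε * (M * Q)
  step ε 0<ε ε≤1 = begin
    sum (λ i → adjacency K a i * adjacency K a i)  ≤⟨ schur-test a ⟩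
    lam * lam * Q  ≤⟨ *-monoʳ₀ 0≤Q (square-bound {d′ = d′} 0≤lam (0≤s l) (<⇒≤ 0<ε) ε≤1 0≤D lam≤ s²≤ (proj₂ (d≤d′ ε 0<ε) l l≥₄)) ⟩
    (d′ * D + ε * M) * Q                           ≡⟨ expand (d′ * D) ε M Q ⟩
    d′ * D * Q + ε * (M * Q)                       ∎
    where
    open ≤-Reasoning
    expand : ∀ p e m q → (p + e * m) * q ≡ p * q + e * (m * q)
    expand = solve 4 (λ p e m q → (p :+ e :* m) :* q := p :* q :+ e :* (m :* q)) refl
    lam = proj₁ (super ε 0<ε)
    open Supersolution (proj₁ (proj₂ (super ε 0<ε)))
    N₁ N₂ N₃ N₄ l : ℕ
    N₁ = proj₁ (proj₂ (proj₂ (super ε 0<ε)))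
    N₂ = proj₁ (ρ≤s ε 0<ε)
    N₃ = proj₁ (proj₂ isSqrt ε 0<ε)
    N₄ = proj₁ (d≤d′ ε 0<ε)
    l = N₁ ℕ.⊔ N₂ ℕ.⊔ (N₃ ℕ.⊔ N₄)
    l≥₁ : N₁ ℕ.≤ l
    l≥₁ = ℕ.≤-trans (ℕ.m≤m⊔n N₁ N₂) (ℕ.m≤m⊔n (N₁ ℕ.⊔ N₂) (N₃ ℕ.⊔ N₄))
    l≥₂ : N₂ ℕ.≤ l
    l≥₂ = ℕ.≤-trans (ℕ.m≤n⊔m N₁ N₂) (ℕ.m≤m⊔n (N₁ ℕ.⊔ N₂) (N₃ ℕ.⊔ N₄))
    l≥₃ : N₃ ℕ.≤ l
    l≥₃ = ℕ.≤-trans (ℕ.m≤m⊔n N₃ N₄) (ℕ.m≤n⊔m (N₁ ℕ.⊔ N₂) (N₃ ℕ.⊔ N₄))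
    l≥₄ : N₄ ℕ.≤ l
    l≥₄ = ℕ.≤-trans (ℕ.m≤n⊔m N₃ N₄) (ℕ.m≤n⊔m (N₁ ℕ.⊔ N₂) (N₃ ℕ.⊔ N₄))
    lam≤ : lam ≤ s l + ε + ε
    lam≤ = ≤-trans (proj₂ (proj₂ (proj₂ (super ε 0<ε))) l l≥₁) (+-monoˡ-≤ ε (proj₂ (ρ≤s ε 0<ε) l l≥₂))
    s²≤ : s l * s l ≤ seq d l * D + ε
    s²≤ = subst (λ t → s l * s l ≤ seq d l * t + ε) (fromℕ-seq (Δ K) l)
      (abs≤⁻¹ (s l * s l) (seq d l * seq (fromℕ (Δ K)) l) (proj₂ (proj₂ isSqrt ε 0<ε) l l≥₃))

restrict : ∀ {n} → Graph n → (Fin n → Bool) → Graph n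
restrict H S = record
  { adj    = λ u v → adj H u v ∧ (S u ∧ S v)
  ; symm   = λ u v → cong₂ _∧_ (symm H u v) (Bool.∧-comm (S u) (S v))
  ; irrefl = λ v → cong (_∧ (S v ∧ S v)) (irrefl H v)
  }

∧-true⁻ : ∀ a b → a ∧ b ≡ true → a ≡ true × b ≡ true
∧-true⁻ true  b h = refl , h

restrict-edge : ∀ {n} (H : Graph n) S u v → adj (restrict H S) u v ≡ true →
                adj H u v ≡ true × S u ≡ true × S v ≡ true
restrict-edge H S u v h = proj₁ (∧-true⁻ _ _ h) , ∧-true⁻ _ _ (proj₂ (∧-true⁻ (adj H u v) _ h))

restrict-⊑ : ∀ {n} (H : Graph n) S → restrict H S ⊑ H
restrict-⊑ H S u v h = proj₁ (restrict-edge H S u v h)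

module Components {n} (H : Graph n) (d : ℝ) (d′ : ℚ) (0<d : 0ℝ <ᵣ d) (d≤d′ : d ≤ᵣ fromℚ d′) (0≤d′ : 0ℚ ≤ d′)
  (bounded : ∀ K → K ⊑ H → BoundedBy d K) (a : Fin n → ℚ) where

  f g : Fin n → ℚ
  f i = adjacency H a i * adjacency H a i
  g i = a i * a i

  Q = d′ * toℚ (Δ H)

  -- A component is closed under adjacency, so on its vertices A a in `H` agrees with A applied in
  -- `K` to the part of a on the component. The maximum degree does not grow in passing from `H` to
  -- `K`.
  component-bound : ∀ r (C : Component H r) → let S = Component.members C in
    sum (λ i → ⟦ S i ⟧ * f i) ≤ Q * sum (λ i → ⟦ S i ⟧ * g i)
  component-bound r C = begin
    sum (λ i → ⟦ S i ⟧ * f i)                       ≤⟨ sum-mono (λ i → row i (S i) refl) ⟩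
    sum (λ i → adjacency K b i * adjacency K b i)  ≤⟨ supersolutions⇒bound K d d′ 0<d d≤d′ (bounded K (restrict-⊑ H S)) ρ spectralRadius supersolutions b ⟩
    d′ * toℚ (Δ K) * sum (λ i → b i * b i)  ≤⟨ *-monoʳ₀ (sum-nonNeg λ i → 0≤p*p (b i)) (*-monoˡ₀ 0≤d′ (toℚ-mono (Δ-mono {K = K} {H} (restrict-⊑ H S)))) ⟩
    Q * sum (λ i → b i * b i)  ≡⟨ cong (Q *_) (sum-cong-≗ {n} {λ i → b i * b i} {λ i → ⟦ S i ⟧ * g i} (λ i → square (S i) (a i))) ⟩
    Q * sum (λ i → ⟦ S i ⟧ * g i)                   ∎
    where
    open ≤-Reasoning
    open Component C renaming (members to S; root to Sr)
    K : Graph n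
    K = restrict H S
    b : Fin n → ℚ
    b i = ⟦ S i ⟧ * a i
    open Perron K S (λ i j ij → proj₁ (proj₂ (restrict-edge H S i j ij))) r Sr steps
      (linked K (λ i j Si Sj ij → cong₂ _∧_ ij (cong₂ _∧_ Si Sj)))
      using (ρ; spectralRadius; supersolutions)
    square : ∀ s t → (⟦ s ⟧ * t) * (⟦ s ⟧ * t) ≡ ⟦ s ⟧ * (t * t)
    square true  t = trans (cong₂ _*_ (*-identityˡ t) (*-identityˡ t)) (sym (*-identityˡ (t * t)))
    square false t = trans (cong₂ _*_ (*-zeroˡ t) (*-zeroˡ t)) (trans (*-zeroˡ 0ℚ) (sym (*-zeroˡ (t * t))))
    entry : ∀ i → S i ≡ true → ∀ j h → adj H i j ≡ h → ∀ t → S j ≡ t → ⟦ adj H i j ⟧ * a j ≡ ⟦ adj K i j ⟧ * b j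
    entry i Si j true ij t Sj = trans (cong (λ x → ⟦ x ⟧ * a j) (trans ij (sym Kij)))
      (cong (⟦ adj K i j ⟧ *_) (sym (trans (cong (λ x → ⟦ x ⟧ * a j) Sj′) (*-identityˡ (a j)))))
      where
      Sj′ : S j ≡ true
      Sj′ = closed i j Si ij
      Kij : adj K i j ≡ true
      Kij = cong₂ _∧_ ij (cong₂ _∧_ Si Sj′)
    entry i Si j false ij t Sj = trans (cong (λ x → ⟦ x ⟧ * a j) ij) (trans (*-zeroˡ (a j))
      (sym (trans (cong (λ x → ⟦ x ∧ (S i ∧ S j) ⟧ * b j) ij) (*-zeroˡ (b j)))))
    row : ∀ i t → S i ≡ t → ⟦ S i ⟧ * f i ≤ adjacency K b i * adjacency K b i
    row i true  Si = ≤-reflexive (trans (cong (λ x → ⟦ x ⟧ * f i) Si) (trans (*-identityˡ (f i))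
      (cong (λ x → x * x) (sum-cong-≗ {n} {λ j → ⟦ adj H i j ⟧ * a j} {λ j → ⟦ adj K i j ⟧ * b j}
        (λ j → entry i Si j (adj H i j) refl (S j) refl)))))
    row i false Si = subst (_≤ adjacency K b i * adjacency K b i)
      (sym (trans (cong (λ x → ⟦ x ⟧ * f i) Si) (*-zeroˡ (f i)))) (0≤p*p (adjacency K b i))

  Bound : (Fin n → Bool) → Set
  Bound V = sum (λ i → ⟦ V i ⟧ * f i) ≤ Q * sum (λ i → ⟦ V i ⟧ * g i)

  bound-∪ : ∀ V S → (∀ i → V i ≡ true → S i ≡ true → false ≡ true) → Bound V → Bound S → Bound (λ i → V i ∨ S i)
  bound-∪ V S disjoint hV hS = subst₂ _≤_ (sym (split f)) (trans (sym (*-distribˡ-+ Q _ _)) (cong (Q *_) (sym (split g)))) (+-mono-≤ hV hS)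
    where
    indicator : ∀ u v → (u ≡ true → v ≡ true → false ≡ true) → ∀ t → ⟦ u ∨ v ⟧ * t ≡ ⟦ u ⟧ * t + ⟦ v ⟧ * t
    indicator true  true  h t = contradiction (h refl refl) λ ()
    indicator true  false h t = sym (trans (cong (1ℚ * t +_) (*-zeroˡ t)) (+-identityʳ (1ℚ * t)))
    indicator false v     h t = sym (trans (cong (_+ ⟦ v ⟧ * t) (*-zeroˡ t)) (+-identityˡ (⟦ v ⟧ * t)))
    split : ∀ (h : Fin n → ℚ) → sum (λ i → ⟦ V i ∨ S i ⟧ * h i) ≡ sum (λ i → ⟦ V i ⟧ * h i) + sum (λ i → ⟦ S i ⟧ * h i)
    split h = trans (sum-cong-≗ {n} {λ i → ⟦ V i ∨ S i ⟧ * h i} {λ i → ⟦ V i ⟧ * h i + ⟦ S i ⟧ * h i} (λ i → indicator (V i) (S i) (disjoint i) (h i)))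
      (∑-distrib-+ (λ i → ⟦ V i ⟧ * h i) (λ i → ⟦ S i ⟧ * h i))

  -- `V` is the union of the components treated so far. Its complement is closed as well, by
  -- symmetry of adjacency, so the component of a vertex outside `V` is disjoint from `V` and the
  -- two bounds add.
  sweep : ∀ fuel V → n ℕ.≤ fuel ℕ.+ count V → Closed H V → Bound V → sum f ≤ Q * sum g
  sweep fuel V enough V-closed hV = go (any? λ r → V r Bool.≟ false)
    where
    go : Dec (∃[ r ] V r ≡ false) → sum f ≤ Q * sum g
    go (no none) = subst₂ _≤_ (all f) (cong (Q *_) (all g)) hV
      where
      all : ∀ h → sum (λ i → ⟦ V i ⟧ * h i) ≡ sum h
      all h = sum-cong-≗ {n} {λ i → ⟦ V i ⟧ * h i} {h} λ i →
        trans (cong (λ x → ⟦ x ⟧ * h i) (Bool.¬-not λ Vi → none (i , Vi))) (*-identityˡ (h i))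
    go (yes (r , Vr)) = continue fuel enough
      where
      C : Component H r
      C = component H r
      open Component C renaming (members to S; root to Sr)
      complement-closed : Closed H (λ i → not (V i))
      complement-closed i j ¬Vi ij = Bool.¬-not λ h → contradiction
        (trans (sym ¬Vi) (cong not (V-closed j i (Bool.not-injective h) (trans (symm H j i) ij)))) λ ()
      disjoint : ∀ i → V i ≡ true → S i ≡ true → false ≡ true
      disjoint i Vi Si = trans (cong not (sym Vi)) (least (λ i → not (V i)) (cong not Vr) complement-closed i Si)
      V′ : Fin n → Bool
      V′ i = V i ∨ S i
      V⊆V′ : ∀ i → V i ≡ true → V′ i ≡ true
      V⊆V′ i Vi = cong (_∨ S i) Vi
      S⊆V′ : ∀ i → S i ≡ true → V′ i ≡ true
      S⊆V′ i Si = trans (cong (V i ∨_) Si) (Bool.∨-zeroʳ (V i))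
      V′-closed : Closed H V′
      V′-closed i j V′i ij = cases (V i) refl
        where
        cases : ∀ b → V i ≡ b → V′ j ≡ true
        cases true  Vi = V⊆V′ j (V-closed i j Vi ij)
        cases false Vi = S⊆V′ j (closed i j (trans (cong (_∨ S i) (sym Vi)) V′i) ij)
      more : count V ℕ.< count V′
      more = count-strict V⊆V′ r Vr (S⊆V′ r Sr)
      continue : ∀ fuel → n ℕ.≤ fuel ℕ.+ count V → sum f ≤ Q * sum g
      continue zero    n≤ = contradiction (ℕ.<-≤-trans (ℕ.≤-<-trans n≤ more) (count≤n V′)) (ℕ.<-irrefl refl)
      continue (suc k) n≤ = sweep k V′
        (ℕ.≤-trans n≤ (ℕ.≤-trans (ℕ.≤-reflexive (sym (ℕ.+-suc k (count V)))) (ℕ.+-monoʳ-≤ k more)))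
        V′-closed (bound-∪ V S disjoint hV (component-bound r C))

  square-degree-bound : sum f ≤ Q * sum g
  square-degree-bound = sweep n (λ _ → false) (ℕ.m≤m+n n _) (λ _ _ ()) (≤-reflexive
    (trans (sum-zero (λ i → *-zeroˡ (f i))) (sym (trans (cong (Q *_) (sum-zero (λ i → *-zeroˡ (g i)))) (*-zeroʳ Q)))))

-- Comparing powers with powers of two

toℚ-^ : ∀ k → toℚ (2 ℕ.^ k) ≡ two ^ k
toℚ-^ zero    = ι-1
toℚ-^ (suc k) = trans (toℚ-* 2 (2 ℕ.^ k)) (cong₂ _*_ toℚ-2 (toℚ-^ k))

0<two : 0ℚ < two
0<two = positive⁻¹ two

2^⁺ : ∀ k → 2^ (ℤ.+ k) ≡ two ^ k
2^⁺ k = trans (sym (ι-def (ℤ.+ (2 ℕ.^ k)))) (toℚ-^ k)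

2^⁻ : ∀ k → 2^ ℤ.-[1+ k ] * two ^ suc k ≡ 1ℚ
2^⁻ k = trans (cong (2^ ℤ.-[1+ k ] *_) (sym (toℚ-^ (suc k))))
  (trans (/-*-ι (ℤ.+ 1) (2 ℕ.^ suc k) {{ℕ.m^n≢0 2 (suc k)}}) ι-1)

2^-suc : ∀ a → 2^ (ℤ.suc a) ≡ two * 2^ a
2^-suc (ℤ.+ k) = trans (2^⁺ (suc k)) (cong (two *_) (sym (2^⁺ k)))
2^-suc ℤ.-[1+ zero ] = trans (2^⁺ 0) (trans (sym (2^⁻ 0)) (rearrange (2^ ℤ.-[1+ 0 ]) two))
  where
  rearrange : ∀ y t → y * (t * 1ℚ) ≡ t * y
  rearrange = solve 2 (λ y t → y :* (t :* con 1ℚ) := t :* y) refl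
2^-suc ℤ.-[1+ suc k ] = begin
  x                      ≡⟨ *-identityʳ x ⟨
  x * 1ℚ                 ≡⟨ cong (x *_) (2^⁻ (suc k)) ⟨
  x * (y * (two * p))    ≡⟨ rearrange x y two p ⟩
  x * p * (two * y)      ≡⟨ cong (_* (two * y)) (2^⁻ k) ⟩
  1ℚ * (two * y)         ≡⟨ *-identityˡ (two * y) ⟩
  two * y                ∎
  where
  open ≡-Reasoning
  x = 2^ ℤ.-[1+ k ]
  y = 2^ ℤ.-[1+ suc k ]
  p = two ^ suc k
  rearrange : ∀ x y t p → x * (y * (t * p)) ≡ x * p * (t * y)
  rearrange = solve 4 (λ x y t p → x :* (y :* (t :* p)) := x :* p :* (t :* y)) refl

2^-+ : ∀ a n → 2^ (a ℤ.+ ℤ.+ n) ≡ 2^ a * two ^ n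
2^-+ a zero    = trans (cong 2^_ (ℤ.+-identityʳ a)) (sym (*-identityʳ (2^ a)))
2^-+ a (suc n) = begin
  2^ (a ℤ.+ ℤ.+ suc n)          ≡⟨ cong 2^_ (move a (ℤ.+ n)) ⟩
  2^ (ℤ.suc (a ℤ.+ ℤ.+ n))      ≡⟨ 2^-suc (a ℤ.+ ℤ.+ n) ⟩
  two * 2^ (a ℤ.+ ℤ.+ n)        ≡⟨ cong (two *_) (2^-+ a n) ⟩
  two * (2^ a * two ^ n)        ≡⟨ rearrange two (2^ a) (two ^ n) ⟩
  2^ a * (two * two ^ n)        ∎
  where
  open ≡-Reasoning
  move : ∀ a b → a ℤ.+ ℤ.suc b ≡ ℤ.suc (a ℤ.+ b)
  move a b = trans (sym (ℤ.+-assoc a (ℤ.+ 1) b)) (trans (cong (ℤ._+ b) (ℤ.+-comm a (ℤ.+ 1))) (ℤ.+-assoc (ℤ.+ 1) a b))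
  rearrange : ∀ t x p → t * (x * p) ≡ x * (t * p)
  rearrange = solve 3 (λ t x p → t :* (x :* p) := x :* (t :* p)) refl

0<2^ : ∀ a → 0ℚ < 2^ a
0<2^ (ℤ.+ k)     = subst (0ℚ <_) (sym (2^⁺ k)) (0<^ k 0<two)
0<2^ ℤ.-[1+ k ] = ≰⇒> λ ≤0 → <-irrefl refl (<-≤-trans (positive⁻¹ 1ℚ) (begin
  1ℚ                             ≡⟨ 2^⁻ k ⟨
  2^ ℤ.-[1+ k ] * two ^ suc k    ≤⟨ *-monoʳ₀ (0≤^ (suc k) 0≤two) ≤0 ⟩
  0ℚ * two ^ suc k               ≡⟨ *-zeroˡ (two ^ suc k) ⟩
  0ℚ                             ∎))
  where open ≤-Reasoning

+-to-difference : ∀ {a b} → a ℤ.≤ b → b ≡ a ℤ.+ ℤ.+ ℤ.∣ b ℤ.- a ∣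
+-to-difference {a} {b} a≤b = sym (trans (cong (λ t → a ℤ.+ t) (ℤ.0≤i⇒+∣i∣≡i (ℤ.i≤j⇒0≤j-i a≤b)))
  (trans (ℤ.+-comm a (b ℤ.- a)) (trans (ℤ.+-assoc b (ℤ.- a) a) (trans (cong (λ t → b ℤ.+ t) (ℤ.+-inverseˡ a)) (ℤ.+-identityʳ b)))))

1≤two^ : ∀ n → 1ℚ + toℚ n ≤ two ^ n
1≤two^ n = ≤-trans (≤-reflexive (cong (1ℚ +_) (sym (*-identityʳ (toℚ n))))) (bernoulli n 0≤1)

2^-cancel : ∀ {a b} → 2^ a ≤ 2^ b → a ℤ.≤ b
2^-cancel {a} {b} h = decide (a ℤ.≤? b)
  where
  open ≤-Reasoning
  decide : Dec (a ℤ.≤ b) → a ℤ.≤ b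
  decide (yes a≤b) = a≤b
  decide (no a≰b)  = contradiction (begin-strict
    2^ b                       ≡⟨ *-identityˡ (2^ b) ⟨
    1ℚ * 2^ b  <⟨ *-monoˡ-<-pos (2^ b) {{positive (0<2^ b)}} (p<p+q {1ℚ} (positive⁻¹ 1ℚ)) ⟩
    two * 2^ b                 ≡⟨ 2^-suc b ⟨
    2^ (ℤ.suc b)               ≡⟨ *-identityʳ (2^ (ℤ.suc b)) ⟨
    2^ (ℤ.suc b) * 1ℚ  ≤⟨ *-monoˡ₀ (<⇒≤ (0<2^ (ℤ.suc b))) (≤-trans (p≤p+q (0≤toℚ k)) (1≤two^ k)) ⟩
    2^ (ℤ.suc b) * two ^ k     ≡⟨ 2^-+ (ℤ.suc b) k ⟨
    2^ (ℤ.suc b ℤ.+ ℤ.+ k)     ≡⟨ cong 2^_ (+-to-difference (ℤ.i<j⇒suc[i]≤j (ℤ.≰⇒> a≰b))) ⟨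
    2^ a                       ≤⟨ h ⟩
    2^ b                       ∎) (<-irrefl refl)
    where k = ℤ.∣ a ℤ.- ℤ.suc b ∣

2^-+ℤ : ∀ a b → 2^ (a ℤ.+ b) ≡ 2^ a * 2^ b
2^-+ℤ a (ℤ.+ n) = trans (2^-+ a n) (cong (2^ a *_) (sym (2^⁺ n)))
2^-+ℤ a b@(ℤ.-[1+ m ]) = begin
  x                        ≡⟨ *-identityʳ x ⟨
  x * 1ℚ                   ≡⟨ cong (x *_) (2^⁻ m) ⟨
  x * (2^ b * p)           ≡⟨ rearrange x (2^ b) p ⟩
  x * p * 2^ b             ≡⟨ cong (_* 2^ b) (2^-+ (a ℤ.+ b) (suc m)) ⟨
  2^ (a ℤ.+ b ℤ.+ ℤ.+ suc m) * 2^ b ≡⟨ cong (λ t → 2^ t * 2^ b) (trans (ℤ.+-assoc a b (ℤ.+ suc m)) (trans (cong (λ t → a ℤ.+ t) (ℤ.+-inverseˡ (ℤ.+ suc m))) (ℤ.+-identityʳ a))) ⟩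
  2^ a * 2^ b              ∎
  where
  open ≡-Reasoning
  x = 2^ (a ℤ.+ b)
  p = two ^ suc m
  rearrange : ∀ x y p → x * (y * p) ≡ x * p * y
  rearrange = solve 3 (λ x y p → x :* (y :* p) := x :* p :* y) refl

2^-* : ∀ a n → (2^ a) ^ n ≡ 2^ (a ℤ.* ℤ.+ n)
2^-* a zero    = sym (trans (cong 2^_ (ℤ.*-zeroʳ a)) (2^⁺ 0))
2^-* a (suc n) = trans (cong (2^ a *_) (2^-* a n)) (trans (sym (2^-+ℤ a (a ℤ.* ℤ.+ n))) (cong 2^_ (sym (expand a (ℤ.+ n)))))
  where
  expand : ∀ a b → a ℤ.* ℤ.suc b ≡ a ℤ.+ a ℤ.* b
  expand a b = trans (ℤ.*-distribˡ-+ a (ℤ.+ 1) b) (cong (ℤ._+ (a ℤ.* b)) (ℤ.*-identityʳ a))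

-- p = a / b and q = a′ / b′, with denominators cleared.
log-mono : ∀ {y b b′ a a′ p q} → 0ℚ < y → ι a ≡ p * toℚ (suc b) → ι a′ ≡ q * toℚ (suc b′) →
           2^ a ≤ y ^ suc b → y ^ suc b′ ≤ 2^ a′ → p ≤ q
log-mono {y} {b-1} {b′-1} {a} {a′} {p} {q} 0<y pa qa′ lo hi = *-cancelʳ₀ (0<* (toℚ b) (toℚ b′) (0<toℚ-suc b-1) (0<toℚ-suc b′-1)) (begin
  p * (toℚ b * toℚ b′)      ≡⟨ *-assoc p (toℚ b) (toℚ b′) ⟨
  p * toℚ b * toℚ b′        ≡⟨ cong (_* toℚ b′) pa ⟨
  ι a * toℚ b′              ≡⟨ ι-* a (ℤ.+ b′) ⟨
  ι (a ℤ.* ℤ.+ b′)          ≤⟨ ι-mono (2^-cancel exponents) ⟩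
  ι (a′ ℤ.* ℤ.+ b)          ≡⟨ ι-* a′ (ℤ.+ b) ⟩
  ι a′ * toℚ b              ≡⟨ cong (_* toℚ b) qa′ ⟩
  q * toℚ b′ * toℚ b        ≡⟨ rearrange q (toℚ b′) (toℚ b) ⟩
  q * (toℚ b * toℚ b′)      ∎)
  where
  open ≤-Reasoning
  b b′ : ℕ
  b  = suc b-1
  b′ = suc b′-1
  rearrange : ∀ q c d → q * c * d ≡ q * (d * c)
  rearrange = solve 3 (λ q c d → q :* c :* d := q :* (d :* c)) refl
  exponents : 2^ (a ℤ.* ℤ.+ b′) ≤ 2^ (a′ ℤ.* ℤ.+ b)
  exponents = begin
    2^ (a ℤ.* ℤ.+ b′)    ≡⟨ 2^-* a b′ ⟨
    (2^ a) ^ b′          ≤⟨ ^-mono b′ (<⇒≤ (0<2^ a)) lo ⟩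
    (y ^ b) ^ b′         ≡⟨ ^-assocʳ y b b′ ⟩
    y ^ (b ℕ.* b′)       ≡⟨ cong (y ^_) (ℕ.*-comm b b′) ⟩
    y ^ (b′ ℕ.* b)       ≡⟨ ^-assocʳ y b′ b ⟨
    (y ^ b′) ^ b         ≤⟨ ^-mono b (0≤^ b′ (<⇒≤ 0<y)) hi ⟩
    (2^ a′) ^ b          ≡⟨ 2^-* a′ b ⟩
    2^ (a′ ℤ.* ℤ.+ b)    ∎

-- After the fraction a / b is refined to the denominator B, the product of the two successors,
-- adding e to the numerator adds e / B to the value; `k` is 1 / B.
numerator-shift : ∀ a q b m k → ι a ≡ q * toℚ (suc b) → toℚ (suc b ℕ.* suc m) * k ≡ 1ℚ → ∀ e c → ι e ≡ c →
  ι (a ℤ.* ℤ.+ suc m ℤ.+ e) ≡ (q + c * k) * toℚ (suc b ℕ.* suc m)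
numerator-shift a q b m k qa inv e c ec = begin
  ι (a ℤ.* ℤ.+ suc m ℤ.+ e)                       ≡⟨ ι-+ (a ℤ.* ℤ.+ suc m) e ⟩
  ι (a ℤ.* ℤ.+ suc m) + ι e  ≡⟨ cong₂ _+_ (trans (ι-* a (ℤ.+ suc m)) (cong (_* toℚ (suc m)) qa)) ec ⟩
  q * toℚ (suc b) * toℚ (suc m) + c  ≡⟨ cong₂ _+_ (trans (*-assoc q (toℚ (suc b)) (toℚ (suc m))) (cong (q *_) (sym (toℚ-* (suc b) (suc m))))) (sym (trans (cong (c *_) inv) (*-identityʳ c))) ⟩
  q * B + c * (B * k)                             ≡⟨ collect q B c k ⟩
  (q + c * k) * B                                 ∎
  where
  open ≡-Reasoning
  B = toℚ (suc b ℕ.* suc m)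
  collect : ∀ q B c k → q * B + c * (B * k) ≡ (q + c * k) * B
  collect = solve 4 (λ q B c k → q :* B :+ c :* (B :* k) := (q :+ c :* k) :* B) refl

bernoulli⁻ : ∀ {c} n → 0ℚ ≤ c → c ≤ 1ℚ → 1ℚ - toℚ n * c ≤ (1ℚ - c) ^ n
bernoulli⁻ {c} zero    0≤c c≤1 = ≤-reflexive (trans (cong (λ t → 1ℚ - t) (trans (cong (_* c) ι-0) (*-zeroˡ c))) refl)
bernoulli⁻ {c} (suc n) 0≤c c≤1 = begin
  1ℚ - toℚ (suc n) * c                              ≡⟨ cong (λ t → 1ℚ - t * c) (toℚ-suc n) ⟩
  1ℚ - (1ℚ + toℚ n) * c                             ≤⟨ p≤p+q (0≤* (0≤toℚ n) (0≤* 0≤c 0≤c)) ⟩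
  1ℚ - (1ℚ + toℚ n) * c + toℚ n * (c * c)           ≡⟨ factor (toℚ n) c ⟩
  (1ℚ - c) * (1ℚ - toℚ n * c)  ≤⟨ *-monoˡ₀ (0≤q-p c≤1) (bernoulli⁻ n 0≤c c≤1) ⟩
  (1ℚ - c) * (1ℚ - c) ^ n                           ∎
  where
  open ≤-Reasoning
  factor : ∀ n c → 1ℚ - (1ℚ + n) * c + n * (c * c) ≡ (1ℚ - c) * (1ℚ - n * c)
  factor = solve 2 (λ n c → con 1ℚ :- (con 1ℚ :+ n) :* c :+ n :* (c :* c) := (con 1ℚ :- c) :* (con 1ℚ :- n :* c)) refl

-- Continuity of the logarithm without logarithms: (1 - c) y ≤ y′ and (h + 1) c = ½ give y^(h+1) ≤ 2
-- y′^(h+1) by Bernoulli, so log₂ y exceeds log₂ y′ by at most 1 / (h + 1).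
log-close : ∀ {y y′ c b b′ a a′ p q} h → 0ℚ < y → 0ℚ ≤ y′ → 0ℚ ≤ c → c ≤ 1ℚ → toℚ (suc h) * c ≡ ½ → (1ℚ - c) * y ≤ y′ →
  ι a ≡ p * toℚ (suc b) → ι a′ ≡ q * toℚ (suc b′) → 2^ a ≤ y ^ suc b → y′ ^ suc b′ ≤ 2^ a′ → p ≤ q + recip h
log-close {y} {y′} {c} {b} {b′} {a} {a′} {p} {q} h 0<y 0≤y′ 0≤c c≤1 hc close pa qa′ lo hi =
  subst (p ≤_) (cong (q +_) scaled) (log-mono {b′ = h ℕ.+ b′ ℕ.* suc h} 0<y pa
    (numerator-shift a′ q b′ h k qa′ (*-1/⁺ B 0<B) (ℤ.+ suc b′) (toℚ (suc b′)) refl) lo upper)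
  where
  open ≤-Reasoning
  B = toℚ (suc b′ ℕ.* suc h)
  0<B : 0ℚ < B
  0<B = 0<toℚ-suc (h ℕ.+ b′ ℕ.* suc h)
  k = 1/⁺ B 0<B
  scaled : toℚ (suc b′) * k ≡ recip h
  scaled = begin-equality
    toℚ (suc b′) * k  ≡⟨ trans (cong (toℚ (suc b′) * k *_) (*-1/⁺ (toℚ (suc h)) (0<toℚ-suc h))) (*-identityʳ _) ⟨
    toℚ (suc b′) * k * (toℚ (suc h) * recip h)  ≡⟨ rearrange (toℚ (suc b′)) k (toℚ (suc h)) (recip h) ⟩
    toℚ (suc b′) * toℚ (suc h) * k * recip h  ≡⟨ cong (λ t → t * k * recip h) (toℚ-* (suc b′) (suc h)) ⟨
    B * k * recip h                                    ≡⟨ cong (_* recip h) (*-1/⁺ B 0<B) ⟩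
    1ℚ * recip h                                       ≡⟨ *-identityˡ (recip h) ⟩
    recip h                                            ∎
    where
    rearrange : ∀ x k z r → x * k * (z * r) ≡ x * z * k * r
    rearrange = solve 4 (λ x k z r → x :* k :* (z :* r) := x :* z :* k :* r) refl
  y^h≤ : y ^ suc h ≤ two * y′ ^ suc h
  y^h≤ = begin
    y ^ suc h                                  ≡⟨ double (y ^ suc h) ⟩
    two * (½ * y ^ suc h)                      ≤⟨ *-monoˡ₀ 0≤two (*-monoʳ₀ (0≤^ (suc h) (<⇒≤ 0<y))
                                                    (≤-trans (≤-reflexive (cong (λ t → 1ℚ - t) (sym hc))) (bernoulli⁻ (suc h) 0≤c c≤1))) ⟩
    two * ((1ℚ - c) ^ suc h * y ^ suc h)       ≡⟨ cong (two *_) (^-distrib-* (1ℚ - c) y (suc h)) ⟨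
    two * ((1ℚ - c) * y) ^ suc h  ≤⟨ *-monoˡ₀ 0≤two (^-mono (suc h) (0≤* (0≤q-p c≤1) (<⇒≤ 0<y)) close) ⟩
    two * y′ ^ suc h                           ∎
    where
    double : ∀ z → z ≡ two * (½ * z)
    double = solve 1 (λ z → z := con (1ℚ + 1ℚ) :* (con ½ :* z)) refl
  upper : y ^ (suc b′ ℕ.* suc h) ≤ 2^ (a′ ℤ.* ℤ.+ suc h ℤ.+ ℤ.+ suc b′)
  upper = begin
    y ^ (suc b′ ℕ.* suc h)                     ≡⟨ cong (y ^_) (ℕ.*-comm (suc b′) (suc h)) ⟩
    y ^ (suc h ℕ.* suc b′)                     ≡⟨ ^-assocʳ y (suc h) (suc b′) ⟨
    (y ^ suc h) ^ suc b′                       ≤⟨ ^-mono (suc b′) (0≤^ (suc h) (<⇒≤ 0<y)) y^h≤ ⟩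
    (two * y′ ^ suc h) ^ suc b′                ≡⟨ ^-distrib-* two (y′ ^ suc h) (suc b′) ⟩
    two ^ suc b′ * (y′ ^ suc h) ^ suc b′  ≡⟨ cong (two ^ suc b′ *_) (trans (^-assocʳ y′ (suc h) (suc b′)) (trans (cong (y′ ^_) (ℕ.*-comm (suc h) (suc b′))) (sym (^-assocʳ y′ (suc b′) (suc h))))) ⟩
    two ^ suc b′ * (y′ ^ suc b′) ^ suc h  ≤⟨ *-monoˡ₀ (0≤^ (suc b′) 0≤two) (^-mono (suc h) (0≤^ (suc b′) 0≤y′) hi) ⟩
    two ^ suc b′ * (2^ a′) ^ suc h             ≡⟨ *-comm (two ^ suc b′) ((2^ a′) ^ suc h) ⟩
    (2^ a′) ^ suc h * two ^ suc b′             ≡⟨ cong (_* two ^ suc b′) (2^-* a′ (suc h)) ⟩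
    2^ (a′ ℤ.* ℤ.+ suc h) * two ^ suc b′       ≡⟨ 2^-+ (a′ ℤ.* ℤ.+ suc h) (suc b′) ⟨
    2^ (a′ ℤ.* ℤ.+ suc h ℤ.+ ℤ.+ suc b′)       ∎

power-gap : ∀ {u ε} → 0ℚ < u → 0ℚ < ε → ∃[ h ] two * u ^ suc h ≤ (u + ε) ^ suc h
power-gap {u} {ε} 0<u 0<ε = h , (begin
  two * u ^ suc h  ≤⟨ *-monoʳ₀ (0≤^ (suc h) (<⇒≤ 0<u)) (≤-trans (+-monoʳ-≤ 1ℚ (proj₂ arch)) (bernoulli (suc h) (<⇒≤ 0<κ))) ⟩
  (1ℚ + κ) ^ suc h * u ^ suc h                  ≡⟨ ^-distrib-* (1ℚ + κ) u (suc h) ⟨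
  ((1ℚ + κ) * u) ^ suc h  ≡⟨ cong (_^ suc h) (trans (expand κ u) (cong (u +_) (proj₂ (proj₂ div)))) ⟩
  (u + ε) ^ suc h                               ∎)
  where
  open ≤-Reasoning
  div : ∃[ κ ] (0ℚ < κ × κ * u ≡ ε)
  div = divide 0<ε 0<u
  κ = proj₁ div
  0<κ = proj₁ (proj₂ div)
  arch : ∃[ n ] 1ℚ ≤ toℚ (suc n) * κ
  arch = archimedean* 1ℚ 0<κ
  h = proj₁ arch
  expand : ∀ k u → (1ℚ + k) * u ≡ u + k * u
  expand = solve 2 (λ k u → (con 1ℚ :+ k) :* u := u :+ k :* u) refl

-- If y^b exceeds 2^a′ by ε, where b is the successor of `b′`, then after a further power h + 1 the
-- excess is a full factor 2. This is one unit in the numerator over the denominator b (h + 1), so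
-- `k` does not depend on y.
log-below : ∀ {ε} a′ q b′ → ι a′ ≡ q * toℚ (suc b′) → 0ℚ < ε →
  ∃[ k ] (0ℚ < k × (∀ y b a p → 0ℚ < y → ι a ≡ p * toℚ (suc b) → y ^ suc b ≤ 2^ a → 2^ a′ + ε ≤ y ^ suc b′ → q + k ≤ p))
log-below {ε} a′ q b′ qa′ 0<ε = k , 0<1/⁺ B 0<B , λ y b a p 0<y pa hi above → ≤-trans
  (≤-reflexive (cong (q +_) (sym (*-identityˡ k))))
  (log-mono {b = h ℕ.+ b′ ℕ.* suc h} {b} {p = q + 1ℚ * k} {p} 0<y (numerator-shift a′ q b′ h k qa′ (*-1/⁺ B 0<B) (ℤ.+ 1) 1ℚ ι-1) pa (lower y above) hi)
  where
  open ≤-Reasoning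
  gap : ∃[ h ] two * (2^ a′) ^ suc h ≤ (2^ a′ + ε) ^ suc h
  gap = power-gap (0<2^ a′) 0<ε
  h = proj₁ gap
  B = toℚ (suc b′ ℕ.* suc h)
  0<B : 0ℚ < B
  0<B = 0<toℚ-suc (h ℕ.+ b′ ℕ.* suc h)
  k = 1/⁺ B 0<B
  lower : ∀ y → 2^ a′ + ε ≤ y ^ suc b′ → 2^ (a′ ℤ.* ℤ.+ suc h ℤ.+ ℤ.+ 1) ≤ y ^ (suc b′ ℕ.* suc h)
  lower y above = begin
    2^ (a′ ℤ.* ℤ.+ suc h ℤ.+ ℤ.+ 1)     ≡⟨ 2^-+ (a′ ℤ.* ℤ.+ suc h) 1 ⟩
    2^ (a′ ℤ.* ℤ.+ suc h) * two ^ 1     ≡⟨ cong (_* two ^ 1) (2^-* a′ (suc h)) ⟨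
    (2^ a′) ^ suc h * two ^ 1  ≡⟨ trans (cong ((2^ a′) ^ suc h *_) (*-identityʳ two)) (*-comm ((2^ a′) ^ suc h) two) ⟩
    two * (2^ a′) ^ suc h               ≤⟨ proj₂ gap ⟩
    (2^ a′ + ε) ^ suc h                 ≤⟨ ^-mono (suc h) (0≤+ (<⇒≤ (0<2^ a′)) (<⇒≤ 0<ε)) above ⟩
    (y ^ suc b′) ^ suc h                ≡⟨ ^-assocʳ y (suc b′) (suc h) ⟩
    y ^ (suc b′ ℕ.* suc h)              ∎

-- The mirror image of `log-below`: a deficit of ε grows to a factor 2 in a suitable power, which
-- lowers the numerator by one.
log-above : ∀ {ε} a′ q b′ → ι a′ ≡ q * toℚ (suc b′) → 0ℚ < ε →
  ∃[ k ] (0ℚ < k × (∀ y b a p → 0ℚ < y → ι a ≡ p * toℚ (suc b) → 2^ a ≤ y ^ suc b → y ^ suc b′ + ε ≤ 2^ a′ → p + k ≤ q))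
log-above {ε} a′ q b′ qa′ 0<ε = k , 0<1/⁺ B 0<B , λ y b a p 0<y pa lo below → ≤-trans
  (+-monoˡ-≤ k {p} {q + - 1ℚ * k} (log-mono {b = b} {h ℕ.+ b′ ℕ.* suc h} {p = p} 0<y pa
    (numerator-shift a′ q b′ h k qa′ (*-1/⁺ B 0<B) ℤ.-[1+ 0 ] (- 1ℚ) ι-neg) lo (upper y (0≤^ (suc b′) (<⇒≤ 0<y)) below)))
  (≤-reflexive (cancel q k))
  where
  open ≤-Reasoning
  div : ∃[ κ ] (0ℚ < κ × κ * 2^ a′ ≡ ε)
  div = divide 0<ε (0<2^ a′)
  κ = proj₁ div
  0<κ = proj₁ (proj₂ div)
  arch : ∃[ n ] 1ℚ ≤ toℚ (suc n) * κ
  arch = archimedean* 1ℚ 0<κ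
  h = proj₁ arch
  B = toℚ (suc b′ ℕ.* suc h)
  0<B : 0ℚ < B
  0<B = 0<toℚ-suc (h ℕ.+ b′ ℕ.* suc h)
  k = 1/⁺ B 0<B
  ι-neg : ι ℤ.-[1+ 0 ] ≡ - 1ℚ
  ι-neg = ι-def ℤ.-[1+ 0 ]
  cancel : ∀ q k → q + - 1ℚ * k + k ≡ q
  cancel = solve 2 (λ q k → q :+ con (- 1ℚ) :* k :+ k := q) refl
  upper : ∀ y → 0ℚ ≤ y ^ suc b′ → y ^ suc b′ + ε ≤ 2^ a′ → y ^ (suc b′ ℕ.* suc h) ≤ 2^ (a′ ℤ.* ℤ.+ suc h ℤ.+ ℤ.-[1+ 0 ])
  upper y 0≤u below = *-cancelˡ₀ 0<two (begin
    two * y ^ (suc b′ ℕ.* suc h)                  ≡⟨ cong (two *_) (^-assocʳ y (suc b′) (suc h)) ⟨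
    two * u ^ suc h  ≤⟨ *-monoʳ₀ (0≤^ (suc h) 0≤u) (≤-trans (+-monoʳ-≤ 1ℚ (proj₂ arch)) (bernoulli (suc h) (<⇒≤ 0<κ))) ⟩
    (1ℚ + κ) ^ suc h * u ^ suc h                  ≡⟨ ^-distrib-* (1ℚ + κ) u (suc h) ⟨
    ((1ℚ + κ) * u) ^ suc h  ≤⟨ ^-mono (suc h) (0≤* (0≤+ 0≤1 (<⇒≤ 0<κ)) 0≤u) κu≤ ⟩
    (2^ a′) ^ suc h                               ≡⟨ 2^-* a′ (suc h) ⟩
    2^ (a′ ℤ.* ℤ.+ suc h)                         ≡⟨ cong 2^_ (step (a′ ℤ.* ℤ.+ suc h)) ⟩
    2^ (ℤ.suc (a′ ℤ.* ℤ.+ suc h ℤ.+ ℤ.-[1+ 0 ]))  ≡⟨ 2^-suc (a′ ℤ.* ℤ.+ suc h ℤ.+ ℤ.-[1+ 0 ]) ⟩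
    two * 2^ (a′ ℤ.* ℤ.+ suc h ℤ.+ ℤ.-[1+ 0 ])    ∎)
    where
    u = y ^ suc b′
    step : ∀ a → a ≡ ℤ.suc (a ℤ.+ ℤ.-[1+ 0 ])
    step a = sym (trans (cong ℤ.suc (ℤ.+-comm a ℤ.-[1+ 0 ])) (trans (sym (ℤ.+-assoc (ℤ.+ 1) ℤ.-[1+ 0 ] a)) (ℤ.+-identityˡ a)))
    u≤ : u ≤ 2^ a′
    u≤ = ≤-trans (p≤p+q (<⇒≤ 0<ε)) below
    κu≤ : (1ℚ + κ) * u ≤ 2^ a′
    κu≤ = begin
      (1ℚ + κ) * u            ≡⟨ trans (*-distribʳ-+ u 1ℚ κ) (cong (_+ κ * u) (*-identityˡ u)) ⟩
      u + κ * u               ≤⟨ +-monoʳ-≤ u (*-monoˡ₀ (<⇒≤ 0<κ) u≤) ⟩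
      u + κ * 2^ a′           ≡⟨ cong (u +_) (proj₂ (proj₂ div)) ⟩
      u + ε                   ≤⟨ below ⟩
      2^ a′                   ∎

-- The search over exponents starts at -(m + 1), where 1 ≤ (m + 1) y ensures that the power of two
-- is below y, and ends at n with y ≤ n < 2ⁿ.
floor-log : ∀ {y} → 0ℚ < y → ∃[ a ] (2^ a ≤ y × y ≤ 2^ (ℤ.suc a))
floor-log {y} 0<y = a (proj₁ last) , proj₁ (proj₂ last) ,
  subst (y ≤_) (cong 2^_ (next (proj₁ last))) (<⇒≤ (≰⇒> (proj₂ (proj₂ last))))
  where
  open ≤-Reasoning
  arch : ∃[ n ] 1ℚ ≤ toℚ (suc n) * y
  arch = archimedean* 1ℚ 0<y
  m = proj₁ arch
  a : ℕ → ℤ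
  a j = ℤ.-[1+ m ] ℤ.+ ℤ.+ j
  next : ∀ j → a (suc j) ≡ ℤ.suc (a j)
  next j = trans (sym (ℤ.+-assoc ℤ.-[1+ m ] (ℤ.+ 1) (ℤ.+ j))) (trans (cong (ℤ._+ (ℤ.+ j)) (ℤ.+-comm ℤ.-[1+ m ] (ℤ.+ 1))) (ℤ.+-assoc (ℤ.+ 1) ℤ.-[1+ m ] (ℤ.+ j)))
  small : 2^ (a 0) ≤ y
  small = *-cancelʳ₀ (0<^ (suc m) 0<two) (begin
    2^ (a 0) * two ^ suc m  ≡⟨ cong (λ t → 2^ t * two ^ suc m) (ℤ.+-identityʳ ℤ.-[1+ m ]) ⟩
    2^ ℤ.-[1+ m ] * two ^ suc m     ≡⟨ 2^⁻ m ⟩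
    1ℚ                              ≤⟨ proj₂ arch ⟩
    toℚ (suc m) * y  ≤⟨ *-monoʳ₀ (<⇒≤ 0<y) (≤-trans (≤-trans (p≤p+q {toℚ (suc m)} {1ℚ} 0≤1) (≤-reflexive (+-comm (toℚ (suc m)) 1ℚ))) (1≤two^ (suc m))) ⟩
    two ^ suc m * y                 ≡⟨ *-comm (two ^ suc m) y ⟩
    y * two ^ suc m                 ∎)
  n = proj₁ (archimedean y)
  end : ¬ (2^ (a (suc m ℕ.+ n)) ≤ y)
  end h = <-irrefl refl (begin-strict
    y                         ≤⟨ proj₂ (archimedean y) ⟩
    toℚ n                     <⟨ p<p+q (positive⁻¹ 1ℚ) ⟩
    toℚ n + 1ℚ                ≡⟨ +-comm (toℚ n) 1ℚ ⟩
    1ℚ + toℚ n                ≤⟨ 1≤two^ n ⟩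
    two ^ n                   ≡⟨ 2^⁺ n ⟨
    2^ (ℤ.+ n)  ≡⟨ cong 2^_ (trans (sym (ℤ.+-assoc ℤ.-[1+ m ] (ℤ.+ suc m) (ℤ.+ n))) (trans (cong (ℤ._+ (ℤ.+ n)) (ℤ.+-inverseˡ (ℤ.+ suc m))) (ℤ.+-identityˡ (ℤ.+ n)))) ⟨
    2^ (a (suc m ℕ.+ n))      ≤⟨ h ⟩
    y                         ∎)
  last : ∃[ j ] (2^ (a j) ≤ y × ¬ (2^ (a (suc j)) ≤ y))
  last = last-holding (λ j → 2^ (a j) ≤? y) (suc m ℕ.+ n) small end

-- Binary logarithms

^ᵣ-seq : ∀ x k n → seq (x ^ᵣ k) n ≡ seq x n ^ k
^ᵣ-seq x zero    n = refl
^ᵣ-seq x (suc k) n = cong (seq x n *_) (^ᵣ-seq x k n)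

module Log (x : ℝ) (0<x : 0ℝ <ᵣ x) where

  c : ℚ
  c = proj₁ 0<x

  0<c : 0ℚ < c
  0<c = proj₁ (proj₂ 0<x)

  N₀ : ℕ
  N₀ = proj₁ (proj₂ (proj₂ 0<x))

  c≤x : ∀ n → N₀ ℕ.≤ n → c ≤ seq x n
  c≤x n n≥ = subst (_≤ seq x n) (+-identityˡ c) (proj₂ (proj₂ (proj₂ 0<x)) n n≥)

  y : ℝ
  y = x ⊔ᵣ fromℚ c

  t : ℕ → ℚ
  t n = seq y n

  c≤t : ∀ n → c ≤ t n
  c≤t n = p≤q⊔p (seq x n) c

  0<t : ∀ n → 0ℚ < t n
  0<t n = <-≤-trans 0<c (c≤t n)

  t≡x : ∀ n → N₀ ℕ.≤ n → t n ≡ seq x n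
  t≡x n n≥ = p≥q⇒p⊔q≡p (c≤x n n≥)

  abstract
    bracket : ∀ n → ∃[ a ] (2^ a ≤ t n ^ suc n × t n ^ suc n ≤ 2^ (ℤ.suc a))
    bracket n = floor-log (0<^ (suc n) (0<t n))

  a : ℕ → ℤ
  a n = proj₁ (bracket n)

  -- By `bracket`, log₂ (t n) lies between l n and l n + 1 / (n + 1): the (n + 1)-st power is taken
  -- in order to refine an integer bracket to this precision.
  l : ℕ → ℚ
  l n = a n / suc n

  a≡ : ∀ n → ι (a n) ≡ l n * toℚ (suc n)
  a≡ n = sym (/-*-ι (a n) (suc n))

  suc-a≡ : ∀ n → ι (ℤ.suc (a n)) ≡ (l n + recip n) * toℚ (suc n)
  suc-a≡ n = begin
    ι (ℤ.suc (a n))                                ≡⟨ ι-+ (ℤ.+ 1) (a n) ⟩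
    ι (ℤ.+ 1) + ι (a n)                            ≡⟨ +-comm (ι (ℤ.+ 1)) (ι (a n)) ⟩
    ι (a n) + ι (ℤ.+ 1)  ≡⟨ cong₂ _+_ (a≡ n) (trans ι-1 (trans (sym (*-1/⁺ (toℚ (suc n)) (0<toℚ-suc n))) (*-comm (toℚ (suc n)) (recip n)))) ⟩
    l n * toℚ (suc n) + recip n * toℚ (suc n)      ≡⟨ *-distribʳ-+ (toℚ (suc n)) (l n) (recip n) ⟨
    (l n + recip n) * toℚ (suc n)                  ∎
    where open ≡-Reasoning

  l-close : ∀ h {κ} → 0ℚ ≤ κ → κ ≤ 1ℚ → toℚ (suc h) * κ ≡ ½ → ∀ m n → ℚ.∣ t m - t n ∣ ≤ κ * c →
            l m ≤ l n + recip n + recip h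
  l-close h {κ} 0≤κ κ≤1 hκ m n close = log-close {b = m} {n} {a m} {ℤ.suc (a n)} {l m} {l n + recip n} h (0<t m) (<⇒≤ (0<t n)) 0≤κ κ≤1 hκ shrink
    (a≡ m) (suc-a≡ n) (proj₁ (proj₂ (bracket m))) (proj₂ (proj₂ (bracket n)))
    where
    open ≤-Reasoning
    -- As t is at least c, an absolute error κ c is a relative error of at most κ.
    shrink : (1ℚ - κ) * t m ≤ t n
    shrink = begin
      (1ℚ - κ) * t m             ≡⟨ expand κ (t m) ⟩
      t m - κ * t m              ≤⟨ +-monoˡ-≤ (- (κ * t m)) (abs≤⁻¹ (t m) (t n) close) ⟩
      t n + κ * c - κ * t m  ≤⟨ +-monoˡ-≤ (- (κ * t m)) (+-monoʳ-≤ (t n) (*-monoˡ₀ 0≤κ (c≤t m))) ⟩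
      t n + κ * t m - κ * t m    ≡⟨ cancel (t n) (κ * t m) ⟩
      t n                        ∎
      where
      expand : ∀ k t → (1ℚ - k) * t ≡ t - k * t
      expand = solve 2 (λ k t → (con 1ℚ :- k) :* t := t :- k :* t) refl
      cancel : ∀ p q → p + q - q ≡ p
      cancel = solve 2 (λ p q → p :+ q :- q := p) refl

  l-cauchy : ∀ ε → 0ℚ < ε → ∃[ N ] (∀ m n → N ℕ.≤ m → N ℕ.≤ n → ℚ.∣ l m - l n ∣ ≤ ε)
  l-cauchy ε 0<ε = N₁ ℕ.⊔ h , λ m n m≥ n≥ → abs≤ (bound m n m≥ n≥) (bound n m n≥ m≥)
    where
    h = proj₁ (recip-vanishes (½ * ε) (0<½* 0<ε))
    recip≤ : ∀ n → h ℕ.≤ n → recip n ≤ ½ * ε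
    recip≤ = proj₂ (recip-vanishes (½ * ε) (0<½* 0<ε))
    κ = ½ * recip h
    0<κ : 0ℚ < κ
    0<κ = 0<½* (0<recip h)
    hκ : toℚ (suc h) * κ ≡ ½
    hκ = trans (swap (toℚ (suc h)) (recip h)) (trans (cong (½ *_) (*-1/⁺ (toℚ (suc h)) (0<toℚ-suc h))) (*-identityʳ ½))
      where
      swap : ∀ p q → p * (½ * q) ≡ ½ * (p * q)
      swap = solve 2 (λ p q → p :* (con ½ :* q) := con ½ :* (p :* q)) refl
    κ≤1 : κ ≤ 1ℚ
    κ≤1 = begin
      κ                   ≡⟨ *-identityˡ κ ⟨
      1ℚ * κ              ≤⟨ *-monoʳ₀ (<⇒≤ 0<κ) (1≤toℚ-suc h) ⟩
      toℚ (suc h) * κ     ≡⟨ hκ ⟩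
      ½                   ≤⟨ p≤p+q (<⇒≤ (positive⁻¹ ½)) ⟩
      1ℚ                  ∎
      where open ≤-Reasoning
    0<κc : 0ℚ < κ * c
    0<κc = 0<* κ c 0<κ 0<c
    N₁ = proj₁ (cauchy y (κ * c) 0<κc)
    bound : ∀ m n → N₁ ℕ.⊔ h ℕ.≤ m → N₁ ℕ.⊔ h ℕ.≤ n → l m ≤ l n + ε
    bound m n m≥ n≥ = begin
      l m  ≤⟨ l-close h (<⇒≤ 0<κ) κ≤1 hκ m n (proj₂ (cauchy y (κ * c) 0<κc) m n (ℕ.m⊔n≤o⇒m≤o N₁ h m≥) (ℕ.m⊔n≤o⇒m≤o N₁ h n≥)) ⟩
      l n + recip n + recip h  ≤⟨ +-mono-≤ (+-monoʳ-≤ (l n) (recip≤ n (ℕ.m⊔n≤o⇒n≤o N₁ h n≥))) (recip≤ h ℕ.≤-refl) ⟩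
      l n + ½ * ε + ½ * ε            ≡⟨ +-assoc (l n) (½ * ε) (½ * ε) ⟩
      l n + (½ * ε + ½ * ε)          ≡⟨ cong (l n +_) (½*+½* ε) ⟩
      l n + ε                        ∎
      where open ≤-Reasoning

  log : ℝ
  log = mkℝ l l-cauchy

  -- If the power of t n fell short of the power of two by ε, then `log-above` would put l n a fixed
  -- amount k below q, although eventually q ≤ l n + k / 2.
  lower : ∀ q → fromℚ q ≤ᵣ log → fromℚ (2^ (↥ q)) ≤ᵣ x ^ᵣ ↧ₙ q
  lower q q≤log ε 0<ε = N₀ ℕ.⊔ N₁ , λ n n≥ →
    subst (λ u → 2^ (↥ q) ≤ u + ε) (trans (cong (_^ ↧ₙ q) (t≡x n (ℕ.m⊔n≤o⇒m≤o N₀ N₁ n≥))) (sym (^ᵣ-seq x (↧ₙ q) n)))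
      (decide n (ℕ.m⊔n≤o⇒n≤o N₀ N₁ n≥) (2^ (↥ q) ≤? t n ^ ↧ₙ q + ε))
    where
    gap : ∃[ k ] (0ℚ < k × (∀ y b a p → 0ℚ < y → ι a ≡ p * toℚ (suc b) → 2^ a ≤ y ^ suc b → y ^ ↧ₙ q + ε ≤ 2^ (↥ q) → p + k ≤ q))
    gap = log-above (↥ q) q (ℚ.denominator-1 q) (sym (q*↧q≡↥q q)) 0<ε
    k = proj₁ gap
    0<k = proj₁ (proj₂ gap)
    N₁ = proj₁ (q≤log (½ * k) (0<½* 0<k))
    decide : ∀ n → N₁ ℕ.≤ n → Dec (2^ (↥ q) ≤ t n ^ ↧ₙ q + ε) → 2^ (↥ q) ≤ t n ^ ↧ₙ q + ε
    decide n n≥ (yes h) = h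
    decide n n≥ (no h)  = contradiction (begin-strict
      q                        ≤⟨ proj₂ (q≤log (½ * k) (0<½* 0<k)) n n≥ ⟩
      l n + ½ * k              <⟨ p<p+q (0<½* 0<k) ⟩
      l n + ½ * k + ½ * k  ≡⟨ trans (+-assoc (l n) (½ * k) (½ * k)) (cong (l n +_) (½*+½* k)) ⟩
      l n + k  ≤⟨ proj₂ (proj₂ gap) (t n) n (a n) (l n) (0<t n) (a≡ n) (proj₁ (proj₂ (bracket n))) (<⇒≤ (≰⇒> h)) ⟩
      q                        ∎) (<-irrefl refl)
      where open ≤-Reasoning

  upper : ∀ q → log ≤ᵣ fromℚ q → x ^ᵣ ↧ₙ q ≤ᵣ fromℚ (2^ (↥ q))
  upper q log≤q ε 0<ε = N₀ ℕ.⊔ (N₁ ℕ.⊔ N₂) , λ n n≥ →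
    subst (_≤ 2^ (↥ q) + ε) (trans (cong (_^ ↧ₙ q) (t≡x n (ℕ.m⊔n≤o⇒m≤o N₀ (N₁ ℕ.⊔ N₂) n≥))) (sym (^ᵣ-seq x (↧ₙ q) n)))
      (decide n (ℕ.m⊔n≤o⇒n≤o N₀ (N₁ ℕ.⊔ N₂) n≥) (t n ^ ↧ₙ q ≤? 2^ (↥ q) + ε))
    where
    gap : ∃[ k ] (0ℚ < k × (∀ y b a p → 0ℚ < y → ι a ≡ p * toℚ (suc b) → y ^ suc b ≤ 2^ a → 2^ (↥ q) + ε ≤ y ^ ↧ₙ q → q + k ≤ p))
    gap = log-below (↥ q) q (ℚ.denominator-1 q) (sym (q*↧q≡↥q q)) 0<ε
    k = proj₁ gap
    0<k = proj₁ (proj₂ gap)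
    -- One quarter of the gap pays for the hypothesis on `log`, another for the distance from l n to
    -- the upper end l n + 1 / (n + 1) of the bracket.
    ε′ = ½ * (½ * k)
    0<ε′ : 0ℚ < ε′
    0<ε′ = 0<½* (0<½* 0<k)
    N₁ = proj₁ (log≤q ε′ 0<ε′)
    N₂ = proj₁ (recip-vanishes ε′ 0<ε′)
    decide : ∀ n → N₁ ℕ.⊔ N₂ ℕ.≤ n → Dec (t n ^ ↧ₙ q ≤ 2^ (↥ q) + ε) → t n ^ ↧ₙ q ≤ 2^ (↥ q) + ε
    decide n n≥ (yes h) = h
    decide n n≥ (no h)  = contradiction (begin-strict
      q + k  ≤⟨ proj₂ (proj₂ gap) (t n) n (ℤ.suc (a n)) (l n + recip n) (0<t n) (suc-a≡ n) (proj₂ (proj₂ (bracket n))) (<⇒≤ (≰⇒> h)) ⟩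
      l n + recip n  ≤⟨ +-mono-≤ (proj₂ (log≤q ε′ 0<ε′) n (ℕ.m⊔n≤o⇒m≤o N₁ N₂ n≥)) (proj₂ (recip-vanishes ε′ 0<ε′) n (ℕ.m⊔n≤o⇒n≤o N₁ N₂ n≥)) ⟩
      q + ε′ + ε′              ≡⟨ trans (+-assoc q ε′ ε′) (cong (q +_) (½*+½* (½ * k))) ⟩
      q + ½ * k                <⟨ p<p+q (0<½* 0<k) ⟩
      q + ½ * k + ½ * k        ≡⟨ trans (+-assoc q (½ * k) (½ * k)) (cong (q +_) (½*+½* k)) ⟩
      q + k                    ∎) (<-irrefl refl)
      where open ≤-Reasoning

  isLog₂ : IsLog₂ x log
  isLog₂ = 0<x , lower , upper

-- Counting edges by layers of degrees

does-true : ∀ {p} {P : Set p} (P? : Dec P) → does P? ≡ true → P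
does-true (yes p) _ = p

does-false : ∀ {p} {P : Set p} (P? : Dec P) → does P? ≡ false → ¬ P
does-false (no ¬p) _ = ¬p

argmin : ∀ {n} (f : Fin (suc n) → ℕ) → ∃[ v ] (∀ u → f v ℕ.≤ f u)
argmin {zero}  f = zero , λ where zero → ℕ.≤-refl
argmin {suc n} f with argmin (f ∘ suc)
... | v , v-min with ℕ.≤-total (f zero) (f (suc v))
... | inj₁ 0≤v = zero , λ where
  zero    → ℕ.≤-refl
  (suc u) → ℕ.≤-trans 0≤v (v-min u)
... | inj₂ v≤0 = suc v , λ where
  zero    → v≤0
  (suc u) → v-min u

count-drop : ∀ {n} {f g : Fin n → Bool} k → (∀ i → i ≢ k → f i ≡ true → g i ≡ true) → count f ℕ.≤ suc (count g)
count-drop {suc n} {f} {g} zero h with f zero | g zero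
... | true  | true  = ℕ.s≤s (ℕ.m≤n⇒m≤1+n (count-mono λ i → h (suc i) λ ()))
... | true  | false = ℕ.s≤s (count-mono λ i → h (suc i) λ ())
... | false | true  = ℕ.m≤n⇒m≤1+n (ℕ.m≤n⇒m≤1+n (count-mono λ i → h (suc i) λ ()))
... | false | false = ℕ.m≤n⇒m≤1+n (count-mono λ i → h (suc i) λ ())
count-drop {suc n} {f} {g} (suc k) h with f zero | g zero | h zero (λ ())
... | true  | true  | _ = ℕ.s≤s (count-drop k λ i i≢k → h (suc i) (i≢k ∘ Fin.suc-injective))
... | true  | false | e = contradiction (e refl) λ ()
... | false | true  | _ = ℕ.m≤n⇒m≤1+n (count-drop k λ i i≢k → h (suc i) (i≢k ∘ Fin.suc-injective))
... | false | false | _ = count-drop k λ i i≢k → h (suc i) (i≢k ∘ Fin.suc-injective)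

count-none : ∀ {n} {f : Fin n → Bool} → (∀ i → f i ≡ false) → count f ≡ 0
count-none {zero}  h = refl
count-none {suc n} {f} h with f zero | h zero
... | false | _ = count-none (h ∘ suc)

toℚ-count : ∀ {n} (f : Fin n → Bool) → toℚ (count f) ≡ sum (λ i → ⟦ f i ⟧)
toℚ-count {zero}  f = ι-0
toℚ-count {suc n} f = trans (head (f zero) (f ∘ suc)) (cong (⟦ f zero ⟧ +_) (toℚ-count (f ∘ suc)))
  where
  head : ∀ b (g : Fin n → Bool) → toℚ ∣ b ∷ tabulate g ∣ ≡ ⟦ b ⟧ + toℚ (count g)
  head true  g = toℚ-suc (count g)
  head false g = sym (+-identityˡ (toℚ (count g)))

total : ∀ {n} → (Fin n → ℕ) → ℕ
total = foldr ℕ._+_ 0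

total-mono : ∀ {n} {f g : Fin n → ℕ} → (∀ i → f i ℕ.≤ g i) → total f ℕ.≤ total g
total-mono {zero}  h = ℕ.z≤n
total-mono {suc n} h = ℕ.+-mono-≤ (h zero) (total-mono (h ∘ suc))

total-strict : ∀ {n} {f g : Fin n → ℕ} → (∀ i → f i ℕ.≤ g i) → ∀ k → f k ℕ.< g k → total f ℕ.< total g
total-strict h zero    fk<gk = ℕ.+-mono-<-≤ fk<gk (total-mono (h ∘ suc))
total-strict h (suc k) fk<gk = ℕ.+-mono-≤-< (h zero) (total-strict (h ∘ suc) k fk<gk)

hits : ∀ {n} → Fin n → Fin n → Fin n → Fin n → Bool
hits u v a b = (does (a ≟ u) ∧ does (b ≟ v)) ∨ (does (a ≟ v) ∧ does (b ≟ u))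

hits-sym : ∀ {n} (u v a b : Fin n) → hits u v a b ≡ hits u v b a
hits-sym u v a b = trans (cong₂ _∨_ (Bool.∧-comm (does (a ≟ u)) (does (b ≟ v))) (Bool.∧-comm (does (a ≟ v)) (does (b ≟ u))))
  (Bool.∨-comm (does (b ≟ v) ∧ does (a ≟ u)) (does (b ≟ u) ∧ does (a ≟ v)))

deleteEdge : ∀ {n} → Graph n → Fin n → Fin n → Graph n
deleteEdge G u v = record
  { adj    = λ a b → adj G a b ∧ not (hits u v a b)
  ; symm   = λ a b → cong₂ (λ s t → s ∧ not t) (symm G a b) (hits-sym u v a b)
  ; irrefl = λ a → cong (_∧ not (hits u v a a)) (irrefl G a)
  }

deleteEdge-⊑ : ∀ {n} (G : Graph n) u v → deleteEdge G u v ⊑ G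
deleteEdge-⊑ G u v a b h = proj₁ (∧-true⁻ _ _ h)

deleteEdge-adj : ∀ {n} (G : Graph n) u v a b → hits u v a b ≡ false → adj G a b ≡ true → adj (deleteEdge G u v) a b ≡ true
deleteEdge-adj G u v a b miss ab = cong₂ (λ s t → s ∧ not t) ab miss

deleteEdge-deleted : ∀ {n} (G : Graph n) u v → adj (deleteEdge G u v) u v ≡ false
deleteEdge-deleted G u v = trans (cong (λ t → adj G u v ∧ not t)
  (cong₂ (λ s t → (s ∧ t) ∨ (does (u ≟ v) ∧ does (v ≟ u))) (dec-true (u ≟ u) refl) (dec-true (v ≟ v) refl))) (Bool.∧-zeroʳ (adj G u v))

-- Only `u` and `v` lose a neighbour, at most one each, and both have one to spare above δ.
deleteEdge-degree : ∀ {n} (G : Graph n) u v a {δ} → δ ℕ.≤ degree G a →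
  δ ℕ.< degree G u → δ ℕ.< degree G v → δ ℕ.≤ degree (deleteEdge G u v) a
deleteEdge-degree G u v a {δ} δ≤a δ<u δ<v = cases (a ≟ u) (a ≟ v)
  where
  miss : ∀ b → ¬ (a ≡ u × b ≡ v) → ¬ (a ≡ v × b ≡ u) → hits u v a b ≡ false
  miss b h k with a ≟ u | b ≟ v | a ≟ v | b ≟ u
  ... | yes p | yes q | _     | _     = contradiction (p , q) h
  ... | yes _ | no _  | yes p | yes q = contradiction (p , q) k
  ... | yes _ | no _  | yes _ | no _  = refl
  ... | yes _ | no _  | no _  | _     = refl
  ... | no _  | _     | yes p | yes q = contradiction (p , q) k
  ... | no _  | _     | yes _ | no _  = refl
  ... | no _  | _     | no _  | _     = refl
  cases : Dec (a ≡ u) → Dec (a ≡ v) → δ ℕ.≤ degree (deleteEdge G u v) a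
  cases (yes refl) (yes refl) = ℕ.s≤s⁻¹ (ℕ.≤-trans δ<u (count-drop u λ b b≢u → deleteEdge-adj G u v a b (miss b (b≢u ∘ proj₂) (b≢u ∘ proj₂))))
  cases (yes refl) (no a≢v) = ℕ.s≤s⁻¹ (ℕ.≤-trans δ<u (count-drop v λ b b≢v → deleteEdge-adj G u v a b (miss b (b≢v ∘ proj₂) (a≢v ∘ proj₁))))
  cases (no a≢u) (yes refl) = ℕ.s≤s⁻¹ (ℕ.≤-trans δ<v (count-drop u λ b b≢u → deleteEdge-adj G u v a b (miss b (a≢u ∘ proj₁) (b≢u ∘ proj₂))))
  cases (no a≢u) (no a≢v) = ℕ.≤-trans δ≤a (count-mono λ b → deleteEdge-adj G u v a b (miss b (a≢u ∘ proj₁) (a≢v ∘ proj₁)))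

-- The vertex `r` witnesses that some vertex still has degree δ; this makes the size of that set
-- positive, so that it can be cancelled at the end.
record Trimmed {n} (G : Graph n) (δ : ℕ) (r : Fin n) : Set where
  field
    graph     : Graph n
    subgraph  : graph ⊑ G
    minDegree : ∀ v → δ ℕ.≤ degree graph v
    root      : degree graph r ≡ δ
    edges     : ∀ u v → adj graph u v ≡ true → ¬ (δ ℕ.< degree graph u × δ ℕ.< degree graph v)

-- The fuel exceeds the degree sum, which every deletion lowers. The degree of `r` cannot rise and
-- may not fall below δ, so it stays δ.
trim : ∀ {n} (G : Graph n) δ r fuel → total (degree G) ℕ.< fuel → (∀ v → δ ℕ.≤ degree G v) → degree G r ≡ δ → Trimmed G δ r
trim G δ r (suc fuel) (ℕ.s≤s enough) min-δ root
  with any? (λ u → any? (λ v → (adj G u v Bool.≟ true) ×-dec (δ ℕ.<? degree G u) ×-dec (δ ℕ.<? degree G v)))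
... | no none = record { graph = G ; subgraph = λ _ _ h → h ; minDegree = min-δ ; root = root
                       ; edges = λ u v uv big → none (u , v , uv , big) }
... | yes (u , v , uv , δ<u , δ<v) = record { Trimmed T ; subgraph = λ a b h → deleteEdge-⊑ G u v a b (Trimmed.subgraph T a b h) }
  where
  G′ : Graph _
  G′ = deleteEdge G u v
  G′-degree≤ : ∀ a → degree G′ a ℕ.≤ degree G a
  G′-degree≤ = degree-mono {K = G′} {G} (deleteEdge-⊑ G u v)
  min-δ′ : ∀ a → δ ℕ.≤ degree G′ a
  min-δ′ a = deleteEdge-degree G u v a (min-δ a) δ<u δ<v
  fewer : total (degree G′) ℕ.< total (degree G)
  fewer = total-strict G′-degree≤ u (count-strict (deleteEdge-⊑ G u v u) v (deleteEdge-deleted G u v) uv)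
  T : Trimmed G′ δ r
  T = trim G′ δ r fuel (ℕ.≤-trans fewer enough) min-δ′ (ℕ.≤-antisym (ℕ.≤-trans (G′-degree≤ r) (ℕ.≤-reflexive root)) (min-δ′ r))

module LayerCount {n} (G : Graph n) (δ : ℕ) (0<δ : 0 ℕ.< δ) (r : Fin n) (T : Trimmed G δ r) (d : ℚ) (0≤d : 0ℚ ≤ d)
  (4d≤δ : toℚ 4 * d ≤ toℚ δ)
  (square-degrees : ∀ H → H ⊑ G → ∀ a → sum (λ v → adjacency H a v * adjacency H a v) ≤ d * toℚ (Δ H) * sum (λ v → a v * a v)) where

  open Trimmed T renaming (graph to F; subgraph to F⊑G)

  α : Fin n → Bool
  α v = does (degree F v ℕ.≟ δ)

  α-true : ∀ v → α v ≡ true → degree F v ≡ δ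
  α-true v = does-true (degree F v ℕ.≟ δ)

  α-false : ∀ v → α v ≡ false → δ ℕ.< degree F v
  α-false v h = ℕ.≤∧≢⇒< (minDegree v) (does-false (degree F v ℕ.≟ δ) h ∘ sym)

  a : Fin n → ℚ
  a v = ⟦ α v ⟧

  m : ℚ
  m = sum a

  0<m : 0ℚ < m
  0<m = <-≤-trans (positive⁻¹ 1ℚ) (≤-trans (≤-reflexive (sym (cong ⟦_⟧ (dec-true (degree F r ℕ.≟ δ) root)))) (term≤sum (λ v → 0≤⟦⟧ (α v)) r))

  ⟦⟧² : ∀ b → ⟦ b ⟧ * ⟦ b ⟧ ≡ ⟦ b ⟧
  ⟦⟧² true  = *-identityˡ 1ℚ
  ⟦⟧² false = *-zeroˡ 0ℚ

  dA deg : Fin n → ℚ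
  dA = adjacency F a
  deg v = toℚ (degree F v)

  0≤dA : ∀ v → 0ℚ ≤ dA v
  0≤dA = preserves-0≤ (adjacency-positiveLinear F) λ v → 0≤⟦⟧ (α v)

  deg-adjacency : ∀ v → adjacency F (λ _ → 1ℚ) v ≡ deg v
  deg-adjacency v = trans (sum-cong-≗ {n} {λ j → ⟦ adj F v j ⟧ * 1ℚ} {λ j → ⟦ adj F v j ⟧} λ j → *-identityʳ ⟦ adj F v j ⟧)
    (sym (toℚ-count (adj F v)))

  -- The gain from trimming: no edge joins two vertices of degree above δ, so every neighbour of
  -- such a vertex is counted by `dA`.
  dA-outside : ∀ v → α v ≡ false → dA v ≡ deg v
  dA-outside v αv = trans (sum-cong-≗ {n} {λ j → ⟦ adj F v j ⟧ * a j} {λ j → ⟦ adj F v j ⟧ * 1ℚ} λ j → entry j (adj F v j) refl) (deg-adjacency v)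
    where
    entry : ∀ j b → adj F v j ≡ b → ⟦ adj F v j ⟧ * a j ≡ ⟦ adj F v j ⟧ * 1ℚ
    entry j true  vj = cong (λ b → ⟦ adj F v j ⟧ * ⟦ b ⟧) (Bool.¬-not λ αj → edges v j vj (α-false v αv , α-false j αj))
    entry j false vj = trans (cong (λ b → ⟦ b ⟧ * a j) vj) (trans (*-zeroˡ (a j)) (sym (trans (cong (λ b → ⟦ b ⟧ * 1ℚ) vj) (*-zeroˡ 1ℚ))))

  -- Double counting: by symmetry of adjacency the sum of `dA` is the degree sum over the vertices
  -- selected by `α`, each of degree δ.
  sum-dA : sum dA ≡ toℚ δ * m
  sum-dA = begin
    sum dA  ≡⟨ sum-cong-≗ {n} {λ v → 1ℚ * dA v} {dA} (λ v → *-identityˡ (dA v)) ⟨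
    sum (λ v → 1ℚ * dA v)                               ≡⟨ adjacency-selfAdjoint F (λ _ → 1ℚ) a ⟩
    sum (λ v → a v * adjacency F (λ _ → 1ℚ) v)  ≡⟨ sum-cong-≗ {n} {λ v → a v * adjacency F (λ _ → 1ℚ) v} {λ v → toℚ δ * a v} (λ v → trans (cong (a v *_) (deg-adjacency v)) (entry v (α v) refl)) ⟩
    sum (λ v → toℚ δ * a v)                             ≡⟨ *-distribˡ-sum (toℚ δ) a ⟨
    toℚ δ * m                                           ∎
    where
    open ≡-Reasoning
    entry : ∀ v b → α v ≡ b → a v * deg v ≡ toℚ δ * a v
    entry v true  αv = trans (cong (λ k → a v * toℚ k) (α-true v αv)) (*-comm (a v) (toℚ δ))
    entry v false αv = trans (cong (λ b → ⟦ b ⟧ * deg v) αv) (trans (*-zeroˡ (deg v)) (sym (trans (cong (λ b → toℚ δ * ⟦ b ⟧) αv) (*-zeroʳ (toℚ δ)))))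

  -- The square-degree inequality for the graph induced by `S` and the indicator `a`. As `S`
  -- contains the vertices of degree δ, no neighbour counted by `dA` at a vertex of `S` is lost.
  restricted : ∀ S D → (∀ v → α v ≡ true → S v ≡ true) → (∀ v → S v ≡ true → degree F v ℕ.≤ D) →
               sum (λ v → ⟦ S v ⟧ * (dA v * dA v)) ≤ d * toℚ D * m
  restricted S D α⊆S S≤D = begin
    sum (λ v → ⟦ S v ⟧ * (dA v * dA v))                  ≤⟨ sum-mono (λ v → row v (S v) refl) ⟩
    sum (λ v → adjacency H a v * adjacency H a v)  ≤⟨ square-degrees H (λ u v h → F⊑G u v (restrict-⊑ F S u v h)) a ⟩
    d * toℚ (Δ H) * sum (λ v → a v * a v)  ≡⟨ cong (d * toℚ (Δ H) *_) (sum-cong-≗ {n} {λ v → a v * a v} {a} (λ v → ⟦⟧² (α v))) ⟩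
    d * toℚ (Δ H) * m  ≤⟨ *-monoʳ₀ (<⇒≤ 0<m) (*-monoˡ₀ 0≤d (toℚ-mono (Δ≤ H λ v → small v (S v) refl))) ⟩
    d * toℚ D * m                                        ∎
    where
    open ≤-Reasoning
    H : Graph n
    H = restrict F S
    small : ∀ v b → S v ≡ b → degree H v ℕ.≤ D
    small v true  Sv = ℕ.≤-trans (degree-mono {K = H} {F} (restrict-⊑ F S) v) (S≤D v Sv)
    small v false Sv = ℕ.≤-trans (ℕ.≤-reflexive (count-none λ j →
      trans (cong (λ b → adj F v j ∧ (b ∧ S j)) Sv) (Bool.∧-zeroʳ (adj F v j)))) ℕ.z≤n
    entry : ∀ v → S v ≡ true → ∀ j b → α j ≡ b → ⟦ adj F v j ⟧ * a j ≡ ⟦ adj H v j ⟧ * a j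
    entry v Sv j true  αj = cong (λ b → ⟦ b ⟧ * a j) (sym (trans (cong₂ (λ s t → adj F v j ∧ (s ∧ t)) Sv (α⊆S j αj)) (Bool.∧-identityʳ (adj F v j))))
    entry v Sv j false αj = trans (cong (λ b → ⟦ adj F v j ⟧ * ⟦ b ⟧) αj) (trans (*-zeroʳ ⟦ adj F v j ⟧)
      (sym (trans (cong (λ b → ⟦ adj H v j ⟧ * ⟦ b ⟧) αj) (*-zeroʳ ⟦ adj H v j ⟧))))
    row : ∀ v b → S v ≡ b → ⟦ S v ⟧ * (dA v * dA v) ≤ adjacency H a v * adjacency H a v
    row v true  Sv = ≤-reflexive (trans (cong (λ b → ⟦ b ⟧ * (dA v * dA v)) Sv) (trans (*-identityˡ (dA v * dA v))
      (cong (λ x → x * x) (sum-cong-≗ {n} {λ j → ⟦ adj F v j ⟧ * a j} {λ j → ⟦ adj H v j ⟧ * a j} λ j → entry v Sv j (α j) refl))))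
    row v false Sv = subst (_≤ adjacency H a v * adjacency H a v)
      (sym (trans (cong (λ b → ⟦ b ⟧ * (dA v * dA v)) Sv) (*-zeroˡ (dA v * dA v)))) (0≤p*p (adjacency H a v))

  0<toℚδ : 0ℚ < toℚ δ
  0<toℚδ = <-≤-trans (0<toℚ-suc 0) (toℚ-mono 0<δ)

  -- From t δ ≤ t² + δ² / 4 and 4 d ≤ δ: at most half of the degrees of the vertices of degree δ stays inside.
  inner : sum (λ v → a v * dA v) + sum (λ v → a v * dA v) ≤ toℚ δ * m
  inner = *-cancelˡ₀ (0<* (toℚ δ) two 0<toℚδ (positive⁻¹ two)) (begin
    toℚ δ * two * (I + I)                    ≡⟨ four (toℚ δ) I ⟩
    two * two * (toℚ δ) * I  ≡⟨ *-distribˡ-sum (two * two * toℚ δ) (λ v → a v * dA v) ⟩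
    sum (λ v → two * two * toℚ δ * (a v * dA v))
                                             ≤⟨ sum-mono (λ v → pointwise (a v) (dA v) (toℚ δ) (0≤⟦⟧ (α v))) ⟩
    sum (λ v → two * two * (a v * (dA v * dA v)) + toℚ δ * toℚ δ * a v)
                                             ≡⟨ sum-linear (two * two) (λ v → a v * (dA v * dA v)) (toℚ δ * toℚ δ) a ⟩
    two * two * sum (λ v → a v * (dA v * dA v)) + toℚ δ * toℚ δ * m
                                             ≤⟨ +-monoˡ-≤ (toℚ δ * toℚ δ * m) (*-monoˡ₀ (0≤* 0≤two 0≤two) (restricted α δ (λ _ h → h) (λ v h → ℕ.≤-reflexive (α-true v h)))) ⟩
    two * two * (d * toℚ δ * m) + toℚ δ * toℚ δ * m
                                             ≡⟨ cong (_+ toℚ δ * toℚ δ * m) (assoc (two * two) d (toℚ δ) m) ⟩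
    two * two * d * (toℚ δ * m) + toℚ δ * toℚ δ * m
                                             ≤⟨ +-monoˡ-≤ (toℚ δ * toℚ δ * m) (*-monoʳ₀ (0≤* (0≤toℚ δ) (<⇒≤ 0<m)) (subst (λ t → t * d ≤ toℚ δ) (four-two) 4d≤δ)) ⟩
    toℚ δ * (toℚ δ * m) + toℚ δ * toℚ δ * m  ≡⟨ combine-two (toℚ δ) m ⟩
    toℚ δ * two * (toℚ δ * m)                ∎)
    where
    open ≤-Reasoning
    I = sum (λ v → a v * dA v)
    four-two : toℚ 4 ≡ two * two
    four-two = trans (toℚ-* 2 2) (cong (λ t → t * t) toℚ-2)
    four : ∀ e i → e * two * (i + i) ≡ two * two * e * i
    four = solve 2 (λ e i → e :* con (1ℚ + 1ℚ) :* (i :+ i) := con (1ℚ + 1ℚ) :* con (1ℚ + 1ℚ) :* e :* i) refl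
    assoc : ∀ f d e m → f * (d * e * m) ≡ f * d * (e * m)
    assoc = solve 4 (λ f d e m → f :* (d :* e :* m) := f :* d :* (e :* m)) refl
    combine-two : ∀ e m → e * (e * m) + e * e * m ≡ e * two * (e * m)
    combine-two = solve 2 (λ e m → e :* (e :* m) :+ e :* e :* m := e :* con (1ℚ + 1ℚ) :* (e :* m)) refl
    pointwise : ∀ a t e → 0ℚ ≤ a → two * two * e * (a * t) ≤ two * two * (a * (t * t)) + e * e * a
    pointwise a t e 0≤a = p≤q⇐0≤q-p (subst (0ℚ ≤_) (square a t e) (0≤* 0≤a (0≤p*p (two * t - e))))
      where
      square : ∀ a t e → a * ((two * t - e) * (two * t - e)) ≡ two * two * (a * (t * t)) + e * e * a - two * two * e * (a * t)
      square = solve 3 (λ a t e → a :* ((con (1ℚ + 1ℚ) :* t :- e) :* (con (1ℚ + 1ℚ) :* t :- e))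
        := con (1ℚ + 1ℚ) :* con (1ℚ + 1ℚ) :* (a :* (t :* t)) :+ e :* e :* a :- con (1ℚ + 1ℚ) :* con (1ℚ + 1ℚ) :* e :* (a :* t)) refl

  within beyond : ℕ → Fin n → Bool
  within D v = does (degree F v ℕ.≤? D)
  beyond D v = not (within D v)

  within-true : ∀ D v → within D v ≡ true → degree F v ℕ.≤ D
  within-true D v = does-true (degree F v ℕ.≤? D)

  beyond-true : ∀ D v → beyond D v ≡ true → D ℕ.< degree F v
  beyond-true D v h = ℕ.≰⇒> (does-false (degree F v ℕ.≤? D) (Bool.not-injective h))

  layer : ℕ → ℕ → Fin n → Bool
  layer D D′ v = beyond D v ∧ within D′ v

  -- In the layer D < deg v = dA v, so D (dA v) ≤ (dA v)². The squares over all degrees up to 2 D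
  -- sum to at most d (2 D) m, and D cancels.
  layer-bound : ∀ D → δ ℕ.≤ D → sum (λ v → ⟦ layer D (2 ℕ.* D) v ⟧ * dA v) ≤ two * d * m
  layer-bound D δ≤D = *-cancelˡ₀ 0<D (begin
    toℚ D * sum (λ v → ⟦ L v ⟧ * dA v)  ≡⟨ *-distribˡ-sum (toℚ D) (λ v → ⟦ L v ⟧ * dA v) ⟩
    sum (λ v → toℚ D * (⟦ L v ⟧ * dA v))            ≤⟨ sum-mono (λ v → row v (L v) refl) ⟩
    sum (λ v → ⟦ within (2 ℕ.* D) v ⟧ * (dA v * dA v)) ≤⟨ restricted (within (2 ℕ.* D)) (2 ℕ.* D)
                                                          (λ v αv → dec-true (degree F v ℕ.≤? 2 ℕ.* D) (ℕ.≤-trans (ℕ.≤-reflexive (α-true v αv)) (ℕ.≤-trans δ≤D (ℕ.m≤m+n D _))))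
                                                          (within-true (2 ℕ.* D)) ⟩
    d * toℚ (2 ℕ.* D) * m  ≡⟨ cong (λ t → d * t * m) (trans (toℚ-* 2 D) (cong (_* toℚ D) toℚ-2)) ⟩
    d * (two * toℚ D) * m                           ≡⟨ rearrange d two (toℚ D) m ⟩
    toℚ D * (two * d * m)                           ∎)
    where
    open ≤-Reasoning
    L : Fin n → Bool
    L = layer D (2 ℕ.* D)
    0<D : 0ℚ < toℚ D
    0<D = <-≤-trans 0<toℚδ (toℚ-mono δ≤D)
    rearrange : ∀ d t D m → d * (t * D) * m ≡ D * (t * d * m)
    rearrange = solve 4 (λ d t D m → d :* (t :* D) :* m := D :* (t :* d :* m)) refl
    row : ∀ v b → L v ≡ b → toℚ D * (⟦ L v ⟧ * dA v) ≤ ⟦ within (2 ℕ.* D) v ⟧ * (dA v * dA v)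
    row v false Lv = subst (_≤ ⟦ within (2 ℕ.* D) v ⟧ * (dA v * dA v))
      (sym (trans (cong (λ b → toℚ D * (⟦ b ⟧ * dA v)) Lv) (trans (cong (toℚ D *_) (*-zeroˡ (dA v))) (*-zeroʳ (toℚ D)))))
      (0≤* (0≤⟦⟧ (within (2 ℕ.* D) v)) (0≤p*p (dA v)))
    row v true Lv = begin
      toℚ D * (⟦ L v ⟧ * dA v)  ≡⟨ cong (toℚ D *_) (trans (cong (λ b → ⟦ b ⟧ * dA v) Lv) (*-identityˡ (dA v))) ⟩
      toℚ D * dA v  ≤⟨ *-monoʳ₀ (0≤dA v) (≤-trans (toℚ-mono (ℕ.<⇒≤ D<v)) (≤-reflexive (sym (dA-outside v αv)))) ⟩
      dA v * dA v  ≡⟨ trans (cong (λ b → ⟦ b ⟧ * (dA v * dA v)) (proj₂ (∧-true⁻ (beyond D v) (within (2 ℕ.* D) v) Lv))) (*-identityˡ (dA v * dA v)) ⟨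
      ⟦ within (2 ℕ.* D) v ⟧ * (dA v * dA v) ∎
      where
      D<v : D ℕ.< degree F v
      D<v = beyond-true D v (proj₁ (∧-true⁻ (beyond D v) (within (2 ℕ.* D) v) Lv))
      αv : α v ≡ false
      αv = dec-false (degree F v ℕ.≟ δ) λ e → ℕ.<-irrefl (sym e) (ℕ.≤-<-trans δ≤D D<v)

  scale-δ : ℕ → ℕ
  scale-δ t = 2 ℕ.^ t ℕ.* δ

  δ≤scale : ∀ t → δ ℕ.≤ scale-δ t
  δ≤scale t = ℕ.m≤n*m δ (2 ℕ.^ t) {{ℕ.m^n≢0 2 t}}

  outer : ∀ t → sum (λ v → ⟦ layer δ (scale-δ t) v ⟧ * dA v) ≤ toℚ t * (two * d * m)
  outer zero = ≤-reflexive (trans (sum-zero λ v → trans (cong (λ b → ⟦ b ⟧ * dA v) (none v)) (*-zeroˡ (dA v)))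
    (sym (trans (cong (_* (two * d * m)) ι-0) (*-zeroˡ (two * d * m)))))
    where
    none : ∀ v → layer δ (scale-δ 0) v ≡ false
    none v = trans (cong (λ k → not (within δ v) ∧ within k v) (ℕ.*-identityˡ δ)) (Bool.∧-inverseˡ (within δ v))
  outer (suc t) = begin
    sum (λ v → ⟦ layer δ (scale-δ (suc t)) v ⟧ * dA v)
      ≤⟨ sum-mono (λ v → *-monoʳ₀ (0≤dA v) (split (beyond δ v) (within (scale-δ t) v) (within (scale-δ (suc t)) v))) ⟩
    sum (λ v → (⟦ layer δ (scale-δ t) v ⟧ + ⟦ layer (scale-δ t) (scale-δ (suc t)) v ⟧) * dA v)
      ≡⟨ sum-cong-≗ {n} {λ v → (⟦ layer δ (scale-δ t) v ⟧ + ⟦ layer (scale-δ t) (scale-δ (suc t)) v ⟧) * dA v}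
           {λ v → ⟦ layer δ (scale-δ t) v ⟧ * dA v + ⟦ layer (scale-δ t) (scale-δ (suc t)) v ⟧ * dA v}
           (λ v → *-distribʳ-+ (dA v) ⟦ layer δ (scale-δ t) v ⟧ ⟦ layer (scale-δ t) (scale-δ (suc t)) v ⟧) ⟩
    sum (λ v → ⟦ layer δ (scale-δ t) v ⟧ * dA v + ⟦ layer (scale-δ t) (scale-δ (suc t)) v ⟧ * dA v)
      ≡⟨ ∑-distrib-+ (λ v → ⟦ layer δ (scale-δ t) v ⟧ * dA v) (λ v → ⟦ layer (scale-δ t) (scale-δ (suc t)) v ⟧ * dA v) ⟩
    sum (λ v → ⟦ layer δ (scale-δ t) v ⟧ * dA v) + sum (λ v → ⟦ layer (scale-δ t) (scale-δ (suc t)) v ⟧ * dA v)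
      ≤⟨ +-mono-≤ (outer t) (subst (λ k → sum (λ v → ⟦ layer (scale-δ t) k v ⟧ * dA v) ≤ E) (sym (ℕ.*-assoc 2 (2 ℕ.^ t) δ)) (layer-bound (scale-δ t) (δ≤scale t))) ⟩
    toℚ t * E + E
      ≡⟨ trans (cong (toℚ t * E +_) (sym (*-identityˡ E))) (trans (sym (*-distribʳ-+ E (toℚ t) 1ℚ)) (cong (_* E) (trans (+-comm (toℚ t) 1ℚ) (sym (toℚ-suc t))))) ⟩
    toℚ (suc t) * E ∎
    where
    open ≤-Reasoning
    E = two * d * m
    split : ∀ b w w′ → ⟦ b ∧ w′ ⟧ ≤ ⟦ b ∧ w ⟧ + ⟦ not w ∧ w′ ⟧
    split false w w′ = ≤-trans (≤-reflexive (sym (+-identityˡ 0ℚ))) (+-monoʳ-≤ 0ℚ (0≤⟦⟧ (not w ∧ w′)))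
    split true true w′ = ≤-trans (⟦⟧≤1 w′) (≤-reflexive (sym (+-identityʳ 1ℚ)))
    split true false w′ = ≤-reflexive (sym (+-identityˡ ⟦ w′ ⟧))

  layers : ∀ t → Δ F ℕ.≤ scale-δ t → toℚ δ ≤ toℚ 4 * d * toℚ t
  layers t Δ≤t = *-cancelʳ₀ 0<m (begin
    -- Writing s as 2 s - s lets `inner`, which bounds I + I by s, remove the inner part without a
    -- division; twice the outer part remains.
    toℚ δ * m                                        ≡⟨ double-minus (toℚ δ * m) ⟩
    two * (toℚ δ * m) - toℚ δ * m                    ≡⟨ cong (λ s → two * s - toℚ δ * m) sum-dA ⟨
    two * sum dA - toℚ δ * m  ≤⟨ +-monoˡ-≤ (- (toℚ δ * m)) (*-monoˡ₀ 0≤two (sum-mono λ v → cover v (α v) refl)) ⟩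
    two * sum (λ v → a v * dA v + ⟦ layer δ (scale-δ t) v ⟧ * dA v) - toℚ δ * m
      ≡⟨ cong (λ s → two * s - toℚ δ * m) (∑-distrib-+ (λ v → a v * dA v) (λ v → ⟦ layer δ (scale-δ t) v ⟧ * dA v)) ⟩
    two * (I + O) - toℚ δ * m                        ≡⟨ regroup I O (toℚ δ * m) ⟩
    two * O + (I + I - toℚ δ * m)  ≤⟨ +-mono-≤ (*-monoˡ₀ 0≤two (outer t)) (≤-trans (+-monoˡ-≤ (- (toℚ δ * m)) inner) (≤-reflexive (+-inverseʳ (toℚ δ * m)))) ⟩
    two * (toℚ t * (two * d * m)) + 0ℚ  ≡⟨ trans (+-identityʳ (two * (toℚ t * (two * d * m)))) (rearrange (toℚ t) d m) ⟩
    two * two * d * toℚ t * m  ≡⟨ cong (λ f → f * d * toℚ t * m) (trans (toℚ-* 2 2) (cong (λ t → t * t) toℚ-2)) ⟨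
    toℚ 4 * d * toℚ t * m                            ∎)
    where
    open ≤-Reasoning
    I = sum (λ v → a v * dA v)
    O = sum (λ v → ⟦ layer δ (scale-δ t) v ⟧ * dA v)
    double-minus : ∀ s → s ≡ two * s - s
    double-minus = solve 1 (λ s → s := con (1ℚ + 1ℚ) :* s :- s) refl
    regroup : ∀ i o s → two * (i + o) - s ≡ two * o + (i + i - s)
    regroup = solve 3 (λ i o s → con (1ℚ + 1ℚ) :* (i :+ o) :- s := con (1ℚ + 1ℚ) :* o :+ (i :+ i :- s)) refl
    rearrange : ∀ t d m → two * (t * (two * d * m)) ≡ two * two * d * t * m
    rearrange = solve 3 (λ t d m → con (1ℚ + 1ℚ) :* (t :* (con (1ℚ + 1ℚ) :* d :* m)) := con (1ℚ + 1ℚ) :* con (1ℚ + 1ℚ) :* d :* t :* m) refl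
    cover : ∀ v b → α v ≡ b → dA v ≤ a v * dA v + ⟦ layer δ (scale-δ t) v ⟧ * dA v
    cover v true  αv = ≤-trans (≤-reflexive (sym (trans (cong (λ b → ⟦ b ⟧ * dA v) αv) (*-identityˡ (dA v)))))
      (p≤p+q (0≤* (0≤⟦⟧ (layer δ (scale-δ t) v)) (0≤dA v)))
    cover v false αv = ≤-trans
      (≤-reflexive (sym (trans (cong (λ b → ⟦ b ⟧ * dA v) in-layer) (*-identityˡ (dA v)))))
      (≤-trans (p≤p+q (0≤* (0≤⟦⟧ (α v)) (0≤dA v))) (≤-reflexive (+-comm (⟦ layer δ (scale-δ t) v ⟧ * dA v) (a v * dA v))))
      where
      in-layer : layer δ (scale-δ t) v ≡ true
      in-layer = cong₂ (λ s t → not s ∧ t) (dec-false (degree F v ℕ.≤? δ) (ℕ.<⇒≱ (α-false v αv)))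
        (dec-true (degree F v ℕ.≤? scale-δ t) (ℕ.≤-trans (degree≤Δ F v) Δ≤t))

-- The degree bound

n<2^n : ∀ n → n ℕ.< 2 ℕ.^ n
n<2^n n = toℚ-cancel (≤-trans (≤-reflexive (toℚ-suc n)) (≤-trans (1≤two^ n) (≤-reflexive (sym (toℚ-^ n)))))

record DoublingTime (δ D : ℕ) (t : ℕ) : Set where
  field
    enough  : D ℕ.≤ 2 ℕ.^ t ℕ.* δ
    minimal : ∀ t′ → t ≡ suc t′ → 2 ℕ.^ t′ ℕ.* δ ℕ.< D

doublingTime : ∀ δ D → 0 ℕ.< δ → ∃[ t ] DoublingTime δ D t
doublingTime δ D 0<δ = decide (2 ℕ.^ 0 ℕ.* δ ℕ.<? D)
  where
  decide : Dec (2 ℕ.^ 0 ℕ.* δ ℕ.< D) → ∃[ t ] DoublingTime δ D t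
  decide (no ¬p) = 0 , record { enough = ℕ.≮⇒≥ ¬p ; minimal = λ _ () }
  decide (yes p) = suc (proj₁ last) , record
    { enough  = ℕ.≮⇒≥ (proj₂ (proj₂ last))
    ; minimal = λ where _ refl → proj₁ (proj₂ last)
    }
    where
    last : ∃[ j ] (2 ℕ.^ j ℕ.* δ ℕ.< D × ¬ (2 ℕ.^ suc j ℕ.* δ ℕ.< D))
    -- `D` is far enough for the search because D < 2^D and δ is positive.
    last = last-holding (λ j → 2 ℕ.^ j ℕ.* δ ℕ.<? D) D p
      (ℕ.≤⇒≯ (ℕ.≤-trans (ℕ.<⇒≤ (n<2^n D)) (ℕ.m≤m*n (2 ℕ.^ D) δ {{ℕ.>-nonZero 0<δ}})))

square-degrees : ∀ {n} (G : Graph n) d d′ → 0ℝ <ᵣ d → d ≤ᵣ fromℚ d′ → 0ℚ ≤ d′ → SpectrallyDegenerate d G →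
  ∀ H → H ⊑ G → ∀ a → sum (λ v → adjacency H a v * adjacency H a v) ≤ d′ * toℚ (Δ H) * sum (λ v → a v * a v)
square-degrees G d d′ 0<d d≤d′ 0≤d′ degenerate H H⊑G a = Components.square-degree-bound H d d′ 0<d d≤d′ 0≤d′
  (λ K K⊑H → degenerate K (⊑⇒⊆ᴳ {K = K} {G} (λ u v h → H⊑G u v (K⊑H u v h)))) a

min-degree≤layers : ∀ {n} (G : Graph n) d d′ → 0ℝ <ᵣ d → d ≤ᵣ fromℚ d′ → 0ℚ ≤ d′ → SpectrallyDegenerate d G →
  ∀ r δ → 0 ℕ.< δ → degree G r ≡ δ → (∀ v → δ ℕ.≤ degree G v) → toℚ 4 * d′ ≤ toℚ δ →
  ∀ t → Δ G ℕ.≤ 2 ℕ.^ t ℕ.* δ → toℚ δ ≤ toℚ 4 * d′ * toℚ t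
min-degree≤layers G d d′ 0<d d≤d′ 0≤d′ degenerate r δ 0<δ root min-δ 4d≤δ t Δ≤ =
  LayerCount.layers G δ 0<δ r T d′ 0≤d′ 4d≤δ (square-degrees G d d′ 0<d d≤d′ 0≤d′ degenerate) t
    (ℕ.≤-trans (Δ-mono {K = Trimmed.graph T} {G} (Trimmed.subgraph T)) Δ≤)
  where
  T : Trimmed G δ r
  T = trim G δ r (suc (total (degree G))) ℕ.≤-refl min-δ root

-- An upper bound `B` of d keeps the quotient away from 0. The inverse of d is formed after
-- truncation at c, so the bound in the denominator is B ⊔ c.
positive-quotient : ∀ k d (0<d : 0ℝ <ᵣ d) → 0ℝ <ᵣ fromℕ (suc k) ÷ᵣ d [ 0<d ]
positive-quotient k d 0<d@(c , 0<c , _) = 1/⁺ (B ⊔ c) 0<B⊔c , 0<1/⁺ (B ⊔ c) 0<B⊔c , N , λ n n≥ →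
  ≤-trans (≤-reflexive (+-identityˡ (1/⁺ (B ⊔ c) 0<B⊔c))) (below n (≤-trans (p≤∣p∣ (seq d n)) (proj₂ (proj₂ (proj₂ (bounded d))) n n≥)))
  where
  B = proj₁ (bounded d)
  N = proj₁ (proj₂ (proj₂ (bounded d)))
  0<B⊔c : 0ℚ < B ⊔ c
  0<B⊔c = <-≤-trans 0<c (p≤q⊔p B c)
  below : ∀ n → seq d n ≤ B → 1/⁺ (B ⊔ c) 0<B⊔c ≤ seq (fromℕ (suc k) ÷ᵣ d [ 0<d ]) n
  below n d≤B = begin
    1/⁺ (B ⊔ c) 0<B⊔c                       ≤⟨ 1/⁺-anti 0<t 0<B⊔c (⊔-mono-≤ d≤B (≤-refl {c})) ⟩
    1/⁺ (seq d n ⊔ c) 0<t                   ≡⟨ *-identityˡ (1/⁺ (seq d n ⊔ c) 0<t) ⟨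
    1ℚ * 1/⁺ (seq d n ⊔ c) 0<t  ≤⟨ *-monoʳ₀ (<⇒≤ (0<1/⁺ (seq d n ⊔ c) 0<t)) (≤-trans (1≤toℚ-suc k) (≤-reflexive (sym (fromℕ-seq (suc k) n)))) ⟩
    seq (fromℕ (suc k)) n * 1/⁺ (seq d n ⊔ c) 0<t ∎
    where
    open ≤-Reasoning
    0<t : 0ℚ < seq d n ⊔ c
    0<t = <-≤-trans 0<c (p≤q⊔p (seq d n) c)

quotient-seq : ∀ k d (0<d : 0ℝ <ᵣ d) → ∃[ N ] (∀ n → N ℕ.≤ n → 0ℚ < seq d n × seq (fromℕ k ÷ᵣ d [ 0<d ]) n * seq d n ≡ toℚ k)
quotient-seq k d 0<d@(c , 0<c , N , c≤d) = N , λ n n≥ →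
  <-≤-trans 0<c (≤-trans (≤-reflexive (sym (+-identityˡ c))) (c≤d n n≥)) ,
  cancel n (p≥q⇒p⊔q≡p (≤-trans (≤-reflexive (sym (+-identityˡ c))) (c≤d n n≥)))
  where
  cancel : ∀ n → seq d n ⊔ c ≡ seq d n → seq (fromℕ k ÷ᵣ d [ 0<d ]) n * seq d n ≡ toℚ k
  cancel n t≡d = begin
    seq (fromℕ k) n * 1/⁺ (seq d n ⊔ c) 0<t * seq d n  ≡⟨ cong (seq (fromℕ k) n * 1/⁺ (seq d n ⊔ c) 0<t *_) t≡d ⟨
    seq (fromℕ k) n * 1/⁺ (seq d n ⊔ c) 0<t * (seq d n ⊔ c)  ≡⟨ rearrange (seq (fromℕ k) n) (1/⁺ (seq d n ⊔ c) 0<t) (seq d n ⊔ c) ⟩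
    seq (fromℕ k) n * ((seq d n ⊔ c) * 1/⁺ (seq d n ⊔ c) 0<t)  ≡⟨ cong (seq (fromℕ k) n *_) (*-1/⁺ (seq d n ⊔ c) 0<t) ⟩
    seq (fromℕ k) n * 1ℚ  ≡⟨ trans (*-identityʳ (seq (fromℕ k) n)) (fromℕ-seq k n) ⟩
    toℚ k                                                        ∎
    where
    open ≡-Reasoning
    0<t : 0ℚ < seq d n ⊔ c
    0<t = <-≤-trans 0<c (p≤q⊔p (seq d n) c)
    rearrange : ∀ k v t → k * v * t ≡ k * (t * v)
    rearrange = solve 3 (λ k v t → k :* v :* t := k :* (t :* v)) refl

<ᵣ⇒≤ᵣ : ∀ x y → x <ᵣ y → x ≤ᵣ y
<ᵣ⇒≤ᵣ x y (η , 0<η , N , h) ε 0<ε = N , λ n n≥ → ≤-trans (p≤p+q (<⇒≤ 0<η)) (≤-trans (h n n≥) (p≤p+q (<⇒≤ 0<ε)))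

-- A literal fraction, so that its numerator and denominator reduce to t and 1 inside `IsLog₂`;
-- those of the abstract `toℚ` do not.
integral : ℕ → ℚ
integral t = mkℚ (ℤ.+ t) 0 (Coprimality.sym (Coprimality.1-coprimeTo t))

integral≡toℚ : ∀ t → integral t ≡ toℚ t
integral≡toℚ t = trans (sym (trans (cong (integral t *_) ι-1) (*-identityʳ (integral t)))) (q*↧q≡↥q (integral t))

-- If log₂ x < t then x ≤ 2 ^ t, whereas the minimality of t gives x = Δ / d ≥ 2 ^ (t + 1).
doublingTime≤log : ∀ k d (0<d : 0ℝ <ᵣ d) δ t → DoublingTime δ (suc k) (suc t) →
  ∃[ N ] (∀ n → N ℕ.≤ n → toℚ 4 * seq d n ≤ toℚ δ) → ∀ l → IsLog₂ (fromℕ (suc k) ÷ᵣ d [ 0<d ]) l →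
  fromℚ (integral (suc t)) ≤ᵣ l
doublingTime≤log k d 0<d δ t time (N₁ , 4d≤δ) l (_ , _ , upper) = ≮ᵣ⇒≥ᵣ (fromℚ q) l λ l<q →
  absurd (upper q (<ᵣ⇒≤ᵣ l (fromℚ q) l<q) ½ (positive⁻¹ ½))
  where
  q = integral (suc t)
  x = fromℕ (suc k) ÷ᵣ d [ 0<d ]
  large : ∀ n → N₁ ℕ.≤ n → 0ℚ < seq d n × seq x n * seq d n ≡ toℚ (suc k) → two * two ^ suc t ≤ seq x n
  large n n≥ (0<dn , xd) = *-cancelʳ₀ 0<dn (begin
    two * (two * two ^ t) * seq d n      ≡⟨ rearrange (two ^ t) (seq d n) ⟩
    two ^ t * (two * two * seq d n)  ≡⟨ cong (λ f → two ^ t * (f * seq d n)) (trans (toℚ-* 2 2) (cong (λ t → t * t) toℚ-2)) ⟨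
    two ^ t * (toℚ 4 * seq d n)          ≤⟨ *-monoˡ₀ (0≤^ t 0≤two) (4d≤δ n n≥) ⟩
    two ^ t * toℚ δ  ≡⟨ trans (toℚ-* (2 ℕ.^ t) δ) (cong (_* toℚ δ) (toℚ-^ t)) ⟨
    toℚ (2 ℕ.^ t ℕ.* δ)                  ≤⟨ toℚ-mono (ℕ.<⇒≤ (DoublingTime.minimal time t refl)) ⟩
    toℚ (suc k)                          ≡⟨ xd ⟨
    seq x n * seq d n                    ∎)
    where
    open ≤-Reasoning
    rearrange : ∀ p d → two * (two * p) * d ≡ p * (two * two * d)
    rearrange = solve 2 (λ p d → con (1ℚ + 1ℚ) :* (con (1ℚ + 1ℚ) :* p) :* d := p :* (con (1ℚ + 1ℚ) :* con (1ℚ + 1ℚ) :* d)) refl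
  absurd : ¬ (∃[ N ] (∀ n → N ℕ.≤ n → seq (x ^ᵣ ↧ₙ q) n ≤ 2^ (↥ q) + ½))
  absurd (N₃ , h) = <-irrefl refl (begin-strict
    two ^ suc t + ½                 <⟨ +-monoʳ-< (two ^ suc t) (p<p+q {½} (positive⁻¹ ½)) ⟩
    two ^ suc t + 1ℚ  ≤⟨ +-monoʳ-≤ (two ^ suc t) (≤-trans (p≤p+q (0≤toℚ (suc t))) (1≤two^ (suc t))) ⟩
    two ^ suc t + two ^ suc t       ≡⟨ double (two ^ suc t) ⟩
    two * two ^ suc t  ≤⟨ large n (ℕ.≤-trans (ℕ.m≤m⊔n N₁ N₂) (ℕ.m≤m⊔n (N₁ ℕ.⊔ N₂) N₃)) (proj₂ (quotient-seq (suc k) d 0<d) n (ℕ.≤-trans (ℕ.m≤n⊔m N₁ N₂) (ℕ.m≤m⊔n (N₁ ℕ.⊔ N₂) N₃))) ⟩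
    seq x n                         ≡⟨ *-identityʳ (seq x n) ⟨
    seq x n ^ 1                     ≡⟨ ^ᵣ-seq x 1 n ⟨
    seq (x ^ᵣ 1) n                  ≤⟨ h n (ℕ.m≤n⊔m (N₁ ℕ.⊔ N₂) N₃) ⟩
    2^ (ℤ.+ suc t) + ½              ≡⟨ cong (_+ ½) (2^⁺ (suc t)) ⟩
    two ^ suc t + ½                 ∎)
    where
    open ≤-Reasoning
    N₂ = proj₁ (quotient-seq (suc k) d 0<d)
    n = N₁ ℕ.⊔ N₂ ℕ.⊔ N₃
    double : ∀ p → p + p ≡ two * p
    double = solve 1 (λ p → p :+ p := con (1ℚ + 1ℚ) :* p) refl

module Contradiction {n} (d : ℝ) (0<d : 0ℝ <ᵣ d) (G : Graph (suc n)) (degenerate : SpectrallyDegenerate d G)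
  (r : Fin (suc n)) (r-min : ∀ v → degree G r ℕ.≤ degree G v) (k : ℕ) (Δ≡ : Δ G ≡ suc k) (l : ℝ)
  (isLog : IsLog₂ (fromℕ (suc k) ÷ᵣ d [ 0<d ]) l) (ε : ℚ) (0<ε : 0ℚ < ε) (N : ℕ)
  (4d+ε≤ : ∀ m → N ℕ.≤ m → toℚ 4 * seq d m + ε ≤ toℚ (degree G r))
  (4dl+ε≤ : ∀ m → N ℕ.≤ m → toℚ 4 * seq d m * seq l m + ε ≤ toℚ (degree G r)) where

  δ : ℕ
  δ = degree G r

  4d≤δ : ∀ m → N ℕ.≤ m → toℚ 4 * seq d m ≤ toℚ δ
  4d≤δ m m≥ = ≤-trans (p≤p+q (<⇒≤ 0<ε)) (4d+ε≤ m m≥)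

  Nd : ℕ
  Nd = proj₁ (quotient-seq (suc k) d 0<d)

  0<dm : ∀ m → Nd ℕ.≤ m → 0ℚ < seq d m
  0<dm m m≥ = proj₁ (proj₂ (quotient-seq (suc k) d 0<d) m m≥)

  0<δ : 0 ℕ.< δ
  0<δ = ℕ.≰⇒> λ δ≤0 → <-irrefl refl (<-≤-trans 0<ε (begin
    ε                            ≤⟨ p≤p+q (0≤* (0≤toℚ 4) (<⇒≤ (0<dm m (ℕ.m≤n⊔m N Nd)))) ⟩
    ε + toℚ 4 * seq d m          ≡⟨ +-comm ε (toℚ 4 * seq d m) ⟩
    toℚ 4 * seq d m + ε          ≤⟨ 4d+ε≤ m (ℕ.m≤m⊔n N Nd) ⟩
    toℚ δ                        ≤⟨ toℚ-mono δ≤0 ⟩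
    toℚ 0                        ≡⟨ ι-0 ⟩
    0ℚ                           ∎))
    where
    open ≤-Reasoning
    m = N ℕ.⊔ Nd

  t : ℕ
  t = proj₁ (doublingTime δ (suc k) 0<δ)

  time : DoublingTime δ (suc k) t
  time = proj₂ (doublingTime δ (suc k) 0<δ)

  -- Replacing d by a rational above it at distance η raises 4 d by 4 η and 4 d t by 4 η t. With `t`
  -- fixed beforehand, a quarter of ε covers both.
  small-η : ∃[ η ] (0ℚ < η × η ≤ 1ℚ × η * (toℚ 4 * (1ℚ + toℚ t)) ≤ ½ * (½ * ε))
  small-η = small-divisor (0≤* (0≤toℚ 4) (0≤+ 0≤1 (0≤toℚ t))) (0<½* (0<½* 0<ε))

  η : ℚ
  η = proj₁ small-η

  0<η : 0ℚ < η
  0<η = proj₁ (proj₂ small-η)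

  4η+4ηt≤ : toℚ 4 * η + toℚ 4 * η * toℚ t ≤ ½ * (½ * ε)
  4η+4ηt≤ = ≤-trans (≤-reflexive (rearrange (toℚ 4) η (toℚ t))) (proj₂ (proj₂ (proj₂ small-η)))
    where
    rearrange : ∀ f e t → f * e + f * e * t ≡ e * (f * (1ℚ + t))
    rearrange = solve 3 (λ f e t → f :* e :+ f :* e :* t := e :* (f :* (con 1ℚ :+ t))) refl

  -- The bound t ≤ l + θ will be multiplied by 4 d, which is at most δ; this may cost half of ε.
  -- Together with the quarter spent on η it stays strictly below ε.
  small-θ : ∃[ θ ] (0ℚ < θ × θ ≤ 1ℚ × θ * toℚ δ ≤ ½ * ε)
  small-θ = small-divisor (0≤toℚ δ) (0<½* 0<ε)

  θ : ℚ
  θ = proj₁ small-θ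

  Nη : ℕ
  Nη = proj₁ (cauchy d η 0<η)

  quarter<half : ½ * (½ * ε) < ½ * ε
  quarter<half = subst (½ * (½ * ε) <_) (½*+½* (½ * ε)) (p<p+q (0<½* (0<½* 0<ε)))

  -- `d′` is built from the term of d at the index `m` at which l is read too, so the bound through
  -- `t` and the assumed gap ε are compared within one term of the sequences.
  module At (m : ℕ) (m≥N : N ℕ.≤ m) (m≥Nd : Nd ℕ.≤ m) (m≥Nη : Nη ℕ.≤ m) where

    dm d′ : ℚ
    dm = seq d m
    d′ = dm + η

    d≤d′ : d ≤ᵣ fromℚ d′
    d≤d′ ε′ 0<ε′ = Nη , λ n n≥ → ≤-trans (abs≤⁻¹ (seq d n) dm (proj₂ (cauchy d η 0<η) n m n≥ m≥Nη)) (p≤p+q (<⇒≤ 0<ε′))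

    0≤d′ : 0ℚ ≤ d′
    0≤d′ = 0≤+ (<⇒≤ (0<dm m m≥Nd)) (<⇒≤ 0<η)

    4d′≤δ : toℚ 4 * d′ ≤ toℚ δ
    4d′≤δ = begin
      toℚ 4 * (dm + η)               ≡⟨ *-distribˡ-+ (toℚ 4) dm η ⟩
      toℚ 4 * dm + toℚ 4 * η  ≤⟨ +-monoʳ-≤ (toℚ 4 * dm) (≤-trans (p≤p+q (0≤* (0≤* (0≤toℚ 4) (<⇒≤ 0<η)) (0≤toℚ t))) 4η+4ηt≤) ⟩
      toℚ 4 * dm + ½ * (½ * ε)  ≤⟨ +-monoʳ-≤ (toℚ 4 * dm) (≤-trans (<⇒≤ quarter<half) (≤-trans (p≤p+q (<⇒≤ (0<½* 0<ε))) (≤-reflexive (½*+½* ε)))) ⟩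
      toℚ 4 * dm + ε                 ≤⟨ 4d+ε≤ m m≥N ⟩
      toℚ δ                          ∎
      where open ≤-Reasoning

    δ≤ : toℚ δ ≤ toℚ 4 * d′ * toℚ t
    δ≤ = min-degree≤layers G d d′ 0<d d≤d′ 0≤d′ degenerate r δ 0<δ refl r-min 4d′≤δ t
      (ℕ.≤-trans (ℕ.≤-reflexive Δ≡) (DoublingTime.enough time))

    t≤l⇒⊥ : ¬ (toℚ t ≤ seq l m + θ)
    t≤l⇒⊥ t≤l = <-irrefl refl (begin-strict
      toℚ 4 * dm * seq l m + ε                      ≤⟨ 4dl+ε≤ m m≥N ⟩
      toℚ δ                                         ≤⟨ δ≤ ⟩
      toℚ 4 * (dm + η) * toℚ t                      ≡⟨ expand (toℚ 4) dm η (toℚ t) ⟩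
      toℚ 4 * dm * toℚ t + toℚ 4 * η * toℚ t        ≤⟨ +-mono-≤ (*-monoˡ₀ 0≤4d t≤l) (≤-trans
                                                         (≤-trans (p≤p+q (0≤* (0≤toℚ 4) (<⇒≤ 0<η))) (≤-reflexive (+-comm (toℚ 4 * η * toℚ t) (toℚ 4 * η)))) 4η+4ηt≤) ⟩
      toℚ 4 * dm * (seq l m + θ) + ½ * (½ * ε)  ≡⟨ cong (_+ ½ * (½ * ε)) (trans (*-distribˡ-+ (toℚ 4 * dm) (seq l m) θ) (cong (toℚ 4 * dm * seq l m +_) (*-comm (toℚ 4 * dm) θ))) ⟩
      toℚ 4 * dm * seq l m + θ * (toℚ 4 * dm) + ½ * (½ * ε)
                                                    ≤⟨ +-monoˡ-≤ (½ * (½ * ε)) (+-monoʳ-≤ (toℚ 4 * dm * seq l m) (≤-trans (*-monoˡ₀ (<⇒≤ (proj₁ (proj₂ small-θ))) (4d≤δ m m≥N)) (proj₂ (proj₂ (proj₂ small-θ))))) ⟩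
      toℚ 4 * dm * seq l m + ½ * ε + ½ * (½ * ε)  <⟨ +-monoʳ-< (toℚ 4 * dm * seq l m + ½ * ε) quarter<half ⟩
      toℚ 4 * dm * seq l m + ½ * ε + ½ * ε  ≡⟨ trans (+-assoc (toℚ 4 * dm * seq l m) (½ * ε) (½ * ε)) (cong (toℚ 4 * dm * seq l m +_) (½*+½* ε)) ⟩
      toℚ 4 * dm * seq l m + ε                      ∎)
      where
      open ≤-Reasoning
      0≤4d : 0ℚ ≤ toℚ 4 * dm
      0≤4d = 0≤* (0≤toℚ 4) (<⇒≤ (0<dm m m≥Nd))
      expand : ∀ f d e t → f * (d + e) * t ≡ f * d * t + f * e * t
      expand = solve 4 (λ f d e t → f :* (d :+ e) :* t := f :* d :* t :+ f :* e :* t) refl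

    -- With no layers the counting bound would give δ ≤ 0. The case is excluded separately because
    -- the comparison of `t` with the logarithm uses the minimality of a positive `t`.
    t≢0 : ¬ (t ≡ 0)
    t≢0 t≡0 = ℕ.<⇒≱ 0<δ (toℚ-cancel (begin
      toℚ δ                        ≤⟨ δ≤ ⟩
      toℚ 4 * d′ * toℚ t           ≡⟨ cong (λ t → toℚ 4 * d′ * toℚ t) t≡0 ⟩
      toℚ 4 * d′ * toℚ 0           ≡⟨ trans (cong (toℚ 4 * d′ *_) ι-0) (*-zeroʳ (toℚ 4 * d′)) ⟩
      0ℚ                           ≡⟨ ι-0 ⟨
      toℚ 0                        ∎))
      where open ≤-Reasoning

  t≤l : ∀ t′ → t ≡ suc t′ → ∃[ N ] (∀ m → N ℕ.≤ m → toℚ t ≤ seq l m + θ)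
  t≤l t′ t≡ = proj₁ bound , λ m m≥ → subst (_≤ seq l m + θ)
    (trans (integral≡toℚ (suc t′)) (cong toℚ (sym t≡))) (proj₂ bound m m≥)
    where
    bound : ∃[ N ] (∀ m → N ℕ.≤ m → integral (suc t′) ≤ seq l m + θ)
    bound = doublingTime≤log k d 0<d δ t′ (subst (DoublingTime δ (suc k)) t≡ time) (N , 4d≤δ) l isLog θ (proj₁ (proj₂ small-θ))

  impossible : ⊥
  impossible = cases t refl
    where
    M : ℕ
    M = N ℕ.⊔ Nd ℕ.⊔ Nη
    N≤M : N ℕ.≤ M
    N≤M = ℕ.≤-trans (ℕ.m≤m⊔n N Nd) (ℕ.m≤m⊔n (N ℕ.⊔ Nd) Nη)
    Nd≤M : Nd ℕ.≤ M
    Nd≤M = ℕ.≤-trans (ℕ.m≤n⊔m N Nd) (ℕ.m≤m⊔n (N ℕ.⊔ Nd) Nη)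
    Nη≤M : Nη ℕ.≤ M
    Nη≤M = ℕ.m≤n⊔m (N ℕ.⊔ Nd) Nη
    cases : ∀ t′ → t ≡ t′ → ⊥
    cases zero     t≡ = At.t≢0 M N≤M Nd≤M Nη≤M t≡
    cases (suc t′) t≡ = At.t≤l⇒⊥ m (ℕ.≤-trans N≤M M≤m) (ℕ.≤-trans Nd≤M M≤m) (ℕ.≤-trans Nη≤M M≤m)
      (proj₂ (t≤l t′ t≡) m (ℕ.m≤n⊔m M (proj₁ (t≤l t′ t≡))))
      where
      m : ℕ
      m = M ℕ.⊔ proj₁ (t≤l t′ t≡)
      M≤m : M ℕ.≤ m
      M≤m = ℕ.m≤m⊔n M (proj₁ (t≤l t′ t≡))

≈ᵣ-refl : ∀ x → x ≈ᵣ x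
≈ᵣ-refl x ε 0<ε = 0 , λ n _ → ≤-trans (≤-reflexive (cong ℚ.∣_∣ (+-inverseʳ (seq x n)))) (<⇒≤ 0<ε)

max-seq : ∀ f d l n → seq (f *ᵣ d ⊔ᵣ f *ᵣ d *ᵣ l) n ≡ (seq f n * seq d n) ⊔ (seq f n * seq d n * seq l n)
max-seq f d l n = refl

fromℕ4-max-seq : ∀ d l n → seq (fromℕ 4 *ᵣ d ⊔ᵣ fromℕ 4 *ᵣ d *ᵣ l) n ≡ (toℚ 4 * seq d n) ⊔ (toℚ 4 * seq d n * seq l n)
fromℕ4-max-seq d l n = trans (max-seq (fromℕ 4) d l n)
  (cong (λ f → (f * seq d n) ⊔ (f * seq d n * seq l n)) (fromℕ-seq 4 n))

-- The maximum degree is generalised to `D` so that `IsDegreeBound` reduces by cases. For D = 0 all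
-- degrees vanish. Otherwise a strict violation gives one ε and one index that serve both terms of
-- the maximum.
degree-bound : ∀ {n} (d : ℝ) (0<d : 0ℝ <ᵣ d) (G : Graph (suc n)) → SpectrallyDegenerate d G →
  ∀ r → (∀ v → degree G r ℕ.≤ degree G v) → ∀ D → Δ G ≡ D →
  ∃[ β ] (IsDegreeBound d 0<d D β × fromℕ (degree G r) ≤ᵣ β)
degree-bound d 0<d G degenerate r r-min zero Δ≡ = fromℕ 4 *ᵣ d , ≈ᵣ-refl (fromℕ 4 *ᵣ d) , λ ε 0<ε →
  proj₁ 0≤4d , λ n n≥ → ≤-trans (≤-reflexive (trans (fromℕ-seq (degree G r) n) (trans (cong toℚ degree≡0) ι-0)))
    (0≤+ (subst (0ℚ ≤_) (*-comm (seq d n) (seq (fromℕ 4) n)) (proj₂ 0≤4d n n≥)) (<⇒≤ 0<ε))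
  where
  degree≡0 : degree G r ≡ 0
  degree≡0 = ℕ.n≤0⇒n≡0 (ℕ.≤-trans (degree≤Δ G r) (ℕ.≤-reflexive Δ≡))
  0≤4d : ∃[ N ] (∀ n → N ℕ.≤ n → 0ℚ ≤ seq d n * seq (fromℕ 4) n)
  0≤4d = eventually-nonNeg d 0<d 4
degree-bound d 0<d G degenerate r r-min (suc k) Δ≡ = β , (l , isLog₂ , ≈ᵣ-refl β) , ≮ᵣ⇒≥ᵣ (fromℕ (degree G r)) β not-below
  where
  open Log (fromℕ (suc k) ÷ᵣ d [ 0<d ]) (positive-quotient k d 0<d) using (isLog₂) renaming (log to l)
  β : ℝ
  β = fromℕ 4 *ᵣ d ⊔ᵣ fromℕ 4 *ᵣ d *ᵣ l
  not-below : ¬ (β <ᵣ fromℕ (degree G r))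
  not-below (ε , 0<ε , N , h) = Contradiction.impossible d 0<d G degenerate r r-min k Δ≡ l isLog₂ ε 0<ε N
    (λ m m≥ → ≤-trans (+-monoˡ-≤ ε (p≤p⊔q (toℚ 4 * seq d m) (toℚ 4 * seq d m * seq l m))) (below m m≥))
    (λ m m≥ → ≤-trans (+-monoˡ-≤ ε (p≤q⊔p (toℚ 4 * seq d m) (toℚ 4 * seq d m * seq l m))) (below m m≥))
    where
    below : ∀ m → N ℕ.≤ m → (toℚ 4 * seq d m) ⊔ (toℚ 4 * seq d m * seq l m) + ε ≤ toℚ (degree G r)
    below m m≥ = subst₂ (λ s t → s + ε ≤ t) (fromℕ4-max-seq d l m) (fromℕ-seq (degree G r) m) (h m m≥)

theorem1p3 : ∀ {n : ℕ} (d : ℝ) (0<d : 0ℝ <ᵣ d) (G : Graph (suc n)) → SpectrallyDegenerate d G →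
    ∃[ v ] ∃[ β ] (IsDegreeBound d 0<d (Δ G) β × fromℕ (degree G v) ≤ᵣ β)
theorem1p3 d 0<d G degenerate = let v , v-min = argmin (degree G) in
  v , degree-bound d 0<d G degenerate v v-min (Δ G) refl
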